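{- Let $L=\mathbb{Q}(\sqrt m,\sqrt n)$ be a biquadratic extension of $\mathbb{Q}$ with $m,n$ square-free, $m\equiv3\pmod 4$ and $n\equiv2\pmod 4$. Let $d=\gcd(m,n)$, $k=\frac{mn}{d^2}$, and let $H_1,H_2,H_3$ be the non-classical Hopf-Galois structures on $L/\mathbb{Q}$ corresponding to $\sqrt m,\sqrt n,\sqrt k$ respectively. For $i\in\{1,2,3\}$, $\mathcal{O}_L$ is $\mathfrak{A}_{H_i}$-free if and only if there exist integers $x,y\in\mathbb{Z}$ such that at least one of the following two equations (one for each sign) is satisfied: 1. $x^2+my^2=\pm4d$, if $i=1$. 2. $x^2+ny^2=\pm2d$, if $i=2$. 3. $x^2+ky^2=\pm2\frac nd$, if $i=3$. If that is the case, then a free generator of $\mathcal{O}_L$ as $\mathfrak{A}_{H_i}$-module is $$\beta=\begin{cases}\gamma_1+\gamma_2+\frac{x-dy}{2d}\,\gamma_3+y\,\gamma_4 & \text{if } i=1,\\ \gamma_1+\frac{x}{2d}\,\gamma_2+\frac{1-y}{2}\,\gamma_3+y\,\gamma_4 & \text{if } i=2,\\ \gamma_1+\frac y2\,\gamma_2+\frac{xd-n}{2n}\,\gamma_3+\gamma_4 & \text{if } i=3,\end{cases}$$ where $\gamma_1=1,\ \gamma_2=\sqrt m,\ \gamma_3=\sqrt n,\ \gamma_4=\frac{\sqrt n+\sqrt k}{2}$.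
   Context: $L=\mathbb{Q}(\sqrt m,\sqrt n)$ has Galois group $C_2\times C_2$; its quadratic subfields are $\mathbb{Q}(\sqrt m),\mathbb{Q}(\sqrt n),\mathbb{Q}(\sqrt k)$, with $\sqrt k=\sqrt m\sqrt n/d$ and $d=\gcd(m,n)>0$. Here $k\equiv 2\pmod 4$ and $\{\gamma_1,\gamma_2,\gamma_3,\gamma_4\}$ is an integral basis of $L$. A Hopf-Galois structure on $L/\mathbb{Q}$ is a finite-dimensional cocommutative $\mathbb{Q}$-Hopf algebra $H$ with an action making $L$ a left $H$-module algebra such that $L\otimes_{\mathbb{Q}} H\to\mathrm{End}_{\mathbb{Q}}(L)$, $x\otimes h\mapsto(y\mapsto x(h\cdot y))$ is bijective. Besides the classical one $\mathbb{Q}[\mathrm{Gal}(L/\mathbb{Q})]$, there are exactly three, one for each $\zeta\in\{\sqrt m,\sqrt n,\sqrt k\}$. Explicitly, let $\tau$ generate $\mathrm{Gal}(L/\mathbb{Q}(\zeta))$ and let $\sigma\in\mathrm{Gal}(L/\mathbb{Q})\setminus\langle\tau\rangle$; since the action is faithful, the structure corresponding to $\zeta$ is identified, as an algebra acting on $L$, with the subalgebra of $\mathrm{End}_{\mathbb{Q}}(L)$ having $\mathbb{Q}$-basis $\mathrm{id},\ \tau,\ \sigma+\sigma\tau,\ \zeta(\sigma-\sigma\tau)$. The associated order is $\mathfrak{A}_H=\{h\in H: h\cdot\mathcal{O}_L\subseteq\mathcal{O}_L\}$; "$\mathcal{O}_L$ is $\mathfrak{A}_H$-free" means free (of rank one)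 as $\mathfrak{A}_H$-module, and a free generator is a $\beta\in\mathcal{O}_L$ such that $\mathfrak{A}_H\to\mathcal{O}_L$, $h\mapsto h\cdot\beta$, is bijective. -}

module Defs where

open import Algebra.Bundles.Raw using (RawRing)
open import Algebra.Morphism.Structures using (module RingMorphisms)
open import Data.Integer as ℤ using (ℤ; +_; ∣_∣)
open import Data.Integer.Divisibility using (_∣_)
open import Data.Integer.GCD using (gcd)
import Data.Integer.Properties as ℤₚ
open import Data.List using (List; []; _∷_)
import Data.Nat.Base as ℕ
import Data.Nat.Divisibility as ℕ
import Data.Nat.GCD as ℕ
open import Data.Nat.GeneralisedArithmetic using (iterate)
open import Data.Product using (Σ; ∃; _×_; _,_; proj₁)
open import Data.Rational as ℚ using (ℚ; 0ℚ; 1ℚ; ½)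
open import Data.Rational.Literals using (fromℤ)
open import Data.Sum using (_⊎_)
open import Function.Definitions using (Bijective)
open import Level using (0ℓ)
open import Relation.Binary.PropositionalEquality using (_≡_; refl)
open import Relation.Nullary using (¬_; contradiction)

Squarefree : ℤ → Set
Squarefree a = ∀ b → b ℤ.* b ∣ a → ∣ b ∣ ≡ 1

squarefree⇒nonZero : ∀ a → Squarefree a → ℤ.NonZero a
squarefree⇒nonZero a sf = ℤ.≢-nonZero {a} λ { refl → contradiction (sf (+ 2) (4 ℕ.∣0)) λ () }

infixl 7 _//_
_//_ : (a b : ℤ) .{{_ : ℤ.NonZero b}} → ℚ
a // b = fromℤ a ℚ.÷ fromℤ b

-- ⟨ a₀ , a₁ , a₂ , a₃ ⟩ stands for a₀ + a₁√m + a₂√n + a₃√m√n.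
record L : Set where
  constructor ⟨_,_,_,_⟩
  field
    c₀ c₁ c₂ c₃ : ℚ

data Index : Set where
  one two three : Index

-- For square-free m ≡ 3 and n ≡ 2 (mod 4), none of m, n, mn is a square in ℚ, so
-- the ring structure put on L, that of ℚ[X,Y]/(X² - m, Y² - n), is the field ℚ(√m,√n).
module Biquadratic (m n : ℤ) .{{_ : ℤ.NonZero m}} .{{_ : ℤ.NonZero n}} where

  d : ℤ
  d = gcd m n

  d≢0 : ℤ.NonZero d
  d≢0 = ℕ.≢-nonZero λ eq → ℕ.≢-nonZero⁻¹ ∣ m ∣ (ℕ.gcd[m,n]≡0⇒m≡0 eq)

  -- Private, so that instance search in importing modules does not see them.
  private instance
    d-nonZero : ℤ.NonZero d
    d-nonZero = d≢0

    d*d-nonZero : ℤ.NonZero (d ℤ.* d)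
    d*d-nonZero = ℤₚ.i*j≢0 d d

    2*d-nonZero : ℤ.NonZero (+ 2 ℤ.* d)
    2*d-nonZero = ℤₚ.i*j≢0 (+ 2) d

    2*n-nonZero : ℤ.NonZero (+ 2 ℤ.* n)
    2*n-nonZero = ℤₚ.i*j≢0 (+ 2) n

  -- Both integer divisions are exact.
  k n/d : ℤ
  k   = (m ℤ.* n) ℤ./ (d ℤ.* d)
  n/d = n ℤ./ d

  infixl 6 _+_ _-_
  infixl 7 _*_
  infixr 7 _·_

  _+_ : L → L → L
  ⟨ a₀ , a₁ , a₂ , a₃ ⟩ + ⟨ b₀ , b₁ , b₂ , b₃ ⟩ =
    ⟨ a₀ ℚ.+ b₀ , a₁ ℚ.+ b₁ , a₂ ℚ.+ b₂ , a₃ ℚ.+ b₃ ⟩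

  -_ : L → L
  - ⟨ a₀ , a₁ , a₂ , a₃ ⟩ = ⟨ ℚ.- a₀ , ℚ.- a₁ , ℚ.- a₂ , ℚ.- a₃ ⟩

  _-_ : L → L → L
  x - y = x + (- y)

  _·_ : ℚ → L → L
  q · ⟨ a₀ , a₁ , a₂ , a₃ ⟩ = ⟨ q ℚ.* a₀ , q ℚ.* a₁ , q ℚ.* a₂ , q ℚ.* a₃ ⟩

  _*_ : L → L → L
  ⟨ a₀ , a₁ , a₂ , a₃ ⟩ * ⟨ b₀ , b₁ , b₂ , b₃ ⟩ =
    ⟨ a₀ ℚ.* b₀ ℚ.+ M ℚ.* (a₁ ℚ.* b₁) ℚ.+ N ℚ.* (a₂ ℚ.* b₂) ℚ.+ M ℚ.* N ℚ.* (a₃ ℚ.* b₃)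
    , a₀ ℚ.* b₁ ℚ.+ a₁ ℚ.* b₀ ℚ.+ N ℚ.* (a₂ ℚ.* b₃ ℚ.+ a₃ ℚ.* b₂)
    , a₀ ℚ.* b₂ ℚ.+ a₂ ℚ.* b₀ ℚ.+ M ℚ.* (a₁ ℚ.* b₃ ℚ.+ a₃ ℚ.* b₁)
    , a₀ ℚ.* b₃ ℚ.+ a₃ ℚ.* b₀ ℚ.+ a₁ ℚ.* b₂ ℚ.+ a₂ ℚ.* b₁ ⟩
    where
    M N : ℚ
    M = fromℤ m
    N = fromℤ n

  0L 1L √m √n √k : L
  0L = ⟨ 0ℚ , 0ℚ , 0ℚ , 0ℚ ⟩
  1L = ⟨ 1ℚ , 0ℚ , 0ℚ , 0ℚ ⟩
  √m = ⟨ 0ℚ , 1ℚ , 0ℚ , 0ℚ ⟩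
  √n = ⟨ 0ℚ , 0ℚ , 1ℚ , 0ℚ ⟩
  √k = (+ 1 // d) · (√m * √n)

  L-rawRing : RawRing 0ℓ 0ℓ
  L-rawRing = record
    { Carrier = L ; _≈_ = _≡_ ; _+_ = _+_ ; _*_ = _*_ ; -_ = -_ ; 0# = 0L ; 1# = 1L }

  open RingMorphisms L-rawRing L-rawRing using (IsRingIsomorphism)

  record IsAutomorphism (σ : L → L) : Set where
    field
      isRingIsomorphism : IsRingIsomorphism σ
      fixes-ℚ           : ∀ q → σ (q · 1L) ≡ q · 1L

  IsPowerOf : (L → L) → (L → L) → Set
  IsPowerOf τ ρ = ∃ λ j → ∀ x → ρ x ≡ iterate τ x j

  -- Gal(L/ℚ(ζ)) consists of the automorphisms fixing ζ.  It is finite, so the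
  -- powers of τ with natural exponents already exhaust the subgroup ⟨τ⟩.
  record IsGaloisPair (ζ : L) (τ σ : L → L) : Set where
    field
      τ-automorphism : IsAutomorphism τ
      τ-fixes-ζ      : τ ζ ≡ ζ
      τ-generates    : ∀ ρ → IsAutomorphism ρ → ρ ζ ≡ ζ → IsPowerOf τ ρ
      σ-automorphism : IsAutomorphism σ
      σ∉⟨τ⟩          : ¬ IsPowerOf τ σ

  -- The Hopf-Galois structure attached to ζ, as a ℚ-subspace of End_ℚ(L): the span of
  -- id, τ, σ + στ and ζ(σ - στ), with endomorphisms taken up to pointwise equality.
  HopfGalois : (ζ : L) (τ σ : L → L) → (L → L) → Set
  HopfGalois ζ τ σ h = ∃ λ q₀ → ∃ λ q₁ → ∃ λ q₂ → ∃ λ q₃ → ∀ x →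
    h x ≡ q₀ · x + q₁ · τ x + q₂ · (σ x + σ (τ x)) + q₃ · (ζ * (σ x - σ (τ x)))

  -- c₀ ∷ … ∷ cᵣ₋₁ ∷ [] encodes the monic polynomial c₀ + c₁X + … + cᵣ₋₁Xʳ⁻¹ + Xʳ.
  evalMonic : List ℤ → L → L
  evalMonic []       x = 1L
  evalMonic (c ∷ cs) x = fromℤ c · 1L + x * evalMonic cs x

  IsIntegral : L → Set
  IsIntegral x = ∃ λ cs → evalMonic cs x ≡ 0L

  𝒪 : Set
  𝒪 = Σ L IsIntegral

  _≈𝒪_ : 𝒪 → 𝒪 → Set
  x ≈𝒪 y = proj₁ x ≡ proj₁ y

  record AssociatedOrder (H : (L → L) → Set) : Set where
    field
      act        : L → L
      act∈H      : H act
      preserves𝒪 : ∀ {x} → IsIntegral x → IsIntegral (act x)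

  module _ {H : (L → L) → Set} where
    open AssociatedOrder

    _≈𝔄_ : AssociatedOrder H → AssociatedOrder H → Set
    h ≈𝔄 h′ = ∀ x → act h x ≡ act h′ x

    _▷_ : AssociatedOrder H → 𝒪 → 𝒪
    h ▷ (x , x∈𝒪) = act h x , preserves𝒪 h x∈𝒪

  IsFreeGenerator : ((L → L) → Set) → L → Set
  IsFreeGenerator H β = Σ (IsIntegral β) λ β∈𝒪 →
    Bijective (_≈𝔄_ {H}) _≈𝒪_ (_▷ (β , β∈𝒪))

  𝒪-IsFree : ((L → L) → Set) → Set
  𝒪-IsFree H = ∃ (IsFreeGenerator H)

  γ₁ γ₂ γ₃ γ₄ : L
  γ₁ = 1L
  γ₂ = √m
  γ₃ = √n
  γ₄ = ½ · (√n + √k)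

  ζ : Index → L
  ζ one   = √m
  ζ two   = √n
  ζ three = √k

  _≡±_ : ℤ → ℤ → Set
  a ≡± b = a ≡ b ⊎ a ≡ ℤ.- b

  Equation : Index → ℤ → ℤ → Set
  Equation one   x y = (x ℤ.* x ℤ.+ m ℤ.* (y ℤ.* y)) ≡± (+ 4 ℤ.* d)
  Equation two   x y = (x ℤ.* x ℤ.+ n ℤ.* (y ℤ.* y)) ≡± (+ 2 ℤ.* d)
  Equation three x y = (x ℤ.* x ℤ.+ k ℤ.* (y ℤ.* y)) ≡± (+ 2 ℤ.* n/d)

  β : Index → ℤ → ℤ → L
  β one   x y = γ₁ + γ₂ + ((x ℤ.- d ℤ.* y) // (+ 2 ℤ.* d)) · γ₃ + fromℤ y · γ₄
  β two   x y = γ₁ + (x // (+ 2 ℤ.* d)) · γ₂ + ((+ 1 ℤ.- y) // + 2) · γ₃ + fromℤ y · γ₄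
  β three x y = γ₁ + (y // + 2) · γ₂ + ((x ℤ.* d ℤ.- n) // (+ 2 ℤ.* n)) · γ₃ + γ₄

{-# OPTIONS --safe #-}
-- Write d = gcd(m,n), m = dm′, n = 2dh and L = ℚ(ζ) ⊕ ℚ(ζ)η.  The structure attached to ζ consists
-- of the maps 1 ↦ A, ζ ↦ Bζ, wη ↦ (Cw + Eζw̄)η, where w̄ is the conjugate of w ∈ ℚ(ζ).  In suitable
-- rational coordinates they act by (u,v,w,z) ↦ (Au, Bv, Cw - Epz, Cz + Eqw) with (p,q) = (m′,d),
-- (h,2d), (h,2m′) for ζ = √m, √n, √k, and 𝒪 is the part of ℤ⁴ satisfying one parity condition.
-- Evaluating at a few lattice points determines the associated order.  For u = v = 1 the element
-- generates 𝒪 exactly when qw² + pz², the determinant of (C,E) ↦ (Cw - Epz, Cz + Eqw), is ±4 for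
-- ζ = √m and ±1 otherwise; after scaling these are the displayed equations.
-- The powers of an integral element have bounded denominators over ℤ[√m,√n].  That property passes
-- to sums, products and conjugates, so traces and norms to the quadratic subfields determine 𝒪.
module Submission where

open import Defs
open import Data.Integer using (ℤ; _%ℕ_)
open import Data.Product using (∃; _×_)
open import Function.Bundles using (_⇔_)
open import Relation.Binary.PropositionalEquality using (_≡_)

open import Algebra.Bundles using (CommutativeRing)
open import Algebra.Morphism.Structures using (module RingMorphisms)
open import Data.Empty using (⊥; ⊥-elim)
open import Data.Integer as ℤ using (+_)
open import Data.Integer.Divisibility.Signed using (divides) renaming (_∣_ to _∣ₛ_)
open import Data.Integer.GCD using (gcd)
import Data.Integer.Properties as ℤₚ
import Data.Integer.Tactic.RingSolver as ℤ-solver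
open import Data.List using (List; []; _∷_; length)
open import Data.Nat.Base as ℕ using (ℕ; zero; suc)
open import Data.Nat.GeneralisedArithmetic using (iterate)
import Data.Nat.Properties as ℕₚ
open import Data.Product using (∃₂; _,_; proj₁; proj₂)
open import Data.Rational as ℚ using (ℚ; 0ℚ; 1ℚ; ½; ↥_; ↧_)
open import Data.Rational.Literals using (fromℤ)
import Data.Rational.Properties as ℚₚ
open import Data.Sum using (_⊎_; inj₁; inj₂)
open import Function using (_∘_)
open import Function.Bundles using (mk⇔)
open import Level using (0ℓ)
open import Relation.Binary.PropositionalEquality
open import Relation.Nullary using (¬_; yes; no; contradiction)
open import Tactic.RingSolver using (solve-∀; solve)

-- Take η = `√n` for ζ = `√m` and η = `√m` otherwise, so that τη = -η. On ℚ(ζ) the map τ is the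
-- identity and ζ(σ - στ) vanishes, so id + τ and σ + στ give arbitrary A and B. On ℚ(ζ)η the map σ
-- + στ vanishes, id - τ gives C, and ζ(σ - στ) sends wη to ±2ζw̄η; the sign, which a Galois pair
-- leaves open, is absorbed by E. The value ±4 for ζ = `√m` is a ratio of covolumes. There the
-- parity condition lies inside the (w, z)-block, where 𝒪 has covolume 2 while the admissible pairs
-- (C, E) have covolume 1/2. For the other ζ the condition ties the block to v, and the admissible
-- scalars satisfy a matching condition between B and C, so the ratio is 1. Integrality means the
-- existence of a monic polynomial, and none is at hand for a sum or a product. Bounded denominators
-- pass to sums and products directly, and for a rational number they force an integer. The converse
-- inclusion does exhibit a polynomial: the quadratic equation over ℚ(√m), multiplied by its
-- conjugate.

module Integers where

  open import Data.Integer
  open import Data.Integer.Divisibility.Signed using (_∣_; divides; quotient; ∣ᵤ⇒∣; ∣⇒∣ᵤ)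
  open _∣_ using (equality)
  open import Data.Integer.DivMod using (n%d<d; a≡a%n+[a/n]*n; a≡a%ℕn+[a/ℕn]*n)
  open import Data.Integer.GCD using (gcd[i,j]∣i; gcd[i,j]∣j; gcd[i,j]≡0⇒j≡0)
  open import Data.Integer.Properties
  open import Data.Integer.Tactic.RingSolver using () renaming (solve-∀ to solve-∀-ℤ)
  import Data.Nat.Divisibility as ℕ
  import Data.Nat.GCD as ℕ
  open import Function using (case_of_)

  -- Units and Bézout identities over ℤ.

  ≢-nonZero⁻¹ : ∀ i .{{_ : NonZero i}} → i ≢ 0ℤ
  ≢-nonZero⁻¹ i = ℕ.≢-nonZero⁻¹ ∣ i ∣ ∘ cong ∣_∣

  ∣i∣≡s*i : ∀ i → ∃ λ s → + ∣ i ∣ ≡ s * i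
  ∣i∣≡s*i i with +∣i∣≡i⊎+∣i∣≡-i i
  ... | inj₁ eq = 1ℤ , trans eq (sym (*-identityˡ i))
  ... | inj₂ eq = -1ℤ , trans eq (sym (-1*i≡-i i))

  ∣i∣≡1⇒ : ∀ i → ∣ i ∣ ≡ 1 → i ≡ 1ℤ ⊎ i ≡ -1ℤ
  ∣i∣≡1⇒ (+ _)    refl = inj₁ refl
  ∣i∣≡1⇒ -[1+ _ ] refl = inj₂ refl

  ∣i∣≡1⇒i*i≡1 : ∀ i → ∣ i ∣ ≡ 1 → i * i ≡ 1ℤ
  ∣i∣≡1⇒i*i≡1 i eq with ∣i∣≡1⇒ i eq
  ... | inj₁ refl = refl
  ... | inj₂ refl = refl

  i*j≡1⇒∣i∣≡1 : ∀ i j → i * j ≡ 1ℤ → ∣ i ∣ ≡ 1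
  i*j≡1⇒∣i∣≡1 i j eq = ℕₚ.m*n≡1⇒m≡1 ∣ i ∣ ∣ j ∣ (trans (sym (abs-* i j)) (cong ∣_∣ eq))

  -- The identity over ℕ is a subtraction in one of two orientations, hence two clauses; the signs
  -- `s` and `t` turn absolute values back into multiples of `a` and `b`.
  bézout-gcd : ∀ a b → ∃₂ λ α β → α * a + β * b ≡ gcd a b
  bézout-gcd a b with ∣i∣≡s*i a | ∣i∣≡s*i b | ℕ.Bézout.identity (ℕ.gcd-GCD ∣ a ∣ ∣ b ∣)
  ... | s , p | t , q | ℕ.Bézout.+- x y eq = + x * s , - (+ y * t) , (begin
    + x * s * a + - (+ y * t) * b ≡⟨ rearrange (+ x) s a (+ y) t b ⟩
    + x * (s * a) - + y * (t * b) ≡⟨ cong₂ (λ u v → + x * u - + y * v) p q ⟨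
    + x * + ∣ a ∣ - + y * + ∣ b ∣ ≡⟨ cong₂ _-_ (pos-* x ∣ a ∣) (pos-* y ∣ b ∣) ⟨
    + (x ℕ.* ∣ a ∣) - + (y ℕ.* ∣ b ∣) ≡⟨ cong (λ u → + u - + (y ℕ.* ∣ b ∣)) eq ⟨
    + (g ℕ.+ y ℕ.* ∣ b ∣) - + (y ℕ.* ∣ b ∣) ≡⟨ cong (_- + (y ℕ.* ∣ b ∣)) (pos-+ g (y ℕ.* ∣ b ∣)) ⟩
    + g + + (y ℕ.* ∣ b ∣) - + (y ℕ.* ∣ b ∣) ≡⟨ cancel (+ g) (+ (y ℕ.* ∣ b ∣)) ⟩
    + g ∎)
    where
    open ≡-Reasoning
    g = ℕ.gcd ∣ a ∣ ∣ b ∣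
    rearrange : ∀ x s a y t b → x * s * a + - (y * t) * b ≡ x * (s * a) - y * (t * b)
    rearrange = solve-∀-ℤ
    cancel : ∀ u v → u + v - v ≡ u
    cancel = solve-∀-ℤ
  ... | s , p | t , q | ℕ.Bézout.-+ x y eq = - (+ x * s) , + y * t , (begin
    - (+ x * s) * a + + y * t * b ≡⟨ rearrange (+ x) s a (+ y) t b ⟩
    + y * (t * b) - + x * (s * a) ≡⟨ cong₂ (λ u v → + y * v - + x * u) p q ⟨
    + y * + ∣ b ∣ - + x * + ∣ a ∣ ≡⟨ cong₂ _-_ (pos-* y ∣ b ∣) (pos-* x ∣ a ∣) ⟨
    + (y ℕ.* ∣ b ∣) - + (x ℕ.* ∣ a ∣) ≡⟨ cong (λ u → + u - + (x ℕ.* ∣ a ∣)) eq ⟨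
    + (g ℕ.+ x ℕ.* ∣ a ∣) - + (x ℕ.* ∣ a ∣) ≡⟨ cong (_- + (x ℕ.* ∣ a ∣)) (pos-+ g (x ℕ.* ∣ a ∣)) ⟩
    + g + + (x ℕ.* ∣ a ∣) - + (x ℕ.* ∣ a ∣) ≡⟨ cancel (+ g) (+ (x ℕ.* ∣ a ∣)) ⟩
    + g ∎)
    where
    open ≡-Reasoning
    g = ℕ.gcd ∣ a ∣ ∣ b ∣
    rearrange : ∀ x s a y t b → - (x * s) * a + y * t * b ≡ y * (t * b) - x * (s * a)
    rearrange = solve-∀-ℤ
    cancel : ∀ u v → u + v - v ≡ u
    cancel = solve-∀-ℤ

  Comaximal : ℤ → ℤ → Set
  Comaximal a b = ∃₂ λ α β → α * a + β * b ≡ 1ℤ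

  comaximal-sym : ∀ {a b} → Comaximal a b → Comaximal b a
  comaximal-sym {a} {b} (α , β , eq) = β , α , trans (+-comm (β * b) (α * a)) eq

  gcd-factors : ∀ a b → ∃₂ λ a₁ b₁ → a ≡ a₁ * gcd a b × b ≡ b₁ * gcd a b
  gcd-factors a b = quotient p , quotient q , equality p , equality q
    where
    p : gcd a b ∣ a
    p = ∣ᵤ⇒∣ {gcd a b} {a} (gcd[i,j]∣i a b)
    q : gcd a b ∣ b
    q = ∣ᵤ⇒∣ {gcd a b} {b} (gcd[i,j]∣j a b)

  comaximal-quotients : ∀ {a b g} a₁ b₁ .{{_ : NonZero g}} → a ≡ a₁ * g → b ≡ b₁ * g →
    (∃₂ λ α β → α * a + β * b ≡ g) → Comaximal a₁ b₁
  comaximal-quotients {a} {b} {g} a₁ b₁ p q (α , β , r) = α , β , *-cancelʳ-≡ (α * a₁ + β * b₁) 1ℤ g (begin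
    (α * a₁ + β * b₁) * g ≡⟨ expand α β a₁ b₁ g ⟩
    α * (a₁ * g) + β * (b₁ * g) ≡⟨ cong₂ (λ u v → α * u + β * v) p q ⟨
    α * a + β * b ≡⟨ r ⟩
    g ≡⟨ *-identityˡ g ⟨
    1ℤ * g ∎)
    where
    open ≡-Reasoning
    expand : ∀ α β a₁ b₁ g → (α * a₁ + β * b₁) * g ≡ α * (a₁ * g) + β * (b₁ * g)
    expand = solve-∀-ℤ

  gcd-split : ∀ a b .{{_ : NonZero b}} →
    ∃ λ g → NonZero g × ∃₂ λ a₁ b₁ → a ≡ a₁ * g × b ≡ b₁ * g × Comaximal a₁ b₁
  gcd-split a b = let a₁ , b₁ , p , q = gcd-factors a b in
    gcd a b , g≢0 , a₁ , b₁ , p , q , comaximal-quotients a₁ b₁ {{g≢0}} p q (bézout-gcd a b)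
    where
    g≢0 : NonZero (gcd a b)
    g≢0 = ≢-nonZero (≢-nonZero⁻¹ b ∘ gcd[i,j]≡0⇒j≡0 {a} {b})

  -- Each term of the squared Bézout identity contains x² or y; after multiplication by b both kinds
  -- are multiples of x².
  comaximal-cancel-square : ∀ {x y b} → Comaximal x y → x * x ∣ y * b → x * x ∣ b
  comaximal-cancel-square {x} {y} {b} (α , β , eq) (divides t p) =
    divides (α * α * b + t * (+ 2 * α * β * x + β * β * y)) (begin
      b ≡⟨ *-identityˡ b ⟨
      1ℤ * 1ℤ * b ≡⟨ cong (λ u → u * u * b) eq ⟨
      (α * x + β * y) * (α * x + β * y) * b ≡⟨ expand α β x y b ⟩
      α * α * b * (x * x) + y * b * (+ 2 * α * β * x + β * β * y)
        ≡⟨ cong (λ u → α * α * b * (x * x) + u * (+ 2 * α * β * x + β * β * y)) p ⟩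
      α * α * b * (x * x) + t * (x * x) * (+ 2 * α * β * x + β * β * y)
        ≡⟨ collect α β x y b t ⟩
      (α * α * b + t * (+ 2 * α * β * x + β * β * y)) * (x * x) ∎)
    where
    open ≡-Reasoning
    expand : ∀ α β x y b → (α * x + β * y) * (α * x + β * y) * b ≡
      α * α * b * (x * x) + y * b * (+ 2 * α * β * x + β * β * y)
    expand = solve-∀-ℤ
    collect : ∀ α β x y b t → α * α * b * (x * x) + t * (x * x) * (+ 2 * α * β * x + β * β * y) ≡
      (α * α * b + t * (+ 2 * α * β * x + β * β * y)) * (x * x)
    collect = solve-∀-ℤ

  comaximal-square : ∀ {x y} → Comaximal x y → Comaximal (x * x) y
  comaximal-square {x} {y} (α , β , eq) = α * α , + 2 * α * β * x + β * β * y ,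
    trans (expand α β x y) (cong (λ u → u * u) eq)
    where
    expand : ∀ α β x y → α * α * (x * x) + (+ 2 * α * β * x + β * β * y) * y ≡
      (α * x + β * y) * (α * x + β * y)
    expand = solve-∀-ℤ

  -- Divisors of square-free integers.

  square-factor : ∀ {c} → Squarefree c → ∀ b t → c ≡ t * (b * b) → ∣ b ∣ ≡ 1
  square-factor {c} sf b t eq = sf b (∣⇒∣ᵤ {b * b} {c} (divides t eq))

  -- The gcd of the two factors occurs squared in `c`, so it is 1.
  squarefree-factors : ∀ {c} a b → Squarefree c → c ≡ a * b → Comaximal a b
  squarefree-factors {c} a b sf c≡ab with gcd-factors a b | bézout-gcd a b
  ... | a₁ , b₁ , p , q | α , β , r = α , β , trans r (cong +_ (square-factor sf g (a₁ * b₁) (begin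
    c ≡⟨ c≡ab ⟩
    a * b ≡⟨ cong₂ _*_ p q ⟩
    a₁ * g * (b₁ * g) ≡⟨ swap a₁ b₁ g ⟩
    a₁ * b₁ * (g * g) ∎)))
    where
    open ≡-Reasoning
    g = gcd a b
    swap : ∀ a b g → a * g * (b * g) ≡ a * b * (g * g)
    swap = solve-∀-ℤ

  squarefree-∣ : ∀ {c} a b → Squarefree c → c ≡ a * b → Squarefree b
  squarefree-∣ a b sf c≡ab x xx∣b = go (∣ᵤ⇒∣ {x * x} {b} xx∣b)
    where
    go : x * x ∣ b → ∣ x ∣ ≡ 1
    go (divides t p) = square-factor sf x (a * t) (trans c≡ab (trans (cong (a *_) p) (sym (*-assoc a t (x * x)))))

  squarefree-1 : Squarefree 1ℤ
  squarefree-1 b bb∣1 = ℕₚ.m*n≡1⇒m≡1 ∣ b ∣ ∣ b ∣ (trans (sym (abs-* b b)) (ℕ.∣1⇒≡1 bb∣1))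

  -- If g = gcd(x, a) then x = x₁g with x₁ coprime to a/g, so x₁² divides b and x₁ is a unit.
  x*x∣a*b⇒x∣a : ∀ {a b} x .{{_ : NonZero a}} → Squarefree b → x * x ∣ a * b → x ∣ a
  x*x∣a*b⇒x∣a {a} {b} x sf (divides t eq) = let g , g≢0 , x₁ , a₁ , p , q , comax = gcd-split x a in
    go g g≢0 x₁ a₁ p q comax
    where
    open ≡-Reasoning
    swap : ∀ a g x → a * g * (x * x) ≡ a * x * (x * g)
    swap = solve-∀-ℤ
    swap₂ : ∀ a b g → a * b * g ≡ a * g * b
    swap₂ = solve-∀-ℤ
    swap₃ : ∀ t x g → t * (x * g * (x * g)) ≡ t * g * (x * x) * g
    swap₃ = solve-∀-ℤ
    go : ∀ g → NonZero g → ∀ x₁ a₁ → x ≡ x₁ * g → a ≡ a₁ * g → Comaximal x₁ a₁ → x ∣ a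
    go g g≢0 x₁ a₁ p q comax = divides (a₁ * x₁) (begin
      a ≡⟨ q ⟩
      a₁ * g ≡⟨ *-identityʳ (a₁ * g) ⟨
      a₁ * g * 1ℤ ≡⟨ cong (a₁ * g *_) x₁x₁≡1 ⟨
      a₁ * g * (x₁ * x₁) ≡⟨ swap a₁ g x₁ ⟩
      a₁ * x₁ * (x₁ * g) ≡⟨ cong (a₁ * x₁ *_) p ⟨
      a₁ * x₁ * x ∎)
      where
      x₁x₁∣b : x₁ * x₁ ∣ b
      x₁x₁∣b = comaximal-cancel-square {x₁} {a₁} {b} comax (divides (t * g) (*-cancelʳ-≡ (a₁ * b) (t * g * (x₁ * x₁)) g {{g≢0}} (begin
        a₁ * b * g ≡⟨ swap₂ a₁ b g ⟩
        a₁ * g * b ≡⟨ cong (_* b) q ⟨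
        a * b ≡⟨ eq ⟩
        t * (x * x) ≡⟨ cong (λ u → t * (u * u)) p ⟩
        t * (x₁ * g * (x₁ * g)) ≡⟨ swap₃ t x₁ g ⟩
        t * g * (x₁ * x₁) * g ∎)))
      x₁x₁≡1 : x₁ * x₁ ≡ 1ℤ
      x₁x₁≡1 = ∣i∣≡1⇒i*i≡1 x₁ (square-factor sf x₁ (quotient x₁x₁∣b) (equality x₁x₁∣b))

  -- If x² divides ab, then x divides a and also b; the Bézout identity makes such an x a unit.
  squarefree-* : ∀ {a b} .{{_ : NonZero a}} .{{_ : NonZero b}} →
    Squarefree a → Squarefree b → Comaximal a b → Squarefree (a * b)
  squarefree-* {a} {b} sfa sfb (α , β , eq) x xx∣ab = go
    (x*x∣a*b⇒x∣a x sfb (∣ᵤ⇒∣ {x * x} {a * b} xx∣ab))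
    (x*x∣a*b⇒x∣a x sfa (subst (x * x ∣_) (*-comm a b) (∣ᵤ⇒∣ {x * x} {a * b} xx∣ab)))
    where
    open ≡-Reasoning
    expand : ∀ x α s β t → x * (α * s + β * t) ≡ α * (s * x) + β * (t * x)
    expand = solve-∀-ℤ
    go : x ∣ a → x ∣ b → ∣ x ∣ ≡ 1
    go (divides s p) (divides t q) = i*j≡1⇒∣i∣≡1 x (α * s + β * t) (begin
      x * (α * s + β * t) ≡⟨ expand x α s β t ⟩
      α * (s * x) + β * (t * x) ≡⟨ cong₂ (λ u v → α * u + β * v) p q ⟨
      α * a + β * b ≡⟨ eq ⟩
      1ℤ ∎)

  -- If g = gcd(x, c) then c = c₁g with c₁ coprime to x/g, so c₁ divides g, c₁² divides c and c₁ is a unit.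
  squarefree-∣-square : ∀ {c x} → Squarefree c → c ∣ x * x → c ∣ x
  squarefree-∣-square {c} {x} sf (divides t eq) =
    let g , g≢0 , x₁ , c₁ , p , q , comax = gcd-split x c {{squarefree⇒nonZero c sf}}
        α , β , r = comaximal-square {x₁} {c₁} comax
    in go g g≢0 x₁ c₁ p q α β r
    where
    open ≡-Reasoning
    swap : ∀ a g x → a * g * (x * x) ≡ a * x * (x * g)
    swap = solve-∀-ℤ
    swap₂ : ∀ x g → x * x * g * g ≡ x * g * (x * g)
    swap₂ = solve-∀-ℤ
    swap₃ : ∀ t c g → t * (c * g) ≡ t * c * g
    swap₃ = solve-∀-ℤ
    expand : ∀ α β x c g → (α * (x * x) + β * c) * g * c ≡ α * (x * x * g) * c + β * g * (c * c)
    expand = solve-∀-ℤ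
    collect : ∀ α β c t g → α * (t * c) * c + β * g * (c * c) ≡ (α * t + β * g) * (c * c)
    collect = solve-∀-ℤ
    go : ∀ g → NonZero g → ∀ x₁ c₁ → x ≡ x₁ * g → c ≡ c₁ * g →
      ∀ α β → α * (x₁ * x₁) + β * c₁ ≡ 1ℤ → c ∣ x
    go g g≢0 x₁ c₁ p q α β r = divides (x₁ * c₁) (begin
      x ≡⟨ p ⟩
      x₁ * g ≡⟨ *-identityʳ (x₁ * g) ⟨
      x₁ * g * 1ℤ ≡⟨ cong (x₁ * g *_) c₁c₁≡1 ⟨
      x₁ * g * (c₁ * c₁) ≡⟨ swap x₁ g c₁ ⟩
      x₁ * c₁ * (c₁ * g) ≡⟨ cong (x₁ * c₁ *_) q ⟨
      x₁ * c₁ * c ∎)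
      where
      x₁x₁g : x₁ * x₁ * g ≡ t * c₁
      x₁x₁g = *-cancelʳ-≡ (x₁ * x₁ * g) (t * c₁) g {{g≢0}} (begin
        x₁ * x₁ * g * g ≡⟨ swap₂ x₁ g ⟩
        x₁ * g * (x₁ * g) ≡⟨ cong (λ u → u * u) p ⟨
        x * x ≡⟨ eq ⟩
        t * c ≡⟨ cong (t *_) q ⟩
        t * (c₁ * g) ≡⟨ swap₃ t c₁ g ⟩
        t * c₁ * g ∎)
      c₁c₁≡1 : c₁ * c₁ ≡ 1ℤ
      c₁c₁≡1 = ∣i∣≡1⇒i*i≡1 c₁ (square-factor sf c₁ (α * t + β * g) (begin
        c ≡⟨ q ⟩
        c₁ * g ≡⟨ *-comm c₁ g ⟩
        g * c₁ ≡⟨ cong (_* c₁) (*-identityˡ g) ⟨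
        1ℤ * g * c₁ ≡⟨ cong (λ u → u * g * c₁) r ⟨
        (α * (x₁ * x₁) + β * c₁) * g * c₁ ≡⟨ expand α β x₁ c₁ g ⟩
        α * (x₁ * x₁ * g) * c₁ + β * g * (c₁ * c₁) ≡⟨ cong (λ u → α * u * c₁ + β * g * (c₁ * c₁)) x₁x₁g ⟩
        α * (t * c₁) * c₁ + β * g * (c₁ * c₁) ≡⟨ collect α β c₁ t g ⟩
        (α * t + β * g) * (c₁ * c₁) ∎))

  -- Parity and exact division.

  parity : ∀ i → ∃ λ j → i ≡ + 2 * j ⊎ i ≡ 1ℤ + + 2 * j
  parity i = go (i %ℕ 2) (a≡a%ℕn+[a/ℕn]*n i 2) (n%d<d i (+ 2))
    where
    j = i /ℕ 2
    go : ∀ r → i ≡ + r + j * + 2 → r ℕ.< 2 → ∃ λ j → i ≡ + 2 * j ⊎ i ≡ 1ℤ + + 2 * j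
    go 0 eq _ = j , inj₁ (trans eq (trans (+-identityˡ (j * + 2)) (*-comm j (+ 2))))
    go 1 eq _ = j , inj₂ (trans eq (cong (λ u → 1ℤ + u) (*-comm j (+ 2))))
    go (ℕ.suc (ℕ.suc _)) _ (ℕ.s≤s (ℕ.s≤s ()))

  odd≢even : ∀ i j → 1ℤ + + 2 * i ≢ + 2 * j
  odd≢even i j eq = case ℕₚ.m*n≡1⇒m≡1 2 ∣ j - i ∣ (trans (sym (abs-* (+ 2) (j - i))) (cong ∣_∣ 2[j-i]≡1)) of λ ()
    where
    expand : ∀ i j → + 2 * (j - i) ≡ + 2 * j - + 2 * i
    expand = solve-∀-ℤ
    collect : ∀ i → 1ℤ + + 2 * i - + 2 * i ≡ 1ℤ
    collect = solve-∀-ℤ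
    2[j-i]≡1 : + 2 * (j - i) ≡ 1ℤ
    2[j-i]≡1 = trans (expand i j) (trans (cong (_- + 2 * i) (sym eq)) (collect i))

  -- The remainder is a multiple of b smaller than |b|, hence zero. This evaluates the quotients by
  -- which `k` and `n/d` are defined.
  a*b/b : ∀ a b .{{_ : NonZero b}} → (a * b) / b ≡ a
  a*b/b a b = *-cancelʳ-≡ _ _ b (sym (trans (a≡a%n+[a/n]*n (a * b) b) (trans (cong (λ u → + u + q * b) r≡0) (+-identityˡ (q * b)))))
    where
    open ≡-Reasoning
    q = (a * b) / b
    r = (a * b) % b
    factor : ∀ a q b → (a - q) * b ≡ a * b - q * b
    factor = solve-∀-ℤ
    cancel : ∀ r s → r + s - s ≡ r
    cancel = solve-∀-ℤ
    r≡[a-q]b : ∣ a - q ∣ ℕ.* ∣ b ∣ ≡ r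
    r≡[a-q]b = trans (sym (abs-* (a - q) b)) (cong ∣_∣ (begin
      (a - q) * b ≡⟨ factor a q b ⟩
      a * b - q * b ≡⟨ cong (_- q * b) (a≡a%n+[a/n]*n (a * b) b) ⟩
      + r + q * b - q * b ≡⟨ cancel (+ r) (q * b) ⟩
      + r ∎))
    small : ∀ c → c ℕ.* ∣ b ∣ ℕ.< ∣ b ∣ → c ≡ 0
    small ℕ.zero    _ = refl
    small (ℕ.suc c) lt = contradiction lt (ℕₚ.≤⇒≯ (ℕₚ.m≤m+n ∣ b ∣ (c ℕ.* ∣ b ∣)))
    r≡0 : r ≡ 0
    r≡0 = trans (sym r≡[a-q]b) (cong (ℕ._* ∣ b ∣) (small ∣ a - q ∣ (subst (ℕ._< ∣ b ∣) (sym r≡[a-q]b) (n%d<d (a * b) b))))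

  -- The common factorisation of m and n.

  Odd : ℤ → Set
  Odd i = ∃ λ j → i ≡ 1ℤ + + 2 * j

  odd-factor : ∀ a b → Odd (a * b) → Odd b
  odd-factor a b (j , eq) with parity b
  ... | i , inj₂ odd = i , odd
  ... | i , inj₁ refl = contradiction (trans (sym eq) (shift a i)) (odd≢even j (a * i))
    where
    shift : ∀ a i → a * (+ 2 * i) ≡ + 2 * (a * i)
    shift = solve-∀-ℤ

  -- The equation d + m′ = 4r is what m ≡ 3 (mod 4) says about the odd factors `d` and `m′`. Both
  -- the integrality of lattice elements and the case ζ = √m rest on it.
  record Decomposition (m n d : ℤ) : Set where
    field
      m′ h r a b       : ℤ
      m≡3+4a           : m ≡ + 3 + + 4 * a
      n≡2+4b           : n ≡ + 2 + + 4 * b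
      m≡dm′            : m ≡ d * m′
      n≡d2h            : n ≡ d * (+ 2 * h)
      d+m′≡4r          : d + m′ ≡ + 4 * r
      d-odd            : Odd d
      m′-odd           : Odd m′
      h-odd            : Odd h
      m′-d             : Comaximal m′ d
      h-d              : Comaximal h d
      m′-2h            : Comaximal m′ (+ 2 * h)
      h-m′             : Comaximal h m′

  %ℕ⇒ : ∀ m r → m %ℕ 4 ≡ r → ∃ λ a → m ≡ + r + + 4 * a
  %ℕ⇒ m r eq = m /ℕ 4 , trans (a≡a%ℕn+[a/ℕn]*n m 4) (cong₂ (λ u v → + u + v) eq (*-comm (m /ℕ 4) (+ 4)))

  -- d + m′ = dm′ + 1 - (d - 1)(m′ - 1), where 4 divides dm′ + 1 and also the product of two even
  -- numbers.
  quarter-sum : ∀ {d m′ a} → Odd d → Odd m′ → m′ * d ≡ + 3 + + 4 * a → ∃ λ r → d + m′ ≡ + 4 * r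
  quarter-sum {a = a} (δ , refl) (μ , refl) eq = 1ℤ + a - δ * μ , (begin
    1ℤ + + 2 * δ + (1ℤ + + 2 * μ) ≡⟨ expand δ μ ⟩
    (1ℤ + + 2 * μ) * (1ℤ + + 2 * δ) + 1ℤ - + 4 * (δ * μ) ≡⟨ cong (λ u → u + 1ℤ - + 4 * (δ * μ)) eq ⟩
    + 3 + + 4 * a + 1ℤ - + 4 * (δ * μ) ≡⟨ collect a δ μ ⟩
    + 4 * (1ℤ + a - δ * μ) ∎)
    where
    open ≡-Reasoning
    expand : ∀ δ μ → 1ℤ + + 2 * δ + (1ℤ + + 2 * μ) ≡ (1ℤ + + 2 * μ) * (1ℤ + + 2 * δ) + 1ℤ - + 4 * (δ * μ)
    expand = solve-∀-ℤ
    collect : ∀ a δ μ → + 3 + + 4 * a + 1ℤ - + 4 * (δ * μ) ≡ + 4 * (1ℤ + a - δ * μ)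
    collect = solve-∀-ℤ

  module _ (m n : ℤ) (m-sf : Squarefree m) (n-sf : Squarefree n)
           (m%4 : m %ℕ 4 ≡ 3) (n%4 : n %ℕ 4 ≡ 2) where
    open ≡-Reasoning

    private
      d : ℤ
      d = gcd m n

    gcd≢0 : NonZero d
    gcd≢0 = ≢-nonZero (≢-nonZero⁻¹ n {{squarefree⇒nonZero n n-sf}} ∘ gcd[i,j]≡0⇒j≡0 {m} {n})

    decompose : ∀ m′ n′ → m ≡ m′ * d → n ≡ n′ * d → Comaximal m′ n′ → Decomposition m n d
    decompose m′ n′ m≡ n≡ (α , β , αm′+βn′≡1) = record
      { m′ = m′ ; h = h ; r = proj₁ d+m′ ; a = a ; b = b
      ; m≡3+4a = m≡3+4a ; n≡2+4b = n≡2+4b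
      ; m≡dm′ = trans m≡ (*-comm m′ d)
      ; n≡d2h = trans n≡2hd (*-comm (+ 2 * h) d)
      ; d+m′≡4r = proj₂ d+m′
      ; d-odd = d-odd ; m′-odd = m′-odd
      ; h-odd = odd-factor d h (b , hd-odd)
      ; m′-d = squarefree-factors m′ d m-sf m≡
      -- With n read as h(2d), square-freeness makes h comaximal to 2d; the 2 then moves into the
      -- coefficient.
      ; h-d = let α , β , eq = squarefree-factors h (+ 2 * d) n-sf (trans n≡2hd (shift₁ h d)) in
          α , β * + 2 , trans (cong (λ u → α * h + u) (*-assoc β (+ 2) d)) eq
      ; m′-2h = α , β , trans (cong (λ u → α * m′ + β * u) (sym n′≡2h)) αm′+βn′≡1
      ; h-m′ = β * + 2 , α , trans (shift₂ α β m′ h) (trans (cong (λ u → α * m′ + β * u) (sym n′≡2h)) αm′+βn′≡1)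
      }
      where
      a b : ℤ
      a = proj₁ (%ℕ⇒ m 3 m%4)
      b = proj₁ (%ℕ⇒ n 2 n%4)
      m≡3+4a : m ≡ + 3 + + 4 * a
      m≡3+4a = proj₂ (%ℕ⇒ m 3 m%4)
      n≡2+4b : n ≡ + 2 + + 4 * b
      n≡2+4b = proj₂ (%ℕ⇒ n 2 n%4)
      shift₁ : ∀ h d → + 2 * h * d ≡ h * (+ 2 * d)
      shift₁ = solve-∀-ℤ
      shift₂ : ∀ α β m h → β * + 2 * h + α * m ≡ α * m + β * (+ 2 * h)
      shift₂ = solve-∀-ℤ
      3+4a : ∀ a → + 3 + + 4 * a ≡ 1ℤ + + 2 * (1ℤ + + 2 * a)
      3+4a = solve-∀-ℤ
      2+4b : ∀ b → + 2 + + 4 * b ≡ + 2 * (1ℤ + + 2 * b)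
      2+4b = solve-∀-ℤ
      odd*odd : ∀ i j → (1ℤ + + 2 * i) * (1ℤ + + 2 * j) ≡ 1ℤ + + 2 * (i + j + + 2 * (i * j))
      odd*odd = solve-∀-ℤ
      m-odd : m′ * d ≡ 1ℤ + + 2 * (1ℤ + + 2 * a)
      m-odd = trans (sym m≡) (trans m≡3+4a (3+4a a))
      d-odd : Odd d
      d-odd = odd-factor m′ d (1ℤ + + 2 * a , m-odd)
      m′-odd : Odd m′
      m′-odd = odd-factor d m′ (1ℤ + + 2 * a , trans (*-comm d m′) m-odd)
      d+m′ : ∃ λ r → d + m′ ≡ + 4 * r
      d+m′ = quarter-sum {a = a} d-odd m′-odd (trans (sym m≡) m≡3+4a)
      n′-even : ∃ λ h → n′ ≡ + 2 * h
      n′-even = go (parity n′) d-odd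
        where
        go : (∃ λ j → n′ ≡ + 2 * j ⊎ n′ ≡ 1ℤ + + 2 * j) → Odd d → ∃ λ h → n′ ≡ + 2 * h
        go (h , inj₁ eq) _ = h , eq
        go (j , inj₂ eq) (i , eq′) = contradiction (begin
          1ℤ + + 2 * (j + i + + 2 * (j * i)) ≡⟨ odd*odd j i ⟨
          (1ℤ + + 2 * j) * (1ℤ + + 2 * i) ≡⟨ cong₂ _*_ eq eq′ ⟨
          n′ * d ≡⟨ n≡ ⟨
          n ≡⟨ n≡2+4b ⟩
          + 2 + + 4 * b ≡⟨ 2+4b b ⟩
          + 2 * (1ℤ + + 2 * b) ∎) (odd≢even (j + i + + 2 * (j * i)) (1ℤ + + 2 * b))
      h : ℤ
      h = proj₁ n′-even
      n′≡2h : n′ ≡ + 2 * h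
      n′≡2h = proj₂ n′-even
      n≡2hd : n ≡ + 2 * h * d
      n≡2hd = trans n≡ (cong (_* d) n′≡2h)
      -- n ≡ 2 (mod 4) says that n/2 = dh is odd.
      hd-odd : d * h ≡ 1ℤ + + 2 * b
      hd-odd = *-cancelˡ-≡ (+ 2) (d * h) (1ℤ + + 2 * b) (begin
        + 2 * (d * h) ≡⟨ cong (+ 2 *_) (*-comm d h) ⟩
        + 2 * (h * d) ≡⟨ *-assoc (+ 2) h d ⟨
        + 2 * h * d ≡⟨ n≡2hd ⟨
        n ≡⟨ n≡2+4b ⟩
        + 2 + + 4 * b ≡⟨ 2+4b b ⟩
        + 2 * (1ℤ + + 2 * b) ∎)

    decomposition : Decomposition m n d
    decomposition = let m′ , n′ , m≡ , n≡ = gcd-factors m n in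
      decompose m′ n′ m≡ n≡ (comaximal-quotients m′ n′ {{gcd≢0}} m≡ n≡ (bézout-gcd m n))

open Integers using (Comaximal; Odd; Decomposition; decomposition; squarefree-∣; squarefree-*; squarefree-∣-square; a*b/b)

-- Integers as a subring of ℚ.

module Rationals where

  open import Data.Integer using (∣_∣)
  open import Data.Integer.Divisibility.Signed using (_∣_)
  import Data.Nat.Coprimality as ℕ
  open import Data.Rational using (_+_; _*_; -_; _-_; 1/_; mkℚ; ≢-nonZero)
  open import Data.Rational.Properties
  open import Data.Rational.Unnormalised using (*≡*)
  import Data.Rational.Unnormalised.Properties as ℚᵘₚ
  open import Relation.Nullary.Decidable using (dec⇒maybe)
  open import Tactic.RingSolver.Core.AlmostCommutativeRing using (AlmostCommutativeRing; fromCommutativeRing)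
  open Integers using (bézout-gcd; comaximal-cancel-square; comaximal-square; comaximal-sym; ∣i∣≡1⇒; square-factor; squarefree-1)

  ℚ-ring : AlmostCommutativeRing 0ℓ 0ℓ
  ℚ-ring = fromCommutativeRing +-*-commutativeRing (λ x → dec⇒maybe (0ℚ ≟ x))

  fromℤ-+ : ∀ a b → fromℤ (a ℤ.+ b) ≡ fromℤ a + fromℤ b
  fromℤ-+ a b = toℚᵘ-injective (ℚᵘₚ.≃-trans (*≡* (identity a b)) (ℚᵘₚ.≃-sym (toℚᵘ-homo-+ (fromℤ a) (fromℤ b))))
    where
    identity : ∀ a b → (a ℤ.+ b) ℤ.* + 1 ≡ (a ℤ.* + 1 ℤ.+ b ℤ.* + 1) ℤ.* + 1
    identity = ℤ-solver.solve-∀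

  fromℤ-* : ∀ a b → fromℤ (a ℤ.* b) ≡ fromℤ a * fromℤ b
  fromℤ-* a b = toℚᵘ-injective (ℚᵘₚ.≃-sym (toℚᵘ-homo-* (fromℤ a) (fromℤ b)))

  fromℤ-neg : ∀ a → fromℤ (ℤ.- a) ≡ - fromℤ a
  fromℤ-neg a = toℚᵘ-injective (ℚᵘₚ.≃-sym (toℚᵘ-homo‿- (fromℤ a)))

  fromℤ-injective : ∀ {a b} → fromℤ a ≡ fromℤ b → a ≡ b
  fromℤ-injective = cong ↥_

  inverse : ∀ {p} → p ≢ 0ℚ → ∃ λ q → q * p ≡ 1ℚ
  inverse {p} p≢0 = 1/ p , *-inverseˡ p
    where instance _ = ≢-nonZero p≢0

  *-cancelˡ : ∀ {p q r} → p ≢ 0ℚ → p * q ≡ p * r → q ≡ r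
  *-cancelˡ {p} {q} {r} p≢0 eq = let p⁻¹ , inv = inverse p≢0 in
    trans (sym (undo p⁻¹ q inv)) (trans (cong (p⁻¹ *_) eq) (undo p⁻¹ r inv))
    where
    undo : ∀ p⁻¹ s → p⁻¹ * p ≡ 1ℚ → p⁻¹ * (p * s) ≡ s
    undo p⁻¹ s inv = trans (sym (*-assoc p⁻¹ p s)) (trans (cong (_* s) inv) (*-identityˡ s))

  p*q≡0⇒q≡0 : ∀ {p q} → p ≢ 0ℚ → p * q ≡ 0ℚ → q ≡ 0ℚ
  p*q≡0⇒q≡0 {p} p≢0 eq = *-cancelˡ p≢0 (trans eq (sym (*-zeroʳ p)))

  p*q≡0⇒ : ∀ p {q} → p * q ≡ 0ℚ → p ≡ 0ℚ ⊎ q ≡ 0ℚ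
  p*q≡0⇒ p eq with p ≟ 0ℚ
  ... | yes p≡0 = inj₁ p≡0
  ... | no p≢0 = inj₂ (p*q≡0⇒q≡0 p≢0 eq)

  fromℤ-≢0 : ∀ {a} → a ≢ + 0 → fromℤ a ≢ 0ℚ
  fromℤ-≢0 a≢0 eq = a≢0 (fromℤ-injective eq)

  //-* : ∀ a b .{{_ : ℤ.NonZero b}} → fromℤ b * (a // b) ≡ fromℤ a
  //-* a b = begin
    fromℤ b * (fromℤ a * (1/ fromℤ b)) ≡⟨ swap (fromℤ b) (fromℤ a) (1/ fromℤ b) ⟩
    fromℤ a * (fromℤ b * (1/ fromℤ b)) ≡⟨ cong (fromℤ a *_) (*-inverseʳ (fromℤ b)) ⟩
    fromℤ a * 1ℚ ≡⟨ *-identityʳ (fromℤ a) ⟩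
    fromℤ a ∎
    where
    open ≡-Reasoning
    swap : ∀ x y z → x * (y * z) ≡ y * (x * z)
    swap = solve-∀ ℚ-ring

  p-q≡0⇒p≡q : ∀ {p q} → p - q ≡ 0ℚ → p ≡ q
  p-q≡0⇒p≡q {p} {q} eq = trans (shift p q) (trans (cong (_+ q) eq) (+-identityˡ q))
    where
    shift : ∀ p q → p ≡ p - q + q
    shift = solve-∀ ℚ-ring

  p≡q⇒p-q≡0 : ∀ {p q} → p ≡ q → p - q ≡ 0ℚ
  p≡q⇒p-q≡0 {p} refl = +-inverseʳ p

  -- Integrality is a predicate on ℚ, so that a single ring solver applies and division by 2 or d
  -- stays available. A term built from the operators marked ᴵ mirrors the expression whose
  -- integrality it proves.
  IsInt : ℚ → Set
  IsInt q = ∃ λ z → q ≡ fromℤ z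

  infixl 6 _+ᴵ_ _-ᴵ_
  infixl 7 _*ᴵ_
  infix  8 -ᴵ_

  _+ᴵ_ : ∀ {p q} → IsInt p → IsInt q → IsInt (p + q)
  (a , p≡) +ᴵ (b , q≡) = a ℤ.+ b , trans (cong₂ _+_ p≡ q≡) (sym (fromℤ-+ a b))

  _*ᴵ_ : ∀ {p q} → IsInt p → IsInt q → IsInt (p * q)
  (a , p≡) *ᴵ (b , q≡) = a ℤ.* b , trans (cong₂ _*_ p≡ q≡) (sym (fromℤ-* a b))

  -ᴵ_ : ∀ {p} → IsInt p → IsInt (- p)
  -ᴵ (a , p≡) = ℤ.- a , trans (cong -_ p≡) (sym (fromℤ-neg a))

  _-ᴵ_ : ∀ {p q} → IsInt p → IsInt q → IsInt (p - q)
  i -ᴵ j = i +ᴵ -ᴵ j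

  int : ∀ z → IsInt (fromℤ z)
  int z = z , refl

  0ᴵ : IsInt 0ℚ
  0ᴵ = int (+ 0)

  1ᴵ : IsInt 1ℚ
  1ᴵ = int (+ 1)

  2ℚ 4ℚ : ℚ
  2ℚ = fromℤ (+ 2)
  4ℚ = fromℤ (+ 4)

  2ᴵ : IsInt 2ℚ
  2ᴵ = int (+ 2)

  4ᴵ : IsInt 4ℚ
  4ᴵ = int (+ 4)

  2≢0 : 2ℚ ≢ 0ℚ
  2≢0 ()

  4≢0 : 4ℚ ≢ 0ℚ
  4≢0 ()

  IsEven IsOdd : ℚ → Set
  IsEven q = ∃ λ r → IsInt r × q ≡ 2ℚ * r
  IsOdd  q = ∃ λ r → IsInt r × q ≡ 1ℚ + 2ℚ * r

  IsUnit : ℚ → Set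
  IsUnit q = q ≡ 1ℚ ⊎ q ≡ - 1ℚ

  odd⇒int : ∀ {q} → IsOdd q → IsInt q
  odd⇒int (r , ir , refl) = 1ᴵ +ᴵ 2ᴵ *ᴵ ir

  parity : ∀ {q} → IsInt q → IsEven q ⊎ IsOdd q
  parity (z , refl) with Integers.parity z
  ... | j , inj₁ refl = inj₁ (fromℤ j , int j , fromℤ-* (+ 2) j)
  ... | j , inj₂ refl = inj₂ (fromℤ j , int j , trans (fromℤ-+ (+ 1) (+ 2 ℤ.* j)) (cong (λ u → 1ℚ + u) (fromℤ-* (+ 2) j)))

  odd≢even : ∀ {p q} → IsInt p → IsInt q → 1ℚ + 2ℚ * p ≢ 2ℚ * q
  odd≢even (a , refl) (b , refl) eq = Integers.odd≢even a b (fromℤ-injective (begin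
    fromℤ (+ 1 ℤ.+ + 2 ℤ.* a) ≡⟨ fromℤ-+ (+ 1) (+ 2 ℤ.* a) ⟩
    1ℚ + fromℤ (+ 2 ℤ.* a) ≡⟨ cong (λ u → 1ℚ + u) (fromℤ-* (+ 2) a) ⟩
    1ℚ + 2ℚ * fromℤ a ≡⟨ eq ⟩
    2ℚ * fromℤ b ≡⟨ fromℤ-* (+ 2) b ⟨
    fromℤ (+ 2 ℤ.* b) ∎))
    where open ≡-Reasoning

  int-unit : ∀ {p q} → IsInt p → IsInt q → p * q ≡ 1ℚ → IsUnit p
  int-unit (a , refl) (b , refl) eq
    with ∣i∣≡1⇒ a (Integers.i*j≡1⇒∣i∣≡1 a b (fromℤ-injective (trans (fromℤ-* a b) eq)))
  ... | inj₁ refl = inj₁ refl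
  ... | inj₂ refl = inj₂ refl

  denominator-clears : ∀ q → fromℤ (↧ q) * q ≡ fromℤ (↥ q)
  denominator-clears q@record{} = toℚᵘ-injective (ℚᵘₚ.≃-trans (toℚᵘ-homo-* (fromℤ (↧ q)) q) (*≡* (identity (↧ q) (↥ q))))
    where
    identity : ∀ D N → D ℤ.* N ℤ.* + 1 ≡ N ℤ.* (+ 1 ℤ.* D)
    identity = ℤ-solver.solve-∀

  comaximal-fraction : ∀ q → Comaximal (↥ q) (↧ q)
  comaximal-fraction q@(mkℚ _ _ c) = let α , β , eq = bézout-gcd (↥ q) (↧ q) in
    α , β , trans eq (cong +_ (ℕ.coprime⇒gcd≡1 (ℕ.recompute c)))

  ∣↧∣≡1⇒int : ∀ q → ∣ ↧ q ∣ ≡ 1 → IsInt q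
  ∣↧∣≡1⇒int (mkℚ p zero _) _ = p , refl

  -- With q = P/Q in lowest terms, Q² divides P²c and is coprime to P², so Q² divides c and Q = 1.
  squarefree-root : ∀ {c q} → Squarefree c → IsInt (fromℤ c * (q * q)) → IsInt q
  squarefree-root {c} {q} sf (z , eq) = go (comaximal-cancel-square {↧ q} {↥ q ℤ.* ↥ q} {c}
      (comaximal-sym {↥ q ℤ.* ↥ q} {↧ q} (comaximal-square {↥ q} {↧ q} (comaximal-fraction q)))
      (divides z (fromℤ-injective (begin
        fromℤ (↥ q ℤ.* ↥ q ℤ.* c) ≡⟨ fromℤ-* (↥ q ℤ.* ↥ q) c ⟩
        fromℤ (↥ q ℤ.* ↥ q) * C ≡⟨ cong (_* C) (fromℤ-* (↥ q) (↥ q)) ⟩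
        fromℤ (↥ q) * fromℤ (↥ q) * C ≡⟨ cong (λ u → u * u * C) (denominator-clears q) ⟨
        D * q * (D * q) * C ≡⟨ swap D q C ⟩
        C * (q * q) * (D * D) ≡⟨ cong₂ _*_ eq (sym (fromℤ-* (↧ q) (↧ q))) ⟩
        fromℤ z * fromℤ (↧ q ℤ.* ↧ q) ≡⟨ fromℤ-* z (↧ q ℤ.* ↧ q) ⟨
        fromℤ (z ℤ.* (↧ q ℤ.* ↧ q)) ∎))))
    where
    open ≡-Reasoning
    C D : ℚ
    C = fromℤ c
    D = fromℤ (↧ q)
    swap : ∀ D q C → D * q * (D * q) * C ≡ C * (q * q) * (D * D)
    swap = solve-∀ ℚ-ring
    go : ↧ q ℤ.* ↧ q ∣ c → IsInt q
    go (divides t eq) = ∣↧∣≡1⇒int q (square-factor sf (↧ q) t eq)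

  -- With f j = E qʲ and q = P/Q in lowest terms, f/Q is again integral, and it has the
  -- smaller initial value E/Q unless Q = 1.
  geometric-int : ∀ q (f : ℕ → ℚ) → f 0 ≢ 0ℚ → (∀ j → f (suc j) ≡ q * f j) → (∀ j → IsInt (f j)) → IsInt q
  geometric-int q f f0≢0 step ints = descend (suc ∣ proj₁ (ints 0) ∣) f f0≢0 step ints ℕₚ.≤-refl
    where
    D : ℤ
    D = ↧ q
    descend : ∀ fuel (f : ℕ → ℚ) → f 0 ≢ 0ℚ → (∀ j → f (suc j) ≡ q * f j) → (ints : ∀ j → IsInt (f j)) →
      ∣ proj₁ (ints 0) ∣ ℕ.< fuel → IsInt q
    descend (suc fuel) f f0≢0 step ints (ℕ.s≤s bound) with ∣ D ∣ ℕₚ.≟ 1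
    ... | yes eq = ∣↧∣≡1⇒int q eq
    ... | no ∣D∣≢1 = descend fuel g g0≢0 step′ ints′ (ℕₚ.<-≤-trans smaller bound)
      where
      open ≡-Reasoning
      α β : ℚ
      α = fromℤ (proj₁ (comaximal-fraction q))
      β = fromℤ (proj₁ (proj₂ (comaximal-fraction q)))
      bézout : α * (fromℤ D * q) + β * fromℤ D ≡ 1ℚ
      bézout = let a , b , eq = comaximal-fraction q in begin
        fromℤ a * (fromℤ D * q) + fromℤ b * fromℤ D ≡⟨ cong (λ u → fromℤ a * u + fromℤ b * fromℤ D) (denominator-clears q) ⟩
        fromℤ a * fromℤ (↥ q) + fromℤ b * fromℤ D ≡⟨ cong₂ _+_ (fromℤ-* a (↥ q)) (fromℤ-* b D) ⟨
        fromℤ (a ℤ.* ↥ q) + fromℤ (b ℤ.* D) ≡⟨ fromℤ-+ (a ℤ.* ↥ q) (b ℤ.* D) ⟨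
        fromℤ (a ℤ.* ↥ q ℤ.+ b ℤ.* D) ≡⟨ cong fromℤ eq ⟩
        1ℚ ∎
      -- By the Bézout relation αP + βQ = 1 this is f j / Q, written as an integral combination of
      -- terms of f.
      g : ℕ → ℚ
      g j = α * f (suc j) + β * f j
      ints′ : ∀ j → IsInt (g j)
      ints′ j = int _ *ᴵ ints (suc j) +ᴵ int _ *ᴵ ints j
      Dg≡f : ∀ j → fromℤ D * g j ≡ f j
      Dg≡f j = begin
        fromℤ D * (α * f (suc j) + β * f j) ≡⟨ cong (λ u → fromℤ D * (α * u + β * f j)) (step j) ⟩
        fromℤ D * (α * (q * f j) + β * f j) ≡⟨ factor (fromℤ D) α q β (f j) ⟩
        (α * (fromℤ D * q) + β * fromℤ D) * f j ≡⟨ cong (_* f j) bézout ⟩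
        1ℚ * f j ≡⟨ *-identityˡ (f j) ⟩
        f j ∎
        where
        factor : ∀ D α q β u → D * (α * (q * u) + β * u) ≡ (α * (D * q) + β * D) * u
        factor = solve-∀ ℚ-ring
      step′ : ∀ j → g (suc j) ≡ q * g j
      step′ j = trans (cong₂ (λ u v → α * u + β * v) (step (suc j)) (step j)) (factor α β q (f (suc j)) (f j))
        where
        factor : ∀ α β q u v → α * (q * u) + β * (q * v) ≡ q * (α * u + β * v)
        factor = solve-∀ ℚ-ring
      g0≢0 : g 0 ≢ 0ℚ
      g0≢0 eq = f0≢0 (trans (sym (Dg≡f 0)) (trans (cong (fromℤ D *_) eq) (*-zeroʳ (fromℤ D))))
      z z′ : ℤ
      z = proj₁ (ints 0)
      z′ = proj₁ (ints′ 0)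
      Dz′≡z : D ℤ.* z′ ≡ z
      Dz′≡z = fromℤ-injective (trans (fromℤ-* D z′) (trans (cong (fromℤ D *_) (sym (proj₂ (ints′ 0)))) (trans (Dg≡f 0) (proj₂ (ints 0)))))
      z′≢0 : ∣ z′ ∣ ≢ 0
      z′≢0 eq = g0≢0 (trans (proj₂ (ints′ 0)) (cong fromℤ (ℤₚ.∣i∣≡0⇒i≡0 eq)))
      larger : ∀ a b → a ≢ 0 → a ≢ 1 → b ≢ 0 → b ℕ.< a ℕ.* b
      larger 0 b a≢0 _ _ = contradiction refl a≢0
      larger 1 b _ a≢1 _ = contradiction refl a≢1
      larger (suc (suc a)) b _ _ b≢0 = ℕₚ.m<m+n b (ℕₚ.<-≤-trans (ℕₚ.n≢0⇒n>0 b≢0) (ℕₚ.m≤m+n b (a ℕ.* b)))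
      smaller : ∣ z′ ∣ ℕ.< ∣ z ∣
      smaller = subst (∣ z′ ∣ ℕ.<_) (trans (sym (ℤₚ.abs-* D z′)) (cong ∣_∣ Dz′≡z))
        (larger ∣ D ∣ ∣ z′ ∣ (λ ()) ∣D∣≢1 z′≢0)

  -- A certificate for deriving one equation from another: p - q is displayed as a multiple of l -
  -- r, which is a pure ring identity. The multiplier `c` is the whole content of each use.
  combine : ∀ {p q l r} c → l ≡ r → p - q ≡ c * (l - r) → p ≡ q
  combine {l = l} c refl eq = p-q≡0⇒p≡q (trans eq (trans (cong (c *_) (+-inverseʳ l)) (*-zeroʳ c)))

  combine₂ : ∀ {p q l r l′ r′} c c′ → l ≡ r → l′ ≡ r′ → p - q ≡ c * (l - r) + c′ * (l′ - r′) → p ≡ q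
  combine₂ {l = l} {l′ = l′} c c′ refl eq₂ eq = combine c′ eq₂ (trans eq
    (trans (cong (λ u → c * u + _) (+-inverseʳ l)) (trans (cong (_+ _) (*-zeroʳ c)) (+-identityˡ _))))

  ℚ⁴ : Set
  ℚ⁴ = ℚ × ℚ × ℚ × ℚ

  quadruple : ∀ {a a′ b b′ c c′ d d′ : ℚ} → a ≡ a′ → b ≡ b′ → c ≡ c′ → d ≡ d′ → (a , b , c , d) ≡ (a′ , b′ , c′ , d′)
  quadruple refl refl refl refl = refl

  ≡-sum : ∀ {s t : ℚ⁴} → s ≡ t → let a , b , c , d = s ; a′ , b′ , c′ , d′ = t in a ≡ a′ × b ≡ b′ × c ≡ c′ × d ≡ d′
  ≡-sum refl = refl , refl , refl , refl

  unit≢0 : ∀ {e} → IsUnit e → e ≢ 0ℚ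
  unit≢0 (inj₁ refl) ()
  unit≢0 (inj₂ refl) ()

  unit-square : ∀ {e} → IsUnit e → e * e ≡ 1ℚ
  unit-square (inj₁ refl) = refl
  unit-square (inj₂ refl) = refl

  unit⇒int : ∀ {e} → IsUnit e → IsInt e
  unit⇒int (inj₁ refl) = 1ᴵ
  unit⇒int (inj₂ refl) = -ᴵ 1ᴵ

  -- The action on coordinates and the two lattice models.

  module Action (p q : ℚ) where

    act : ℚ⁴ → ℚ⁴ → ℚ⁴
    act (A , B , C , D) (u , v , w , z) = A * u , B * v , C * w - D * (p * z) , C * z + D * (q * w)

    Stabilises : (ℚ⁴ → Set) → ℚ⁴ → Set
    Stabilises O s = ∀ x → O x → O (act s x)

    norm : ℚ → ℚ → ℚ
    norm w z = q * (w * w) + p * (z * z)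

    -- Multiplicativity of determinants: the matrix with rows (w, -pz) and (z, qw) sends (C, D) and
    -- (C′, D′) to the two images.
    determinant : ∀ C D C′ D′ w z →
      (C * w - D * (p * z)) * (C′ * z + D′ * (q * w)) - (C * z + D * (q * w)) * (C′ * w - D′ * (p * z)) ≡
      (C * D′ - D * C′) * norm w z
    determinant C D C′ D′ w z = identity p q C D C′ D′ w z
      where
      identity : ∀ p q C D C′ D′ w z →
        (C * w - D * (p * z)) * (C′ * z + D′ * (q * w)) - (C * z + D * (q * w)) * (C′ * w - D′ * (p * z)) ≡
        (C * D′ - D * C′) * (q * (w * w) + p * (z * z))
      identity = solve-∀ ℚ-ring

    -- Cramer's rule for C, by the adjugate of the same matrix.
    recover-C : ∀ C D w z → q * w * (C * w - D * (p * z)) + p * z * (C * z + D * (q * w)) ≡ norm w z * C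
    recover-C C D w z = identity p q C D w z
      where
      identity : ∀ p q C D w z → q * w * (C * w - D * (p * z)) + p * z * (C * z + D * (q * w)) ≡ (q * (w * w) + p * (z * z)) * C
      identity = solve-∀ ℚ-ring

    recover-D : ∀ C D w z → w * (C * z + D * (q * w)) - z * (C * w - D * (p * z)) ≡ norm w z * D
    recover-D C D w z = identity p q C D w z
      where
      identity : ∀ p q C D w z → w * (C * z + D * (q * w)) - z * (C * w - D * (p * z)) ≡ (q * (w * w) + p * (z * z)) * D
      identity = solve-∀ ℚ-ring

    act-injective : ∀ {w z} s t → norm w z ≢ 0ℚ → act s (1ℚ , 1ℚ , w , z) ≡ act t (1ℚ , 1ℚ , w , z) → s ≡ t
    act-injective {w} {z} (A , B , C , D) (A′ , B′ , C′ , D′) N≢0 eq = let a , b , c , d = ≡-sum eq in quadruple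
      (trans (sym (*-identityʳ A)) (trans a (*-identityʳ A′)))
      (trans (sym (*-identityʳ B)) (trans b (*-identityʳ B′)))
      (*-cancelˡ N≢0 (trans (sym (recover-C C D w z)) (trans (cong₂ (λ s t → q * w * s + p * z * t) c d) (recover-C C′ D′ w z))))
      (*-cancelˡ N≢0 (trans (sym (recover-D C D w z)) (trans (cong₂ (λ s t → w * t - z * s) c d) (recover-D C′ D′ w z))))

  -- The lattice for ζ = √n and ζ = √k.
  module CrossModel (p q′ : ℚ) (p-odd : IsOdd p) (q′-int : IsInt q′)
    (comax : ∃₂ λ α β → IsInt α × IsInt β × α * p + β * q′ ≡ 1ℚ) where

    q : ℚ
    q = 2ℚ * q′

    open Action p q public

    -- The parity condition links `v`, a coordinate in ℚ(ζ), with `z` in the complement, so the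
    -- lattice does not split along the two summands.
    O : ℚ⁴ → Set
    O (u , v , w , z) = IsInt u × IsInt v × IsInt w × IsInt z × IsEven (v - z)

    private
      p-int : IsInt p
      p-int = odd⇒int p-odd
      q-int : IsInt q
      q-int = 2ᴵ *ᴵ q′-int

    -- Three lattice points suffice. One image shows Dp; another shows Dq = 2Dq′, which the parity
    -- condition makes even, so Dq′ is an integer. Comaximality of p and q′ then recovers D.
    stabiliser-int : ∀ A B C D → Stabilises O (A , B , C , D) → IsInt A × IsInt B × IsInt C × IsInt D × IsEven (B - C)
    stabiliser-int A B C D st = A-int , B-int , C-int , D-int , B-C-even
      where
      e₁ = st (1ℚ , 0ℚ , 0ℚ , 0ℚ) (1ᴵ , 0ᴵ , 0ᴵ , 0ᴵ , 0ℚ , 0ᴵ , refl)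
      e₂ = st (0ℚ , 1ℚ , 0ℚ , 1ℚ) (0ᴵ , 1ᴵ , 0ᴵ , 1ᴵ , 0ℚ , 0ᴵ , refl)
      e₃ = st (0ℚ , 0ℚ , 1ℚ , 0ℚ) (0ᴵ , 0ᴵ , 1ᴵ , 0ᴵ , 0ℚ , 0ᴵ , refl)
      A-int : IsInt A
      A-int = subst IsInt (*-identityʳ A) (proj₁ e₁)
      B-int : IsInt B
      B-int = subst IsInt (*-identityʳ B) (proj₁ (proj₂ e₂))
      C-int : IsInt C
      C-int = subst IsInt (identity p C D) (proj₁ (proj₂ (proj₂ e₃)))
        where
        identity : ∀ p C D → C * 1ℚ - D * (p * 0ℚ) ≡ C
        identity = solve-∀ ℚ-ring
      Dp-int : IsInt (- (D * p))
      Dp-int = subst IsInt (identity p C D) (proj₁ (proj₂ (proj₂ e₂)))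
        where
        identity : ∀ p C D → C * 0ℚ - D * (p * 1ℚ) ≡ - (D * p)
        identity = solve-∀ ℚ-ring
      Dq′-int : IsInt (D * q′)
      Dq′-int = let r , r-int , eq = proj₂ (proj₂ (proj₂ (proj₂ e₃))) in
        subst IsInt (*-cancelˡ 2≢0 (combine 1ℚ eq (identity q′ B C D r))) (-ᴵ r-int)
        where
        identity : ∀ q′ B C D r → 2ℚ * - r - 2ℚ * (D * q′) ≡ 1ℚ * (B * 0ℚ - (C * 0ℚ + D * (2ℚ * q′ * 1ℚ)) - 2ℚ * r)
        identity = solve-∀ ℚ-ring
      D-int : IsInt D
      D-int = let α , β , α-int , β-int , eq = comax in
        subst IsInt (combine D eq (identity p q′ D α β)) (α-int *ᴵ -ᴵ Dp-int +ᴵ β-int *ᴵ Dq′-int)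
        where
        identity : ∀ p q′ D α β → α * - (- (D * p)) + β * (D * q′) - D ≡ D * (α * p + β * q′ - 1ℚ)
        identity = solve-∀ ℚ-ring
      B-C-even : IsEven (B - C)
      B-C-even = let r , r-int , eq = proj₂ (proj₂ (proj₂ (proj₂ e₂))) in
        r , r-int , trans (identity q B C D) eq
        where
        identity : ∀ q B C D → B - C ≡ B * 1ℚ - (C * 1ℚ + D * (q * 0ℚ))
        identity = solve-∀ ℚ-ring

    int-stabiliser : ∀ {A B C D} → IsInt A → IsInt B → IsInt C → IsInt D → IsEven (B - C) → Stabilises O (A , B , C , D)
    int-stabiliser {A} {B} {C} {D} A-int B-int C-int D-int (r , r-int , B-C≡2r) (u , v , w , z) (u-int , v-int , w-int , z-int , s , s-int , v-z≡2s) =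
      A-int *ᴵ u-int , B-int *ᴵ v-int , C-int *ᴵ w-int -ᴵ D-int *ᴵ (p-int *ᴵ z-int) , C-int *ᴵ z-int +ᴵ D-int *ᴵ (q-int *ᴵ w-int) ,
      B * s + r * z - D * (q′ * w) , B-int *ᴵ s-int +ᴵ r-int *ᴵ z-int -ᴵ D-int *ᴵ (q′-int *ᴵ w-int) ,
      combine₂ z B B-C≡2r v-z≡2s (identity q′ B C D v w z r s)
      where
      identity : ∀ q′ B C D v w z r s → B * v - (C * z + D * (2ℚ * q′ * w)) - 2ℚ * (B * s + r * z - D * (q′ * w)) ≡
        z * (B - C - 2ℚ * r) + B * (v - z - 2ℚ * s)
      identity = solve-∀ ℚ-ring

    -- The two targets are lattice points whose (w, z)-parts form the identity matrix, so
    -- `determinant` exhibits an integral inverse of the norm.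
    generator⇒unit : ∀ {u v w z} → O (u , v , w , z) →
      (∀ y → O y → ∃ λ s → Stabilises O s × act s (u , v , w , z) ≡ y) → IsUnit (norm w z)
    generator⇒unit {w = w} {z} (_ , _ , w-int , z-int , _) onto
      with onto (0ℚ , 0ℚ , 1ℚ , 0ℚ) (0ᴵ , 0ᴵ , 1ᴵ , 0ᴵ , 0ℚ , 0ᴵ , refl)
         | onto (0ℚ , 1ℚ , 0ℚ , 1ℚ) (0ᴵ , 1ᴵ , 0ᴵ , 1ᴵ , 0ℚ , 0ᴵ , refl)
    ... | (A , B , C , D) , st , eq | (A′ , B′ , C′ , D′) , st′ , eq′ =
      let _ , _ , C-int , D-int , _ = stabiliser-int A B C D st
          _ , _ , C′-int , D′-int , _ = stabiliser-int A′ B′ C′ D′ st′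
          _ , _ , e₁ , e₂ = ≡-sum eq
          _ , _ , e₁′ , e₂′ = ≡-sum eq′
      in int-unit (q-int *ᴵ (w-int *ᴵ w-int) +ᴵ p-int *ᴵ (z-int *ᴵ z-int)) (C-int *ᴵ D′-int -ᴵ D-int *ᴵ C′-int)
        (trans (*-comm (norm w z) (C * D′ - D * C′)) (trans (sym (determinant C D C′ D′ w z))
          (cong₂ _-_ (cong₂ _*_ e₁ e₂′) (cong₂ _*_ e₂ e₁′))))

    -- Cramer's rule gives C and D, the determinant e = ±1 being its own inverse. It remains to
    -- check that B = b is congruent to C modulo 2.
    unit⇒generator : ∀ {w z} → O (1ℚ , 1ℚ , w , z) → IsUnit (norm w z) →
      ∀ y → O y → ∃ λ s → Stabilises O s × act s (1ℚ , 1ℚ , w , z) ≡ y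
    unit⇒generator {w} {z} (_ , _ , w-int , z-int , t , t-int , 1-z≡2t) unit
      (a , b , c , d) (a-int , b-int , c-int , d-int , s , s-int , b-d≡2s) =
      (a , b , C , D) ,
      int-stabiliser {a} {b} {C} {D} a-int b-int
        (e-int *ᴵ (q-int *ᴵ w-int *ᴵ c-int +ᴵ p-int *ᴵ z-int *ᴵ d-int))
        (e-int *ᴵ (w-int *ᴵ d-int -ᴵ z-int *ᴵ c-int))
        (parity-bc (b-C p-odd unit)) ,
      quadruple (*-identityʳ a) (*-identityʳ b)
        (combine c (unit-square unit) (identity₁ p q′ w z c d))
        (combine d (unit-square unit) (identity₂ p q′ w z c d))
      where
      e C D : ℚ
      e = norm w z
      e-int : IsInt e
      e-int = unit⇒int unit
      C = e * (q * w * c + p * z * d)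
      D = e * (w * d - z * c)
      identity₁ : ∀ p q′ w z c d → let q = 2ℚ * q′ ; e = q * (w * w) + p * (z * z) in
        e * (q * w * c + p * z * d) * w - e * (w * d - z * c) * (p * z) - c ≡ c * (e * e - 1ℚ)
      identity₁ = solve-∀ ℚ-ring
      identity₂ : ∀ p q′ w z c d → let q = 2ℚ * q′ ; e = q * (w * w) + p * (z * z) in
        e * (q * w * c + p * z * d) * z + e * (w * d - z * c) * (q * w) - d ≡ d * (e * e - 1ℚ)
      identity₂ = solve-∀ ℚ-ring
      parity-bc : (∃ λ f → IsInt f × d - C ≡ 2ℚ * f) → IsEven (b - C)
      parity-bc (f , f-int , d-C≡2f) = s + f , s-int +ᴵ f-int , combine₂ 1ℚ 1ℚ b-d≡2s d-C≡2f (identity b C d s f)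
        where
        identity : ∀ b C d s f → b - C - 2ℚ * (s + f) ≡ 1ℚ * (b - d - 2ℚ * s) + 1ℚ * (d - C - 2ℚ * f)
        identity = solve-∀ ℚ-ring
      -- C = e(qwc + pzd) is congruent to d modulo 2, because q is even and e, p, z are odd; z is
      -- odd as 1 - z = 2t.
      b-C : IsOdd p → IsUnit e → ∃ λ f → IsInt f × d - C ≡ 2ℚ * f
      b-C (p₁ , p₁-int , refl) (inj₁ e≡1) =
        d * (t - p₁ * z) - q′ * w * c ,
        d-int *ᴵ (t-int -ᴵ p₁-int *ᴵ z-int) -ᴵ q′-int *ᴵ w-int *ᴵ c-int ,
        combine₂ (- (q * w * c + p * z * d)) d e≡1 1-z≡2t (identity p₁ q′ w z c d t e)
        where
        identity : ∀ p₁ q′ w z c d t e → let q = 2ℚ * q′ ; p = 1ℚ + 2ℚ * p₁ in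
          d - e * (q * w * c + p * z * d) - 2ℚ * (d * (t - p₁ * z) - q′ * w * c) ≡
          - (q * w * c + p * z * d) * (e - 1ℚ) + d * (1ℚ - z - 2ℚ * t)
        identity = solve-∀ ℚ-ring
      b-C (p₁ , p₁-int , refl) (inj₂ e≡-1) =
        d * (1ℚ - t + p₁ * z) + q′ * w * c ,
        d-int *ᴵ (1ᴵ -ᴵ t-int +ᴵ p₁-int *ᴵ z-int) +ᴵ q′-int *ᴵ w-int *ᴵ c-int ,
        combine₂ (- (q * w * c + p * z * d)) (- d) e≡-1 1-z≡2t (identity p₁ q′ w z c d t e)
        where
        identity : ∀ p₁ q′ w z c d t e → let q = 2ℚ * q′ ; p = 1ℚ + 2ℚ * p₁ in
          d - e * (q * w * c + p * z * d) - 2ℚ * (d * (1ℚ - t + p₁ * z) + q′ * w * c) ≡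
          - (q * w * c + p * z * d) * (e - - 1ℚ) + - d * (1ℚ - z - 2ℚ * t)
        identity = solve-∀ ℚ-ring

  -- The lattice for ζ = √m.
  module DirectModel (p q r : ℚ) (p-odd : IsOdd p) (q-odd : IsOdd q) (r-int : IsInt r) (p+q≡4r : p + q ≡ 4ℚ * r)
    (comax : ∃₂ λ α β → IsInt α × IsInt β × α * p + β * q ≡ 1ℚ) where

    open Action p q public

    -- The parity condition stays inside the (w, z)-block, so this lattice is a direct sum.
    O : ℚ⁴ → Set
    O (u , v , w , z) = IsInt u × IsInt v × IsInt w × IsInt z × IsEven (w - z)

    private
      p-int : IsInt p
      p-int = odd⇒int p-odd
      q-int : IsInt q
      q-int = odd⇒int q-odd

      minus : ∀ {x y t} → x - y ≡ 2ℚ * t → x ≡ y + 2ℚ * t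
      minus {x} {y} {t} eq = combine 1ℚ eq (solve (x ∷ y ∷ t ∷ []) ℚ-ring)
      p≡4r-q : p ≡ 4ℚ * r - q
      p≡4r-q = combine 1ℚ p+q≡4r (solve (p ∷ q ∷ r ∷ []) ℚ-ring)

    -- The (w, z)-block is spanned by (2, 0) and (1, 1), which leaves room for half-integral C and
    -- D, provided both are half-integral together.
    stabiliser-int : ∀ A B C D → Stabilises O (A , B , C , D) →
      IsInt A × IsInt B × IsInt (2ℚ * C) × IsInt (2ℚ * D) × IsEven (2ℚ * C - 2ℚ * D)
    stabiliser-int A B C D st = A-int , B-int , 2C-int , 2D-int , even q-odd (proj₂ (proj₂ (proj₂ (proj₂ e₃))))
      where
      e₁ = st (1ℚ , 0ℚ , 0ℚ , 0ℚ) (1ᴵ , 0ᴵ , 0ᴵ , 0ᴵ , 0ℚ , 0ᴵ , refl)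
      e₂ = st (0ℚ , 1ℚ , 0ℚ , 0ℚ) (0ᴵ , 1ᴵ , 0ᴵ , 0ᴵ , 0ℚ , 0ᴵ , refl)
      e₃ = st (0ℚ , 0ℚ , 2ℚ , 0ℚ) (0ᴵ , 0ᴵ , 2ᴵ , 0ᴵ , 1ℚ , 1ᴵ , refl)
      e₄ = st (0ℚ , 0ℚ , 1ℚ , 1ℚ) (0ᴵ , 0ᴵ , 1ᴵ , 1ᴵ , 0ℚ , 0ᴵ , refl)
      A-int : IsInt A
      A-int = subst IsInt (*-identityʳ A) (proj₁ e₁)
      B-int : IsInt B
      B-int = subst IsInt (*-identityʳ B) (proj₁ (proj₂ e₂))
      2C-int : IsInt (2ℚ * C)
      2C-int = subst IsInt (identity p C D) (proj₁ (proj₂ (proj₂ e₃)))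
        where
        identity : ∀ p C D → C * 2ℚ - D * (p * 0ℚ) ≡ 2ℚ * C
        identity = solve-∀ ℚ-ring
      2Dq-int : IsInt (C * 0ℚ + D * (q * 2ℚ))
      2Dq-int = proj₁ (proj₂ (proj₂ (proj₂ e₃)))
      2D-int : IsInt (2ℚ * D)
      -- The parity condition at (1, 1) reads -D(p + q) = -4rD = 2s, and at (2, 0) the last
      -- coordinate is 2Dq. With αp + βq = 1 and p = 4r - q this gives 2D = -4αs + (β - α)2Dq.
      2D-int = let α , β , α-int , β-int , eq = comax
                   s , s-int , eq′ = proj₂ (proj₂ (proj₂ (proj₂ e₄)))
        in subst IsInt (identity p q r α β C D s eq eq′ p≡4r-q) (4ᴵ *ᴵ α-int *ᴵ -ᴵ s-int +ᴵ (β-int -ᴵ α-int) *ᴵ 2Dq-int)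
        where
        identity : ∀ p q r α β C D s → α * p + β * q ≡ 1ℚ →
          C * 1ℚ - D * (p * 1ℚ) - (C * 1ℚ + D * (q * 1ℚ)) ≡ 2ℚ * s → p ≡ 4ℚ * r - q →
          4ℚ * α * - s + (β - α) * (C * 0ℚ + D * (q * 2ℚ)) ≡ 2ℚ * D
        identity p q r α β C D s eq eq′ refl = combine₂ (2ℚ * D) (2ℚ * α) eq eq′ (expand q r α β C D s)
          where
          expand : ∀ q r α β C D s → 4ℚ * α * - s + (β - α) * (C * 0ℚ + D * (q * 2ℚ)) - 2ℚ * D ≡
            2ℚ * D * (α * (4ℚ * r - q) + β * q - 1ℚ) + 2ℚ * α * (C * 1ℚ - D * ((4ℚ * r - q) * 1ℚ) - (C * 1ℚ + D * (q * 1ℚ)) - 2ℚ * s)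
          expand = solve-∀ ℚ-ring
      even : IsOdd q → IsEven (C * 2ℚ - D * (p * 0ℚ) - (C * 0ℚ + D * (q * 2ℚ))) → IsEven (2ℚ * C - 2ℚ * D)
      even (q₁ , q₁-int , refl) (t , t-int , eq) = t + 2ℚ * D * q₁ , t-int +ᴵ 2D-int *ᴵ q₁-int , combine 1ℚ eq (identity p q₁ C D t)
        where
        identity : ∀ p q₁ C D t → 2ℚ * C - 2ℚ * D - 2ℚ * (t + 2ℚ * D * q₁) ≡
          1ℚ * (C * 2ℚ - D * (p * 0ℚ) - (C * 0ℚ + D * ((1ℚ + 2ℚ * q₁) * 2ℚ)) - 2ℚ * t)
        identity = solve-∀ ℚ-ring

    int-stabiliser : ∀ {A B C D} → IsInt A → IsInt B → IsInt (2ℚ * C) → IsInt (2ℚ * D) → IsEven (2ℚ * C - 2ℚ * D) →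
      Stabilises O (A , B , C , D)
    int-stabiliser {A} {B} {C} {D} A-int B-int 2C-int 2D-int (f , f-int , 2C-2D≡2f)
      (u , v , w , z) (u-int , v-int , w-int , z-int , s , s-int , w-z≡2s) =
      A-int *ᴵ u-int , B-int *ᴵ v-int , w′-int p-odd , z′-int q-odd , even q-odd
      where
      w′-int : IsOdd p → IsInt (C * w - D * (p * z))
      w′-int (p₁ , p₁-int , refl) = subst IsInt (sym (combine₂ C (½ * z) w-z≡2s 2C-2D≡2f (identity p₁ C D w z s f)))
        ((f-int -ᴵ 2D-int *ᴵ p₁-int) *ᴵ z-int +ᴵ 2C-int *ᴵ s-int)
        where
        identity : ∀ p₁ C D w z s f → C * w - D * ((1ℚ + 2ℚ * p₁) * z) - ((f - 2ℚ * D * p₁) * z + 2ℚ * C * s) ≡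
          C * (w - z - 2ℚ * s) + ½ * z * (2ℚ * C - 2ℚ * D - 2ℚ * f)
        identity = solve-∀ ℚ-ring
      z′-int : IsOdd q → IsInt (C * z + D * (q * w))
      z′-int (q₁ , q₁-int , refl) = subst IsInt (sym (combine₂ (D * (1ℚ + 2ℚ * q₁)) (½ * z) w-z≡2s 2C-2D≡2f (identity q₁ C D w z s f)))
        ((f-int +ᴵ 2D-int *ᴵ (1ᴵ +ᴵ q₁-int)) *ᴵ z-int +ᴵ 2D-int *ᴵ (1ᴵ +ᴵ 2ᴵ *ᴵ q₁-int) *ᴵ s-int)
        where
        identity : ∀ q₁ C D w z s f → C * z + D * ((1ℚ + 2ℚ * q₁) * w) - ((f + 2ℚ * D * (1ℚ + q₁)) * z + 2ℚ * D * (1ℚ + 2ℚ * q₁) * s) ≡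
          D * (1ℚ + 2ℚ * q₁) * (w - z - 2ℚ * s) + ½ * z * (2ℚ * C - 2ℚ * D - 2ℚ * f)
        identity = solve-∀ ℚ-ring
      even : IsOdd q → IsEven (C * w - D * (p * z) - (C * z + D * (q * w)))
      -- The difference of the new coordinates is 2s(C - Dq) - D(p + q)z. Since p + q = 4r and 2D is
      -- an integer, the second term is even.
      even (q₁ , q₁-int , refl) = - (2ℚ * D * r * z) + (f - 2ℚ * D * q₁) * s ,
        -ᴵ (2D-int *ᴵ r-int *ᴵ z-int) +ᴵ (f-int -ᴵ 2D-int *ᴵ q₁-int) *ᴵ s-int ,
        identity p w p≡4r-q (minus {w} {z} {s} w-z≡2s)
        where
        identity : ∀ p w → p ≡ 4ℚ * r - (1ℚ + 2ℚ * q₁) → w ≡ z + 2ℚ * s →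
          C * w - D * (p * z) - (C * z + D * ((1ℚ + 2ℚ * q₁) * w)) ≡ 2ℚ * (- (2ℚ * D * r * z) + (f - 2ℚ * D * q₁) * s)
        identity _ _ refl refl = combine s 2C-2D≡2f (expand q₁ r C D z s f)
          where
          expand : ∀ q₁ r C D z s f → C * (z + 2ℚ * s) - D * ((4ℚ * r - (1ℚ + 2ℚ * q₁)) * z) - (C * z + D * ((1ℚ + 2ℚ * q₁) * (z + 2ℚ * s)))
            - 2ℚ * (- (2ℚ * D * r * z) + (f - 2ℚ * D * q₁) * s) ≡ s * (2ℚ * C - 2ℚ * D - 2ℚ * f)
          expand = solve-∀ ℚ-ring

    -- The (w, z)-parts of the two targets have determinant 2. As C - D, C′ - D′, 2D and 2D′ are
    -- integers, so is 2(CD′ - DC′), and its product with δ = norm/4 is 1.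
    generator⇒unit : ∀ {u v w z} → O (u , v , w , z) →
      (∀ y → O y → ∃ λ s → Stabilises O s × act s (u , v , w , z) ≡ y) → ∃ λ e → IsUnit e × norm w z ≡ 4ℚ * e
    generator⇒unit {w = w} {z} (_ , _ , w-int , z-int , x , x-int , w-z≡2x) onto
      with onto (0ℚ , 0ℚ , 2ℚ , 0ℚ) (0ᴵ , 0ᴵ , 2ᴵ , 0ᴵ , 1ℚ , 1ᴵ , refl)
         | onto (0ℚ , 0ℚ , 1ℚ , 1ℚ) (0ᴵ , 0ᴵ , 1ᴵ , 1ᴵ , 0ℚ , 0ᴵ , refl)
    ... | (A , B , C , D) , st , eq | (A′ , B′ , C′ , D′) , st′ , eq′ =
      let _ , _ , _ , 2D-int , f , f-int , 2C-2D≡2f = stabiliser-int A B C D st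
          _ , _ , _ , 2D′-int , f′ , f′-int , 2C′-2D′≡2f′ = stabiliser-int A′ B′ C′ D′ st′
          _ , _ , e₁ , e₂ = ≡-sum eq
          _ , _ , e₁′ , e₂′ = ≡-sum eq′
      in δ , int-unit (r-int *ᴵ (z-int *ᴵ z-int) +ᴵ q-int *ᴵ (x-int *ᴵ z-int +ᴵ x-int *ᴵ x-int)) (f-int *ᴵ 2D′-int -ᴵ f′-int *ᴵ 2D-int)
        (unit C D C′ D′ f f′ 2C-2D≡2f 2C′-2D′≡2f′
          (trans (sym (determinant C D C′ D′ w z)) (cong₂ _-_ (cong₂ _*_ e₁ e₂′) (cong₂ _*_ e₂ e₁′)))) ,
        norm≡4δ
      where
      -- One quarter of qw² + pz² after the substitutions w = z + 2x and p = 4r - q.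
      δ : ℚ
      δ = r * (z * z) + q * (x * z + x * x)
      norm≡4δ : norm w z ≡ 4ℚ * δ
      norm≡4δ = identity p w p≡4r-q (minus {w} {z} {x} w-z≡2x)
        where
        expand : ∀ q r z x → q * ((z + 2ℚ * x) * (z + 2ℚ * x)) + (4ℚ * r - q) * (z * z) ≡ 4ℚ * (r * (z * z) + q * (x * z + x * x))
        expand = solve-∀ ℚ-ring
        identity : ∀ p w → p ≡ 4ℚ * r - q → w ≡ z + 2ℚ * x → q * (w * w) + p * (z * z) ≡ 4ℚ * δ
        identity _ _ refl refl = expand q r z x
      unit : ∀ C D C′ D′ f f′ → 2ℚ * C - 2ℚ * D ≡ 2ℚ * f → 2ℚ * C′ - 2ℚ * D′ ≡ 2ℚ * f′ →
        (C * D′ - D * C′) * norm w z ≡ 2ℚ → δ * (f * (2ℚ * D′) - f′ * (2ℚ * D)) ≡ 1ℚ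
      unit C D C′ D′ f f′ 2C-2D≡2f 2C′-2D′≡2f′ eq =
        trans (combine₂ (- δ * D′) (δ * D) 2C-2D≡2f 2C′-2D′≡2f′ (identity δ C D C′ D′ f f′))
              (cong (½ *_) (trans (cong ((C * D′ - D * C′) *_) (sym norm≡4δ)) eq))
        where
        identity : ∀ δ C D C′ D′ f f′ → δ * (f * (2ℚ * D′) - f′ * (2ℚ * D)) - ½ * ((C * D′ - D * C′) * (4ℚ * δ)) ≡
          - δ * D′ * (2ℚ * C - 2ℚ * D - 2ℚ * f) + δ * D * (2ℚ * C′ - 2ℚ * D′ - 2ℚ * f′)
        identity = solve-∀ ℚ-ring

    -- Cramer's rule with inverse determinant e/4. `K` and `G` are 2C and 2D after substituting w =
    -- z + 2x, c = d + 2s and p = 4r - q, which removes the denominators.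
    unit⇒generator : ∀ {w z e} → O (1ℚ , 1ℚ , w , z) → IsUnit e → norm w z ≡ 4ℚ * e →
      ∀ y → O y → ∃ λ s → Stabilises O s × act s (1ℚ , 1ℚ , w , z) ≡ y
    unit⇒generator {w} {z} {e} (_ , _ , w-int , z-int , x , x-int , w-z≡2x) unit norm≡4e
      (a , b , c , d) (a-int , b-int , c-int , d-int , s , s-int , c-d≡2s) =
      (a , b , C , D) ,
      int-stabiliser {a} {b} {C} {D} a-int b-int
        (subst IsInt (sym 2C≡K) (e-int *ᴵ (2ᴵ *ᴵ r-int *ᴵ z-int *ᴵ d-int +ᴵ q-int *ᴵ (z-int *ᴵ s-int +ᴵ x-int *ᴵ d-int +ᴵ 2ᴵ *ᴵ x-int *ᴵ s-int))))
        (subst IsInt (sym 2D≡G) (e-int *ᴵ (x-int *ᴵ d-int -ᴵ z-int *ᴵ s-int)))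
        (subst IsEven (sym (cong₂ _-_ 2C≡K 2D≡G)) (K-G-even q-odd)) ,
      quadruple (*-identityʳ a) (*-identityʳ b)
        (combine₂ (½ * ½ * e * c) c norm≡4e (unit-square unit) (identity₁ p q w z c d e))
        (combine₂ (½ * ½ * e * d) d norm≡4e (unit-square unit) (identity₂ p q w z c d e))
      where
      C D K G : ℚ
      C = ½ * ½ * e * (q * w * c + p * z * d)
      D = ½ * ½ * e * (w * d - z * c)
      K = e * (2ℚ * r * z * d + q * (z * s + x * d + 2ℚ * x * s))
      G = e * (x * d - z * s)
      e-int : IsInt e
      e-int = unit⇒int unit
      2C≡K : 2ℚ * C ≡ K
      2C≡K = identity p w c p≡4r-q (minus {w} {z} {x} w-z≡2x) (minus {c} {d} {s} c-d≡2s)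
        where
        expand : ∀ q r e z d x s → 2ℚ * (½ * ½ * e * (q * (z + 2ℚ * x) * (d + 2ℚ * s) + (4ℚ * r - q) * z * d)) ≡
          e * (2ℚ * r * z * d + q * (z * s + x * d + 2ℚ * x * s))
        expand = solve-∀ ℚ-ring
        identity : ∀ p w c → p ≡ 4ℚ * r - q → w ≡ z + 2ℚ * x → c ≡ d + 2ℚ * s → 2ℚ * (½ * ½ * e * (q * w * c + p * z * d)) ≡ K
        identity _ _ _ refl refl refl = expand q r e z d x s
      2D≡G : 2ℚ * D ≡ G
      2D≡G = identity w c (minus {w} {z} {x} w-z≡2x) (minus {c} {d} {s} c-d≡2s)
        where
        expand : ∀ e z d x s → 2ℚ * (½ * ½ * e * ((z + 2ℚ * x) * d - z * (d + 2ℚ * s))) ≡ e * (x * d - z * s)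
        expand = solve-∀ ℚ-ring
        identity : ∀ w c → w ≡ z + 2ℚ * x → c ≡ d + 2ℚ * s → 2ℚ * (½ * ½ * e * (w * d - z * c)) ≡ G
        identity _ _ refl refl = expand e z d x s
      K-G-even : IsOdd q → IsEven (K - G)
      K-G-even (q₁ , q₁-int , refl) = e * (r * z * d + q₁ * (z * s + x * d) + q * x * s + z * s) ,
        e-int *ᴵ (r-int *ᴵ z-int *ᴵ d-int +ᴵ q₁-int *ᴵ (z-int *ᴵ s-int +ᴵ x-int *ᴵ d-int) +ᴵ q-int *ᴵ x-int *ᴵ s-int +ᴵ z-int *ᴵ s-int) ,
        identity q₁ r e z d x s
        where
        identity : ∀ q₁ r e z d x s → let q = 1ℚ + 2ℚ * q₁ in
          e * (2ℚ * r * z * d + q * (z * s + x * d + 2ℚ * x * s)) - e * (x * d - z * s) ≡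
          2ℚ * (e * (r * z * d + q₁ * (z * s + x * d) + q * x * s + z * s))
        identity = solve-∀ ℚ-ring
      identity₁ : ∀ p q w z c d e → ½ * ½ * e * (q * w * c + p * z * d) * w - ½ * ½ * e * (w * d - z * c) * (p * z) - c ≡
        ½ * ½ * e * c * (q * (w * w) + p * (z * z) - 4ℚ * e) + c * (e * e - 1ℚ)
      identity₁ = solve-∀ ℚ-ring
      identity₂ : ∀ p q w z c d e → ½ * ½ * e * (q * w * c + p * z * d) * z + ½ * ½ * e * (w * d - z * c) * (q * w) - d ≡
        ½ * ½ * e * d * (q * (w * w) + p * (z * z) - 4ℚ * e) + d * (e * e - 1ℚ)
      identity₂ = solve-∀ ℚ-ring

  -- Parity arguments and quadratic integers.

  odd-even-⊥ : ∀ {x} → IsOdd x → IsEven x → ⊥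
  odd-even-⊥ (r , r-int , refl) (s , s-int , eq) = odd≢even r-int s-int eq

  odd*odd : ∀ {x y} → IsOdd x → IsOdd y → IsOdd (x * y)
  odd*odd (r , r-int , refl) (s , s-int , refl) =
    r + s + 2ℚ * (r * s) , r-int +ᴵ s-int +ᴵ 2ᴵ *ᴵ (r-int *ᴵ s-int) , identity r s
    where
    identity : ∀ r s → (1ℚ + 2ℚ * r) * (1ℚ + 2ℚ * s) ≡ 1ℚ + 2ℚ * (r + s + 2ℚ * (r * s))
    identity = solve-∀ ℚ-ring

  even*int : ∀ {x y} → IsEven x → IsInt y → IsEven (x * y)
  even*int {y = y} (r , r-int , refl) y-int = r * y , r-int *ᴵ y-int , *-assoc 2ℚ r y

  int*even : ∀ {x y} → IsInt x → IsEven y → IsEven (x * y)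
  int*even {x} {y} x-int y-even = subst IsEven (*-comm y x) (even*int y-even x-int)

  odd+even : ∀ {x y} → IsOdd x → IsEven y → IsOdd (x + y)
  odd+even (r , r-int , refl) (s , s-int , refl) = r + s , r-int +ᴵ s-int , identity r s
    where
    identity : ∀ r s → 1ℚ + 2ℚ * r + 2ℚ * s ≡ 1ℚ + 2ℚ * (r + s)
    identity = solve-∀ ℚ-ring

  even+odd : ∀ {x y} → IsEven x → IsOdd y → IsOdd (x + y)
  even+odd {x} {y} x-even y-odd = subst IsOdd (+-comm y x) (odd+even y-odd x-even)

  even-even : ∀ {x y} → IsEven x → IsEven y → IsEven (x - y)
  even-even (r , r-int , refl) (s , s-int , refl) = r - s , r-int -ᴵ s-int , identity r s
    where
    identity : ∀ r s → 2ℚ * r - 2ℚ * s ≡ 2ℚ * (r - s)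
    identity = solve-∀ ℚ-ring

  odd-odd : ∀ {x y} → IsOdd x → IsOdd y → IsEven (x - y)
  odd-odd (r , r-int , refl) (s , s-int , refl) = r - s , r-int -ᴵ s-int , identity r s
    where
    identity : ∀ r s → 1ℚ + 2ℚ * r - (1ℚ + 2ℚ * s) ≡ 2ℚ * (r - s)
    identity = solve-∀ ℚ-ring

  2*int-even : ∀ {x} → IsInt x → IsEven (2ℚ * x)
  2*int-even {x} x-int = x , x-int , refl

  half-even : ∀ {x} → IsEven (2ℚ * x) → IsInt x
  half-even (r , r-int , eq) = subst IsInt (sym (*-cancelˡ 2≢0 eq)) r-int

  -- The residues modulo 4 for which a square-free c gives ℤ[√c] as the full ring of integers of
  -- ℚ(√c).
  IsTwoOrThree : ℚ → Set
  IsTwoOrThree c = (∃ λ a → IsInt a × c ≡ 2ℚ + 4ℚ * a) ⊎ (∃ λ a → IsInt a × c ≡ fromℤ (+ 3) + 4ℚ * a)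

  -- For c ≡ 2 or 3 the form P² - cQ² vanishes modulo 4 only when P and Q are both even; every other
  -- choice of parities is refuted.
  norm-4-even : ∀ {c P Q N} → IsTwoOrThree c → IsInt P → IsInt Q → IsInt N →
    P * P - c * (Q * Q) ≡ 4ℚ * N → IsEven P × IsEven Q
  norm-4-even {c} {P} {Q} {N} c-res P-int Q-int N-int eq = go c-res (parity P-int) (parity Q-int)
    where
    residue-two : ∀ a → 2ℚ + 4ℚ * a ≡ 2ℚ * (1ℚ + 2ℚ * a)
    residue-two = solve-∀ ℚ-ring
    residue-three : ∀ a → fromℤ (+ 3) + 4ℚ * a ≡ 1ℚ + 2ℚ * (1ℚ + 2ℚ * a)
    residue-three = solve-∀ ℚ-ring
    P² : P * P ≡ c * (Q * Q) + 2ℚ * (2ℚ * N)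
    P² = combine 1ℚ eq (solve (P ∷ Q ∷ c ∷ N ∷ []) ℚ-ring)
    4N-even : IsEven (2ℚ * (2ℚ * N))
    4N-even = 2*int-even (2ᴵ *ᴵ N-int)
    c-odd : ∀ {a} → IsInt a → c ≡ fromℤ (+ 3) + 4ℚ * a → IsOdd c
    c-odd {a} a-int c≡ = 1ℚ + 2ℚ * a , 1ᴵ +ᴵ 2ᴵ *ᴵ a-int , trans c≡ (residue-three a)
    go : IsTwoOrThree c → IsEven P ⊎ IsOdd P → IsEven Q ⊎ IsOdd Q → IsEven P × IsEven Q
    go _ (inj₁ P-even) (inj₁ Q-even) = P-even , Q-even
    go (inj₁ (a , a-int , c≡)) (inj₂ P-odd) _ = ⊥-elim (odd-even-⊥ (odd*odd P-odd P-odd) (subst IsEven (sym P²)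
      (subst IsEven (identity c Q N) (even-even (even*int c-even (Q-int *ᴵ Q-int)) (2*int-even (-ᴵ (2ᴵ *ᴵ N-int)))))))
      where
      c-even : IsEven c
      c-even = 1ℚ + 2ℚ * a , 1ᴵ +ᴵ 2ᴵ *ᴵ a-int , trans c≡ (residue-two a)
      identity : ∀ c Q N → c * (Q * Q) - 2ℚ * - (2ℚ * N) ≡ c * (Q * Q) + 2ℚ * (2ℚ * N)
      identity = solve-∀ ℚ-ring
    go (inj₁ (a , a-int , refl)) (inj₁ (r , r-int , refl)) (inj₂ Q-odd) = ⊥-elim (odd-even-⊥
      (odd*odd (a , a-int , refl) (odd*odd Q-odd Q-odd))
      (r * r - N , r-int *ᴵ r-int -ᴵ N-int , combine (- ½) eq (solve (a ∷ r ∷ Q ∷ N ∷ []) ℚ-ring)))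
    go (inj₂ (a , a-int , c≡)) (inj₁ P-even) (inj₂ Q-odd) = ⊥-elim (odd-even-⊥
      (odd+even (odd*odd (c-odd a-int c≡) (odd*odd Q-odd Q-odd)) 4N-even)
      (subst IsEven P² (even*int P-even P-int)))
    go (inj₂ (a , a-int , c≡)) (inj₂ P-odd) (inj₁ Q-even) = ⊥-elim (odd-even-⊥ (odd*odd P-odd P-odd)
      (subst IsEven (sym P²) (subst IsEven (identity c Q N) (even-even (int*even (odd⇒int (c-odd a-int c≡)) (even*int Q-even Q-int)) (2*int-even (-ᴵ (2ᴵ *ᴵ N-int)))))))
      where
      identity : ∀ c Q N → c * (Q * Q) - 2ℚ * - (2ℚ * N) ≡ c * (Q * Q) + 2ℚ * (2ℚ * N)
      identity = solve-∀ ℚ-ring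
    -- Both odd: P² - cQ² ≡ 1 - 3 = -2 (mod 4). Half of the equation equates an odd and an even
    -- number, and the final -1 rewrites its constant term -1 as 1 - 2.
    go (inj₂ (a , a-int , refl)) (inj₂ (i , i-int , refl)) (inj₂ (j , j-int , refl)) = ⊥-elim (odd≢even
      {i + i * i - a - (fromℤ (+ 3) + 4ℚ * a) * (j + j * j) - 1ℚ}
      (i-int +ᴵ i-int *ᴵ i-int -ᴵ a-int -ᴵ (int (+ 3) +ᴵ 4ᴵ *ᴵ a-int) *ᴵ (j-int +ᴵ j-int *ᴵ j-int) -ᴵ 1ᴵ) N-int
      (combine ½ eq (solve (a ∷ i ∷ j ∷ N ∷ []) ℚ-ring)))

  -- The ring of integers of ℚ(√c) is ℤ[√c].
  quadratic-int : ∀ {c} u v → Squarefree c → IsTwoOrThree (fromℤ c) →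
    IsInt (2ℚ * u) → IsInt (u * u - fromℤ c * (v * v)) → IsInt u × IsInt v
  quadratic-int {c} u v sf c-res 2u-int N-int =
    let P-even , Q-even = norm-4-even c-res 2u-int 2v-int N-int (identity (fromℤ c) u v)
    in half-even P-even , half-even Q-even
    where
    identity : ∀ c u v → 2ℚ * u * (2ℚ * u) - c * (2ℚ * v * (2ℚ * v)) ≡ 4ℚ * (u * u - c * (v * v))
    identity = solve-∀ ℚ-ring
    identity′ : ∀ c u v → 2ℚ * u * (2ℚ * u) - 4ℚ * (u * u - c * (v * v)) ≡ c * (2ℚ * v * (2ℚ * v))
    identity′ = solve-∀ ℚ-ring
    -- c(2v)² = (2u)² - 4(u² - cv²) is an integer, and c is square-free.
    2v-int : IsInt (2ℚ * v)
    2v-int = squarefree-root {c} sf (subst IsInt (identity′ (fromℤ c) u v) (2u-int *ᴵ 2u-int -ᴵ 4ᴵ *ᴵ N-int))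

  -- A rational root q of c is an integer, and P = q, Q = 1 would solve P² - cQ² = 0 with Q odd.
  nonsquare : ∀ {c} → IsTwoOrThree c → IsInt c → ∀ q → q * q ≢ c
  nonsquare {c} c-res c-int q qq≡c = go (norm-4-even {N = 0ℚ} c-res q-int 1ᴵ 0ᴵ (combine 1ℚ qq≡c (identity q c)))
    where
    q-int : IsInt q
    q-int = squarefree-root squarefree-1 (subst IsInt (trans (sym qq≡c) (sym (*-identityˡ (q * q)))) c-int)
    identity : ∀ q c → q * q - c * (1ℚ * 1ℚ) - 4ℚ * 0ℚ ≡ 1ℚ * (q * q - c)
    identity = solve-∀ ℚ-ring
    go : IsEven q × IsEven 1ℚ → ⊥
    go (_ , 1-even) = odd-even-⊥ (0ℚ , 0ᴵ , refl) 1-even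

  -- For x = a + b√m + c√n + e√m√n put A = 2a, B = 2b, C = 2c, E = 2de; the equations say that the
  -- norm of x to ℚ(√m) is P + Q√m. They make A² + MB² and AB even, hence A and B. Then h(dC² +
  -- m′E²) is even with h, d, m′ odd, so C and E have the same parity.
  biquadratic-parity : ∀ {M A B C E h d m′ P Q} → IsOdd M → IsOdd h → IsOdd d → IsOdd m′ →
    IsInt A → IsInt B → IsInt C → IsInt E → IsInt P → IsInt Q →
    A * A + M * (B * B) - 2ℚ * h * (d * (C * C) + m′ * (E * E)) ≡ 4ℚ * P → A * B - 2ℚ * h * (C * E) ≡ 2ℚ * Q →
    IsEven A × IsEven B × IsEven (C - E)
  biquadratic-parity {M} {A} {B} {C} {E} {h} {d} {m′} {P} {Q} M-odd h-odd d-odd m′-odd A-int B-int C-int E-int P-int Q-int eq eq′ =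
    go (parity A-int) (parity B-int)
    where
    h-int = odd⇒int h-odd
    d-int = odd⇒int d-odd
    m′-int = odd⇒int m′-odd
    A²+MB² : A * A + M * (B * B) ≡ 2ℚ * (2ℚ * P + h * (d * (C * C) + m′ * (E * E)))
    A²+MB² = combine 1ℚ eq (solve (A ∷ B ∷ C ∷ E ∷ M ∷ h ∷ d ∷ m′ ∷ P ∷ []) ℚ-ring)
    A²+MB²-even : IsEven (A * A + M * (B * B))
    A²+MB²-even = _ , 2ᴵ *ᴵ P-int +ᴵ h-int *ᴵ (d-int *ᴵ (C-int *ᴵ C-int) +ᴵ m′-int *ᴵ (E-int *ᴵ E-int)) , A²+MB²
    AB-even : IsEven (A * B)
    AB-even = h * (C * E) + Q , h-int *ᴵ (C-int *ᴵ E-int) +ᴵ Q-int , combine 1ℚ eq′ (solve (A ∷ B ∷ C ∷ E ∷ h ∷ Q ∷ []) ℚ-ring)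
    C-E-even : IsEven (h * (d * (C * C) + m′ * (E * E))) → IsEven (C - E)
    C-E-even even = choose (parity C-int) (parity E-int)
      where
      choose : IsEven C ⊎ IsOdd C → IsEven E ⊎ IsOdd E → IsEven (C - E)
      choose (inj₁ C-even) (inj₁ E-even) = even-even C-even E-even
      choose (inj₂ C-odd) (inj₂ E-odd) = odd-odd C-odd E-odd
      choose (inj₂ C-odd) (inj₁ E-even) = ⊥-elim (odd-even-⊥
        (odd*odd h-odd (odd+even (odd*odd d-odd (odd*odd C-odd C-odd)) (int*even m′-int (even*int E-even E-int)))) even)
      choose (inj₁ C-even) (inj₂ E-odd) = ⊥-elim (odd-even-⊥
        (odd*odd h-odd (even+odd (int*even d-int (even*int C-even C-int)) (odd*odd m′-odd (odd*odd E-odd E-odd)))) even)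
    go : IsEven A ⊎ IsOdd A → IsEven B ⊎ IsOdd B → IsEven A × IsEven B × IsEven (C - E)
    go (inj₂ A-odd) (inj₂ B-odd) = ⊥-elim (odd-even-⊥ (odd*odd A-odd B-odd) AB-even)
    go (inj₂ A-odd) (inj₁ B-even) = ⊥-elim (odd-even-⊥
      (odd+even (odd*odd A-odd A-odd) (int*even (odd⇒int M-odd) (even*int B-even B-int))) A²+MB²-even)
    go (inj₁ A-even) (inj₂ B-odd) = ⊥-elim (odd-even-⊥
      (even+odd (even*int A-even A-int) (odd*odd M-odd (odd*odd B-odd B-odd))) A²+MB²-even)
    go (inj₁ A-even@(a , a-int , refl)) (inj₁ B-even@(b , b-int , refl)) = A-even , B-even ,
      C-E-even (a * a + M * (b * b) - P , a-int *ᴵ a-int +ᴵ odd⇒int M-odd *ᴵ (b-int *ᴵ b-int) -ᴵ P-int , combine (- ½) eq (solve (a ∷ b ∷ M ∷ h ∷ d ∷ m′ ∷ C ∷ E ∷ P ∷ []) ℚ-ring))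

open Rationals

L-≡ : ∀ {a a′ b b′ c c′ e e′} → a ≡ a′ → b ≡ b′ → c ≡ c′ → e ≡ e′ → ⟨ a , b , c , e ⟩ ≡ ⟨ a′ , b′ , c′ , e′ ⟩
L-≡ refl refl refl refl = refl

-- The ring laws of L in coordinates.

module Identities where
  open import Data.Rational using (_+_; _*_)

  assoc₀ : ∀ M N a₀ a₁ a₂ a₃ b₀ b₁ b₂ b₃ c₀ c₁ c₂ c₃ →
    (a₀ * b₀ + M * (a₁ * b₁) + N * (a₂ * b₂) + M * N * (a₃ * b₃)) * c₀ + M * ((a₀ * b₁ + a₁ * b₀ + N * (a₂ * b₃ + a₃ * b₂)) * c₁)
      + N * ((a₀ * b₂ + a₂ * b₀ + M * (a₁ * b₃ + a₃ * b₁)) * c₂) + M * N * ((a₀ * b₃ + a₃ * b₀ + a₁ * b₂ + a₂ * b₁) * c₃) ≡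
    a₀ * (b₀ * c₀ + M * (b₁ * c₁) + N * (b₂ * c₂) + M * N * (b₃ * c₃)) + M * (a₁ * (b₀ * c₁ + b₁ * c₀ + N * (b₂ * c₃ + b₃ * c₂)))
      + N * (a₂ * (b₀ * c₂ + b₂ * c₀ + M * (b₁ * c₃ + b₃ * c₁))) + M * N * (a₃ * (b₀ * c₃ + b₃ * c₀ + b₁ * c₂ + b₂ * c₁))
  assoc₀ = solve-∀ ℚ-ring

  assoc₁ : ∀ M N a₀ a₁ a₂ a₃ b₀ b₁ b₂ b₃ c₀ c₁ c₂ c₃ →
    (a₀ * b₀ + M * (a₁ * b₁) + N * (a₂ * b₂) + M * N * (a₃ * b₃)) * c₁ + (a₀ * b₁ + a₁ * b₀ + N * (a₂ * b₃ + a₃ * b₂)) * c₀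
      + N * ((a₀ * b₂ + a₂ * b₀ + M * (a₁ * b₃ + a₃ * b₁)) * c₃ + (a₀ * b₃ + a₃ * b₀ + a₁ * b₂ + a₂ * b₁) * c₂) ≡
    a₀ * (b₀ * c₁ + b₁ * c₀ + N * (b₂ * c₃ + b₃ * c₂)) + a₁ * (b₀ * c₀ + M * (b₁ * c₁) + N * (b₂ * c₂) + M * N * (b₃ * c₃))
      + N * (a₂ * (b₀ * c₃ + b₃ * c₀ + b₁ * c₂ + b₂ * c₁) + a₃ * (b₀ * c₂ + b₂ * c₀ + M * (b₁ * c₃ + b₃ * c₁)))
  assoc₁ = solve-∀ ℚ-ring

  assoc₂ : ∀ M N a₀ a₁ a₂ a₃ b₀ b₁ b₂ b₃ c₀ c₁ c₂ c₃ →
    (a₀ * b₀ + M * (a₁ * b₁) + N * (a₂ * b₂) + M * N * (a₃ * b₃)) * c₂ + (a₀ * b₂ + a₂ * b₀ + M * (a₁ * b₃ + a₃ * b₁)) * c₀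
      + M * ((a₀ * b₁ + a₁ * b₀ + N * (a₂ * b₃ + a₃ * b₂)) * c₃ + (a₀ * b₃ + a₃ * b₀ + a₁ * b₂ + a₂ * b₁) * c₁) ≡
    a₀ * (b₀ * c₂ + b₂ * c₀ + M * (b₁ * c₃ + b₃ * c₁)) + a₂ * (b₀ * c₀ + M * (b₁ * c₁) + N * (b₂ * c₂) + M * N * (b₃ * c₃))
      + M * (a₁ * (b₀ * c₃ + b₃ * c₀ + b₁ * c₂ + b₂ * c₁) + a₃ * (b₀ * c₁ + b₁ * c₀ + N * (b₂ * c₃ + b₃ * c₂)))
  assoc₂ = solve-∀ ℚ-ring

  assoc₃ : ∀ M N a₀ a₁ a₂ a₃ b₀ b₁ b₂ b₃ c₀ c₁ c₂ c₃ →
    (a₀ * b₀ + M * (a₁ * b₁) + N * (a₂ * b₂) + M * N * (a₃ * b₃)) * c₃ + (a₀ * b₃ + a₃ * b₀ + a₁ * b₂ + a₂ * b₁) * c₀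
      + (a₀ * b₁ + a₁ * b₀ + N * (a₂ * b₃ + a₃ * b₂)) * c₂ + (a₀ * b₂ + a₂ * b₀ + M * (a₁ * b₃ + a₃ * b₁)) * c₁ ≡
    a₀ * (b₀ * c₃ + b₃ * c₀ + b₁ * c₂ + b₂ * c₁) + a₃ * (b₀ * c₀ + M * (b₁ * c₁) + N * (b₂ * c₂) + M * N * (b₃ * c₃))
      + a₁ * (b₀ * c₂ + b₂ * c₀ + M * (b₁ * c₃ + b₃ * c₁)) + a₂ * (b₀ * c₁ + b₁ * c₀ + N * (b₂ * c₃ + b₃ * c₂))
  assoc₃ = solve-∀ ℚ-ring

  comm₀ : ∀ M N a₀ a₁ a₂ a₃ b₀ b₁ b₂ b₃ →
    a₀ * b₀ + M * (a₁ * b₁) + N * (a₂ * b₂) + M * N * (a₃ * b₃) ≡ b₀ * a₀ + M * (b₁ * a₁) + N * (b₂ * a₂) + M * N * (b₃ * a₃)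
  comm₀ = solve-∀ ℚ-ring

  -- Exchanging √m with √n swaps M with N and index 1 with index 2, so this identity also serves the
  -- √n-coordinate.
  comm₁ : ∀ N a₀ a₁ a₂ a₃ b₀ b₁ b₂ b₃ →
    a₀ * b₁ + a₁ * b₀ + N * (a₂ * b₃ + a₃ * b₂) ≡ b₀ * a₁ + b₁ * a₀ + N * (b₂ * a₃ + b₃ * a₂)
  comm₁ = solve-∀ ℚ-ring

  comm₃ : ∀ a₀ a₁ a₂ a₃ b₀ b₁ b₂ b₃ →
    a₀ * b₃ + a₃ * b₀ + a₁ * b₂ + a₂ * b₁ ≡ b₀ * a₃ + b₃ * a₀ + b₁ * a₂ + b₂ * a₁
  comm₃ = solve-∀ ℚ-ring

  distrib₀ : ∀ M N a₀ a₁ a₂ a₃ b₀ b₁ b₂ b₃ c₀ c₁ c₂ c₃ →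
    a₀ * (b₀ + c₀) + M * (a₁ * (b₁ + c₁)) + N * (a₂ * (b₂ + c₂)) + M * N * (a₃ * (b₃ + c₃)) ≡
    a₀ * b₀ + M * (a₁ * b₁) + N * (a₂ * b₂) + M * N * (a₃ * b₃) + (a₀ * c₀ + M * (a₁ * c₁) + N * (a₂ * c₂) + M * N * (a₃ * c₃))
  distrib₀ = solve-∀ ℚ-ring

  distrib₁ : ∀ N a₀ a₁ a₂ a₃ b₀ b₁ b₂ b₃ c₀ c₁ c₂ c₃ →
    a₀ * (b₁ + c₁) + a₁ * (b₀ + c₀) + N * (a₂ * (b₃ + c₃) + a₃ * (b₂ + c₂)) ≡
    a₀ * b₁ + a₁ * b₀ + N * (a₂ * b₃ + a₃ * b₂) + (a₀ * c₁ + a₁ * c₀ + N * (a₂ * c₃ + a₃ * c₂))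
  distrib₁ = solve-∀ ℚ-ring

  distrib₃ : ∀ a₀ a₁ a₂ a₃ b₀ b₁ b₂ b₃ c₀ c₁ c₂ c₃ →
    a₀ * (b₃ + c₃) + a₃ * (b₀ + c₀) + a₁ * (b₂ + c₂) + a₂ * (b₁ + c₁) ≡
    a₀ * b₃ + a₃ * b₀ + a₁ * b₂ + a₂ * b₁ + (a₀ * c₃ + a₃ * c₀ + a₁ * c₂ + a₂ * c₁)
  distrib₃ = solve-∀ ℚ-ring

  identity₀ : ∀ M N a₀ a₁ a₂ a₃ → 1ℚ * a₀ + M * (0ℚ * a₁) + N * (0ℚ * a₂) + M * N * (0ℚ * a₃) ≡ a₀
  identity₀ = solve-∀ ℚ-ring

  identity₁ : ∀ N a₀ a₁ a₂ a₃ → 1ℚ * a₁ + 0ℚ * a₀ + N * (0ℚ * a₃ + 0ℚ * a₂) ≡ a₁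
  identity₁ = solve-∀ ℚ-ring

  identity₃ : ∀ a₀ a₁ a₂ a₃ → 1ℚ * a₃ + 0ℚ * a₀ + 0ℚ * a₂ + 0ℚ * a₁ ≡ a₃
  identity₃ = solve-∀ ℚ-ring

  ·-*₀ : ∀ D E M N a₀ a₁ a₂ a₃ b₀ b₁ b₂ b₃ →
    D * a₀ * (E * b₀) + M * (D * a₁ * (E * b₁)) + N * (D * a₂ * (E * b₂)) + M * N * (D * a₃ * (E * b₃)) ≡
    D * E * (a₀ * b₀ + M * (a₁ * b₁) + N * (a₂ * b₂) + M * N * (a₃ * b₃))
  ·-*₀ = solve-∀ ℚ-ring

  ·-*₁ : ∀ D E N a₀ a₁ a₂ a₃ b₀ b₁ b₂ b₃ →
    D * a₀ * (E * b₁) + D * a₁ * (E * b₀) + N * (D * a₂ * (E * b₃) + D * a₃ * (E * b₂)) ≡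
    D * E * (a₀ * b₁ + a₁ * b₀ + N * (a₂ * b₃ + a₃ * b₂))
  ·-*₁ = solve-∀ ℚ-ring

  ·-*₃ : ∀ D E a₀ a₁ a₂ a₃ b₀ b₁ b₂ b₃ →
    D * a₀ * (E * b₃) + D * a₃ * (E * b₀) + D * a₁ * (E * b₂) + D * a₂ * (E * b₁) ≡
    D * E * (a₀ * b₃ + a₃ * b₀ + a₁ * b₂ + a₂ * b₁)
  ·-*₃ = solve-∀ ℚ-ring

-- The ring L and elements with bounded denominators.

module BiquadraticRing (m n : ℤ) .{{m≢0 : ℤ.NonZero m}} .{{n≢0 : ℤ.NonZero n}} where

  open Biquadratic m n

  M N : ℚ
  M = fromℤ m
  N = fromℤ n

  open Identities

  *-assoc : ∀ x y z → (x * y) * z ≡ x * (y * z)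
  *-assoc ⟨ a₀ , a₁ , a₂ , a₃ ⟩ ⟨ b₀ , b₁ , b₂ , b₃ ⟩ ⟨ c₀ , c₁ , c₂ , c₃ ⟩ = L-≡
    (assoc₀ M N a₀ a₁ a₂ a₃ b₀ b₁ b₂ b₃ c₀ c₁ c₂ c₃) (assoc₁ M N a₀ a₁ a₂ a₃ b₀ b₁ b₂ b₃ c₀ c₁ c₂ c₃)
    (assoc₂ M N a₀ a₁ a₂ a₃ b₀ b₁ b₂ b₃ c₀ c₁ c₂ c₃) (assoc₃ M N a₀ a₁ a₂ a₃ b₀ b₁ b₂ b₃ c₀ c₁ c₂ c₃)

  *-comm : ∀ x y → x * y ≡ y * x
  *-comm ⟨ a₀ , a₁ , a₂ , a₃ ⟩ ⟨ b₀ , b₁ , b₂ , b₃ ⟩ = L-≡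
    (comm₀ M N a₀ a₁ a₂ a₃ b₀ b₁ b₂ b₃) (comm₁ N a₀ a₁ a₂ a₃ b₀ b₁ b₂ b₃)
    (comm₁ M a₀ a₂ a₁ a₃ b₀ b₂ b₁ b₃) (comm₃ a₀ a₁ a₂ a₃ b₀ b₁ b₂ b₃)

  *-distribˡ-+ : ∀ x y z → x * (y + z) ≡ x * y + x * z
  *-distribˡ-+ ⟨ a₀ , a₁ , a₂ , a₃ ⟩ ⟨ b₀ , b₁ , b₂ , b₃ ⟩ ⟨ c₀ , c₁ , c₂ , c₃ ⟩ = L-≡
    (distrib₀ M N a₀ a₁ a₂ a₃ b₀ b₁ b₂ b₃ c₀ c₁ c₂ c₃) (distrib₁ N a₀ a₁ a₂ a₃ b₀ b₁ b₂ b₃ c₀ c₁ c₂ c₃)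
    (distrib₁ M a₀ a₂ a₁ a₃ b₀ b₂ b₁ b₃ c₀ c₂ c₁ c₃) (distrib₃ a₀ a₁ a₂ a₃ b₀ b₁ b₂ b₃ c₀ c₁ c₂ c₃)

  *-distribʳ-+ : ∀ x y z → (y + z) * x ≡ y * x + z * x
  *-distribʳ-+ x y z = trans (*-comm (y + z) x) (trans (*-distribˡ-+ x y z) (cong₂ _+_ (*-comm x y) (*-comm x z)))

  *-identityˡ : ∀ x → 1L * x ≡ x
  *-identityˡ ⟨ a₀ , a₁ , a₂ , a₃ ⟩ = L-≡
    (identity₀ M N a₀ a₁ a₂ a₃) (identity₁ N a₀ a₁ a₂ a₃) (identity₁ M a₀ a₂ a₁ a₃) (identity₃ a₀ a₁ a₂ a₃)

  *-identityʳ : ∀ x → x * 1L ≡ x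
  *-identityʳ x = trans (*-comm x 1L) (*-identityˡ x)

  +-assoc : ∀ x y z → (x + y) + z ≡ x + (y + z)
  +-assoc ⟨ a₀ , a₁ , a₂ , a₃ ⟩ ⟨ b₀ , b₁ , b₂ , b₃ ⟩ ⟨ c₀ , c₁ , c₂ , c₃ ⟩ =
    L-≡ (ℚₚ.+-assoc a₀ b₀ c₀) (ℚₚ.+-assoc a₁ b₁ c₁) (ℚₚ.+-assoc a₂ b₂ c₂) (ℚₚ.+-assoc a₃ b₃ c₃)

  +-comm : ∀ x y → x + y ≡ y + x
  +-comm ⟨ a₀ , a₁ , a₂ , a₃ ⟩ ⟨ b₀ , b₁ , b₂ , b₃ ⟩ =
    L-≡ (ℚₚ.+-comm a₀ b₀) (ℚₚ.+-comm a₁ b₁) (ℚₚ.+-comm a₂ b₂) (ℚₚ.+-comm a₃ b₃)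

  +-identityˡ : ∀ x → 0L + x ≡ x
  +-identityˡ ⟨ a₀ , a₁ , a₂ , a₃ ⟩ = L-≡ (ℚₚ.+-identityˡ a₀) (ℚₚ.+-identityˡ a₁) (ℚₚ.+-identityˡ a₂) (ℚₚ.+-identityˡ a₃)

  +-inverseˡ : ∀ x → - x + x ≡ 0L
  +-inverseˡ ⟨ a₀ , a₁ , a₂ , a₃ ⟩ = L-≡ (ℚₚ.+-inverseˡ a₀) (ℚₚ.+-inverseˡ a₁) (ℚₚ.+-inverseˡ a₂) (ℚₚ.+-inverseˡ a₃)

  L-commutativeRing : CommutativeRing 0ℓ 0ℓ
  L-commutativeRing = record
    { Carrier = L ; _≈_ = _≡_ ; _+_ = _+_ ; _*_ = _*_ ; -_ = -_ ; 0# = 0L ; 1# = 1L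
    ; isCommutativeRing = record
      { isRing = record
        { +-isAbelianGroup = record
          { isGroup = record
            { isMonoid = record
              { isSemigroup = record
                { isMagma = record { isEquivalence = isEquivalence ; ∙-cong = cong₂ _+_ }
                ; assoc = +-assoc }
              ; identity = +-identityˡ , λ x → trans (+-comm x 0L) (+-identityˡ x) }
            ; inverse = +-inverseˡ , λ x → trans (+-comm x (- x)) (+-inverseˡ x)
            ; ⁻¹-cong = cong (λ x → - x) }
          ; comm = +-comm }
        ; *-cong = cong₂ _*_
        ; *-assoc = *-assoc
        ; *-identity = *-identityˡ , *-identityʳ
        ; distrib = *-distribˡ-+ , *-distribʳ-+ }
      ; *-comm = *-comm } }

  open import Algebra.Properties.CommutativeSemiring.Exp (CommutativeRing.commutativeSemiring L-commutativeRing) public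
    using (_^_; ^-distrib-*)

  ·-* : ∀ D E x y → (D · x) * (E · y) ≡ (D ℚ.* E) · (x * y)
  ·-* D E ⟨ a₀ , a₁ , a₂ , a₃ ⟩ ⟨ b₀ , b₁ , b₂ , b₃ ⟩ = L-≡
    (·-*₀ D E M N a₀ a₁ a₂ a₃ b₀ b₁ b₂ b₃) (·-*₁ D E N a₀ a₁ a₂ a₃ b₀ b₁ b₂ b₃)
    (·-*₁ D E M a₀ a₂ a₁ a₃ b₀ b₂ b₁ b₃) (·-*₃ D E a₀ a₁ a₂ a₃ b₀ b₁ b₂ b₃)

  ·-+ : ∀ D x y → D · (x + y) ≡ D · x + D · y
  ·-+ D ⟨ a₀ , a₁ , a₂ , a₃ ⟩ ⟨ b₀ , b₁ , b₂ , b₃ ⟩ =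
    L-≡ (ℚₚ.*-distribˡ-+ D a₀ b₀) (ℚₚ.*-distribˡ-+ D a₁ b₁) (ℚₚ.*-distribˡ-+ D a₂ b₂) (ℚₚ.*-distribˡ-+ D a₃ b₃)

  ·-assoc : ∀ D E x → (D ℚ.* E) · x ≡ D · (E · x)
  ·-assoc D E ⟨ a₀ , a₁ , a₂ , a₃ ⟩ = L-≡ (ℚₚ.*-assoc D E a₀) (ℚₚ.*-assoc D E a₁) (ℚₚ.*-assoc D E a₂) (ℚₚ.*-assoc D E a₃)

  ·-identity : ∀ x → 1ℚ · x ≡ x
  ·-identity ⟨ a₀ , a₁ , a₂ , a₃ ⟩ = L-≡ (ℚₚ.*-identityˡ a₀) (ℚₚ.*-identityˡ a₁) (ℚₚ.*-identityˡ a₂) (ℚₚ.*-identityˡ a₃)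

  *-· : ∀ D x y → x * (D · y) ≡ D · (x * y)
  *-· D x y = trans (cong (_* (D · y)) (sym (·-identity x))) (trans (·-* 1ℚ D x y) (cong (_· (x * y)) (ℚₚ.*-identityˡ D)))

  ·-1L-* : ∀ q x → (q · 1L) * x ≡ q · x
  ·-1L-* q x = trans (*-comm (q · 1L) x) (trans (*-· q x 1L) (cong (q ·_) (*-identityʳ x)))

  x*yz≡y*xz : ∀ x y z → x * (y * z) ≡ y * (x * z)
  x*yz≡y*xz x y z = trans (sym (*-assoc x y z)) (trans (cong (_* z) (*-comm x y)) (*-assoc y x z))

  rational : ℚ → L
  rational q = ⟨ q , 0ℚ , 0ℚ , 0ℚ ⟩

  q·1L : ∀ q → q · 1L ≡ rational q
  q·1L q = L-≡ (ℚₚ.*-identityʳ q) (ℚₚ.*-zeroʳ q) (ℚₚ.*-zeroʳ q) (ℚₚ.*-zeroʳ q)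

  -- ℤ[√m,√n]
  Λ : L → Set
  Λ ⟨ a , b , c , e ⟩ = IsInt a × IsInt b × IsInt c × IsInt e

  Λ-+ : ∀ {x y} → Λ x → Λ y → Λ (x + y)
  Λ-+ (a , b , c , e) (a′ , b′ , c′ , e′) = a +ᴵ a′ , b +ᴵ b′ , c +ᴵ c′ , e +ᴵ e′

  Λ-neg : ∀ {x} → Λ x → Λ (- x)
  Λ-neg (a , b , c , e) = -ᴵ a , -ᴵ b , -ᴵ c , -ᴵ e

  Λ-* : ∀ {x y} → Λ x → Λ y → Λ (x * y)
  Λ-* (a₀ , a₁ , a₂ , a₃) (b₀ , b₁ , b₂ , b₃) =
    a₀ *ᴵ b₀ +ᴵ int m *ᴵ (a₁ *ᴵ b₁) +ᴵ int n *ᴵ (a₂ *ᴵ b₂) +ᴵ int m *ᴵ int n *ᴵ (a₃ *ᴵ b₃) ,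
    a₀ *ᴵ b₁ +ᴵ a₁ *ᴵ b₀ +ᴵ int n *ᴵ (a₂ *ᴵ b₃ +ᴵ a₃ *ᴵ b₂) ,
    a₀ *ᴵ b₂ +ᴵ a₂ *ᴵ b₀ +ᴵ int m *ᴵ (a₁ *ᴵ b₃ +ᴵ a₃ *ᴵ b₁) ,
    a₀ *ᴵ b₃ +ᴵ a₃ *ᴵ b₀ +ᴵ a₁ *ᴵ b₂ +ᴵ a₂ *ᴵ b₁

  Λ-· : ∀ {D x} → IsInt D → Λ x → Λ (D · x)
  Λ-· D-int (a , b , c , e) = D-int *ᴵ a , D-int *ᴵ b , D-int *ᴵ c , D-int *ᴵ e

  Λ-0 : Λ 0L
  Λ-0 = 0ᴵ , 0ᴵ , 0ᴵ , 0ᴵ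

  Denominator : ℚ → Set
  Denominator D = IsInt D × D ≢ 0ℚ

  denominator-* : ∀ {D E} → Denominator D → Denominator E → Denominator (D ℚ.* E)
  denominator-* (D-int , D≢0) (E-int , E≢0) = D-int *ᴵ E-int , λ eq → E≢0 (p*q≡0⇒q≡0 D≢0 eq)

  -- Almost integrality over ℤ[√m,√n] in the sense of complete integral closure: one denominator
  -- serves all powers.
  AlmostIntegral : L → Set
  AlmostIntegral x = ∃ λ D → Denominator D × ∀ j → Λ (D · (x ^ j))

  almostIntegral-* : ∀ {x y} → AlmostIntegral x → AlmostIntegral y → AlmostIntegral (x * y)
  almostIntegral-* {x} {y} (D , D-den , Dx) (E , E-den , Ey) = D ℚ.* E , denominator-* D-den E-den , λ j →
    subst Λ (trans (·-* D E (x ^ j) (y ^ j)) (cong ((D ℚ.* E) ·_) (sym (^-distrib-* x y j)))) (Λ-* (Dx j) (Ey j))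

  almostIntegral-+ : ∀ {x y} → AlmostIntegral x → AlmostIntegral y → AlmostIntegral (x + y)
  almostIntegral-+ {x} {y} (D , D-den , Dx) (E , E-den , Ey) = D ℚ.* E , denominator-* D-den E-den , λ j →
    subst Λ (cong ((D ℚ.* E) ·_) (trans (*-assoc 1L 1L ((x + y) ^ j)) (trans (*-identityˡ _) (*-identityˡ _)))) (mixed j 0 0)
    where
    DE = D ℚ.* E
    open ≡-Reasoning
    -- In place of the binomial theorem: one factor x + y at a time is split off and absorbed into
    -- the powers of x and y.
    mixed : ∀ j i l → Λ (DE · (x ^ i * y ^ l * (x + y) ^ j))
    mixed zero i l = subst Λ (trans (·-* D E (x ^ i) (y ^ l)) (cong (DE ·_) (sym (*-identityʳ (x ^ i * y ^ l))))) (Λ-* (Dx i) (Ey l))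
    mixed (suc j) i l = subst Λ (sym eq) (Λ-+ (mixed j (suc i) l) (mixed j i (suc l)))
      where
      w X Y : L
      w = (x + y) ^ j
      X = x ^ i
      Y = y ^ l
      eq : DE · (X * Y * ((x + y) * w)) ≡ DE · (x * X * Y * w) + DE · (X * (y * Y) * w)
      eq = begin
        DE · (X * Y * ((x + y) * w)) ≡⟨ cong (λ u → DE · (X * Y * u)) (*-distribʳ-+ w x y) ⟩
        DE · (X * Y * (x * w + y * w)) ≡⟨ cong (DE ·_) (*-distribˡ-+ (X * Y) (x * w) (y * w)) ⟩
        DE · (X * Y * (x * w) + X * Y * (y * w)) ≡⟨ cong₂ (λ u v → DE · (u + v)) left right ⟩
        DE · (x * X * Y * w + X * (y * Y) * w) ≡⟨ ·-+ DE (x * X * Y * w) (X * (y * Y) * w) ⟩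
        DE · (x * X * Y * w) + DE · (X * (y * Y) * w) ∎
        where
        left : X * Y * (x * w) ≡ x * X * Y * w
        left = trans (x*yz≡y*xz (X * Y) x w) (trans (sym (*-assoc x (X * Y) w)) (cong (_* w) (sym (*-assoc x X Y))))
        right : X * Y * (y * w) ≡ X * (y * Y) * w
        right = trans (x*yz≡y*xz (X * Y) y w) (trans (sym (*-assoc y (X * Y) w)) (cong (_* w) (x*yz≡y*xz y X Y)))

  clear-denominators : ∀ y → ∃ λ D → Denominator D × Λ (D · y)
  clear-denominators ⟨ a , b , c , e ⟩ =
    let D₀ , den₀ , int₀ = clear a ; D₁ , den₁ , int₁ = clear b ; D₂ , den₂ , int₂ = clear c ; D₃ , den₃ , int₃ = clear e
    in D₀ ℚ.* D₁ ℚ.* (D₂ ℚ.* D₃) , denominator-* (denominator-* den₀ den₁) (denominator-* den₂ den₃) ,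
      subst IsInt (swap₀ D₀ D₁ D₂ D₃ a) (int₀ *ᴵ (proj₁ den₁ *ᴵ (proj₁ den₂ *ᴵ proj₁ den₃))) ,
      subst IsInt (swap₁ D₀ D₁ D₂ D₃ b) (int₁ *ᴵ (proj₁ den₀ *ᴵ (proj₁ den₂ *ᴵ proj₁ den₃))) ,
      subst IsInt (swap₂ D₀ D₁ D₂ D₃ c) (int₂ *ᴵ (proj₁ den₀ *ᴵ (proj₁ den₁ *ᴵ proj₁ den₃))) ,
      subst IsInt (swap₃ D₀ D₁ D₂ D₃ e) (int₃ *ᴵ (proj₁ den₀ *ᴵ (proj₁ den₁ *ᴵ proj₁ den₂)))
    where
    clear : ∀ q → ∃ λ D → Denominator D × IsInt (D ℚ.* q)
    clear q@record{} = fromℤ (↧ q) , (int (↧ q) , fromℤ-≢0 λ ()) , ↥ q , denominator-clears q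
    swap₀ : ∀ D₀ D₁ D₂ D₃ q → D₀ ℚ.* q ℚ.* (D₁ ℚ.* (D₂ ℚ.* D₃)) ≡ D₀ ℚ.* D₁ ℚ.* (D₂ ℚ.* D₃) ℚ.* q
    swap₀ = solve-∀ ℚ-ring
    swap₁ : ∀ D₀ D₁ D₂ D₃ q → D₁ ℚ.* q ℚ.* (D₀ ℚ.* (D₂ ℚ.* D₃)) ≡ D₀ ℚ.* D₁ ℚ.* (D₂ ℚ.* D₃) ℚ.* q
    swap₁ = solve-∀ ℚ-ring
    swap₂ : ∀ D₀ D₁ D₂ D₃ q → D₂ ℚ.* q ℚ.* (D₀ ℚ.* (D₁ ℚ.* D₃)) ≡ D₀ ℚ.* D₁ ℚ.* (D₂ ℚ.* D₃) ℚ.* q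
    swap₂ = solve-∀ ℚ-ring
    swap₃ : ∀ D₀ D₁ D₂ D₃ q → D₃ ℚ.* q ℚ.* (D₀ ℚ.* (D₁ ℚ.* D₂)) ≡ D₀ ℚ.* D₁ ℚ.* (D₂ ℚ.* D₃) ℚ.* q
    swap₃ = solve-∀ ℚ-ring

  clear-powers : ∀ x r → ∃ λ D → Denominator D × (∀ i → i ℕ.≤ r → Λ (D · (x ^ i)))
  clear-powers x zero = let D , den , ok = clear-denominators (x ^ 0) in D , den , λ { zero ℕ.z≤n → ok }
  clear-powers x (suc r) =
    let D , D-den , D-ok = clear-powers x r ; E , E-den , E-ok = clear-denominators (x ^ suc r)
    in D ℚ.* E , denominator-* D-den E-den , λ i i≤ → extend D E D-den E-den D-ok E-ok i (ℕₚ.m≤n⇒m<n∨m≡n i≤)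
    where
    extend : ∀ D E → Denominator D → Denominator E → (∀ i → i ℕ.≤ r → Λ (D · (x ^ i))) → Λ (E · (x ^ suc r)) →
      ∀ i → i ℕ.< suc r ⊎ i ≡ suc r → Λ ((D ℚ.* E) · (x ^ i))
    extend D E D-den E-den D-ok E-ok i (inj₁ (ℕ.s≤s i≤r)) =
      subst Λ (trans (sym (·-assoc E D (x ^ i))) (cong (_· (x ^ i)) (ℚₚ.*-comm E D))) (Λ-· (proj₁ E-den) (D-ok i i≤r))
    extend D E D-den E-den D-ok E-ok i (inj₂ refl) = subst Λ (sym (·-assoc D E (x ^ suc r))) (Λ-· (proj₁ D-den) E-ok)

  -- One Horner step: the value of c + X·p at x, times y, minus c·y equals p(x)·(xy). The induction
  -- therefore passes from y to xy, and every lower power is already known to be in the lattice.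
  leading-power : ∀ x cs y → (∀ i → i ℕ.< length cs → Λ (x ^ i * y)) → Λ (evalMonic cs x * y) → Λ (x ^ length cs * y)
  leading-power x [] y _ ok = ok
  leading-power x (c ∷ cs) y lower ok = subst Λ (trans (x*yz≡y*xz (x ^ length cs) x y) (sym (*-assoc x (x ^ length cs) y)))
    (leading-power x cs (x * y)
      (λ i i< → subst Λ (trans (*-assoc x (x ^ i) y) (x*yz≡y*xz x (x ^ i) y)) (lower (suc i) (ℕ.s≤s i<)))
      (subst Λ eq (Λ-+ ok (Λ-neg (Λ-· (int c) (subst Λ (*-identityˡ y) (lower 0 (ℕ.s≤s ℕ.z≤n))))))))
    where
    open ≡-Reasoning
    E : L
    E = evalMonic cs x
    cancel : ∀ u v → u + v - u ≡ v
    cancel u v = trans (cong (λ w → w + (- u)) (+-comm u v)) (trans (+-assoc v u (- u))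
      (trans (cong (λ u → v + u) (trans (+-comm u (- u)) (+-inverseˡ u))) (trans (+-comm v 0L) (+-identityˡ v))))
    eq : (fromℤ c · 1L + x * E) * y - fromℤ c · y ≡ E * (x * y)
    eq = begin
      (fromℤ c · 1L + x * E) * y - fromℤ c · y ≡⟨ cong (_- (fromℤ c · y)) (*-distribʳ-+ y (fromℤ c · 1L) (x * E)) ⟩
      (fromℤ c · 1L) * y + x * E * y - fromℤ c · y ≡⟨ cong (λ u → u + x * E * y - fromℤ c · y) (·-1L-* (fromℤ c) y) ⟩
      fromℤ c · y + x * E * y - fromℤ c · y ≡⟨ cancel (fromℤ c · y) (x * E * y) ⟩
      x * E * y ≡⟨ *-assoc x E y ⟩
      x * (E * y) ≡⟨ x*yz≡y*xz x E y ⟩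
      E * (x * y) ∎

  0L-* : ∀ y → 0L * y ≡ 0L
  0L-* = CommutativeRing.zeroˡ L-commutativeRing

  -- A common denominator of 1, x, …, xʳ serves for all powers, since xʳ is an integral
  -- combination of the lower ones.
  integral⇒almostIntegral : ∀ {x} → IsIntegral x → AlmostIntegral x
  integral⇒almostIntegral {x} (cs , eq) =
    let D , D-den , D-ok = clear-powers x r in
    D , D-den , λ j → subst Λ (trans (*-identityˡ _) (trans (*-· D (x ^ j) 1L) (cong (D ·_) (*-identityʳ (x ^ j)))))
      (window D j (λ i i≤r → subst Λ (sym (trans (*-· D (x ^ i) 1L) (cong (D ·_) (*-identityʳ (x ^ i))))) (D-ok i i≤r)) 0 ℕ.z≤n)
    where
    r = length cs
    Window : L → Set
    Window y = ∀ i → i ℕ.≤ r → Λ (x ^ i * y)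
    -- Multiplication by x moves the window by one place; only its top entry is new, and the
    -- equation of x reduces it to the others.
    shift : ∀ y → Window y → Window (x * y)
    shift y win i i≤r = go i (ℕₚ.m≤n⇒m<n∨m≡n i≤r)
      where
      below : ∀ i → i ℕ.< r → Λ (x ^ i * (x * y))
      below i i<r = subst Λ (trans (*-assoc x (x ^ i) y) (x*yz≡y*xz x (x ^ i) y)) (win (suc i) i<r)
      go : ∀ i → i ℕ.< r ⊎ i ≡ r → Λ (x ^ i * (x * y))
      go i (inj₁ i<r) = below i i<r
      go i (inj₂ refl) = leading-power x cs (x * y) below (subst Λ (sym (trans (cong (_* (x * y)) eq) (0L-* (x * y)))) Λ-0)
    window : ∀ D j → Window (D · 1L) → Window (x ^ j * (D · 1L))
    window D zero win = subst Window (sym (*-identityˡ (D · 1L))) win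
    window D (suc j) win = subst Window (sym (*-assoc x (x ^ j) (D · 1L))) (shift (x ^ j * (D · 1L)) (window D j win))

  -- The first coordinates of D·qʲ form a geometric sequence of integers with ratio q.
  rational-almostIntegral : ∀ {q} → AlmostIntegral (rational q) → IsInt q
  rational-almostIntegral {q} (D , (D-int , D≢0) , ok) = geometric-int q f
    (λ eq → D≢0 (trans (sym (ℚₚ.*-identityʳ D)) eq))
    (λ j → subst (λ u → D ℚ.* L.c₀ u ≡ q ℚ.* f j) (sym (step j)) (swap D q (L.c₀ (rational q ^ j))))
    (λ j → proj₁ (ok j))
    where
    f : ℕ → ℚ
    f j = D ℚ.* L.c₀ (rational q ^ j)
    step : ∀ j → rational q ^ suc j ≡ q · (rational q ^ j)
    step j = trans (cong (_* (rational q ^ j)) (sym (q·1L q))) (·-1L-* q (rational q ^ j))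
    swap : ∀ D q u → D ℚ.* (q ℚ.* u) ≡ q ℚ.* (D ℚ.* u)
    swap = solve-∀ ℚ-ring

-- A monic quartic from a quadratic over ℚ(√m).

module Quartic (R : CommutativeRing 0ℓ 0ℓ) where
  open CommutativeRing R using (Carrier; _≈_; _+_; _*_; 0#; 1#; *-cong; *-congʳ; *-congˡ; +-congʳ; +-congˡ; *-identityʳ; zeroˡ; distribʳ; commutativeSemiring)
  open import Algebra.Solver.Ring.NaturalCoefficients.Default commutativeSemiring using (_:=_; _:+_; _:*_) renaming (solve to solve-ℕ)
  open import Relation.Binary.Reasoning.Setoid (CommutativeRing.setoid R)

  -- The norm of the quadratic X² + TX + P - (VX + Q)√M, with M′ = -M.
  quartic : ∀ {T P V Q M M′ X S} → S * S ≈ M → M + M′ ≈ 0# → X * X + T * X + P ≈ (V * X + Q) * S →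
    (P * P + M′ * (Q * Q)) + X * (((T * P + T * P) + M′ * (V * Q + V * Q)) +
      X * ((T * T + (P + P) + M′ * (V * V)) + X * ((T + T) + X * 1#))) ≈ 0#
  quartic {T} {P} {V} {Q} {M} {M′} {X} {S} S² M+M′ rel = begin
    (P * P + M′ * (Q * Q)) + X * (((T * P + T * P) + M′ * (V * Q + V * Q)) +
      X * ((T * T + (P + P) + M′ * (V * V)) + X * ((T + T) + X * 1#)))
      ≈⟨ +-congˡ (*-congˡ (+-congˡ (*-congˡ (+-congˡ (*-congˡ (+-congˡ (*-identityʳ X))))))) ⟩
    (P * P + M′ * (Q * Q)) + X * (((T * P + T * P) + M′ * (V * Q + V * Q)) +
      X * ((T * T + (P + P) + M′ * (V * V)) + X * ((T + T) + X)))
      -- Only semiring laws are used here, with `M′` in the place of -M; the relation M + M′ = 0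
      -- enters last.
      ≈⟨ solve-ℕ 6 (λ T P V Q M′ X →
           (P :* P :+ M′ :* (Q :* Q)) :+ X :* (((T :* P :+ T :* P) :+ M′ :* (V :* Q :+ V :* Q)) :+
             X :* ((T :* T :+ (P :+ P) :+ M′ :* (V :* V)) :+ X :* ((T :+ T) :+ X))) :=
           (X :* X :+ T :* X :+ P) :* (X :* X :+ T :* X :+ P) :+ M′ :* ((V :* X :+ Q) :* (V :* X :+ Q)))
         (CommutativeRing.refl R) T P V Q M′ X ⟩
    (X * X + T * X + P) * (X * X + T * X + P) + M′ * (w * w)
      ≈⟨ +-congʳ (*-cong rel rel) ⟩
    w * S * (w * S) + M′ * (w * w)
      ≈⟨ +-congʳ (solve-ℕ 2 (λ w S → w :* S :* (w :* S) := S :* S :* (w :* w)) (CommutativeRing.refl R) w S) ⟩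
    S * S * (w * w) + M′ * (w * w)
      ≈⟨ +-congʳ (*-congʳ S²) ⟩
    M * (w * w) + M′ * (w * w)
      ≈⟨ distribʳ (w * w) M M′ ⟨
    (M + M′) * (w * w)
      ≈⟨ *-congʳ M+M′ ⟩
    0# * (w * w)
      ≈⟨ zeroˡ (w * w) ⟩
    0# ∎
    where
    w : Carrier
    w = V * X + Q

-- Conjugates, traces and norms in coordinates.

module ConjugationIdentities where
  open import Data.Rational using (_+_; _*_; -_; _-_)

  homo₀ : ∀ M N s t a₀ a₁ a₂ a₃ b₀ b₁ b₂ b₃ →
    a₀ * b₀ + M * (s * a₁ * (s * b₁)) + N * (t * a₂ * (t * b₂)) + M * N * (s * t * a₃ * (s * t * b₃))
      - (a₀ * b₀ + M * (a₁ * b₁) + N * (a₂ * b₂) + M * N * (a₃ * b₃)) ≡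
    (M * (a₁ * b₁) + M * N * (a₃ * b₃) * (t * t)) * (s * s - 1ℚ) + (N * (a₂ * b₂) + M * N * (a₃ * b₃)) * (t * t - 1ℚ)
  homo₀ = solve-∀ ℚ-ring

  homo₁ : ∀ N s t a₀ a₁ a₂ a₃ b₀ b₁ b₂ b₃ →
    a₀ * (s * b₁) + s * a₁ * b₀ + N * (t * a₂ * (s * t * b₃) + s * t * a₃ * (t * b₂))
      - s * (a₀ * b₁ + a₁ * b₀ + N * (a₂ * b₃ + a₃ * b₂)) ≡
    s * N * (a₂ * b₃ + a₃ * b₂) * (t * t - 1ℚ)
  homo₁ = solve-∀ ℚ-ring

  homo₂ : ∀ M s t a₀ a₁ a₂ a₃ b₀ b₁ b₂ b₃ →
    a₀ * (t * b₂) + t * a₂ * b₀ + M * (s * a₁ * (s * t * b₃) + s * t * a₃ * (s * b₁))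
      - t * (a₀ * b₂ + a₂ * b₀ + M * (a₁ * b₃ + a₃ * b₁)) ≡
    t * M * (a₁ * b₃ + a₃ * b₁) * (s * s - 1ℚ)
  homo₂ = solve-∀ ℚ-ring

  homo₃ : ∀ s t a₀ a₁ a₂ a₃ b₀ b₁ b₂ b₃ →
    a₀ * (s * t * b₃) + s * t * a₃ * b₀ + s * a₁ * (t * b₂) + t * a₂ * (s * b₁) ≡
    s * t * (a₀ * b₃ + a₃ * b₀ + a₁ * b₂ + a₂ * b₁)
  homo₃ = solve-∀ ℚ-ring

  trace₀ : ∀ u → u + u ≡ 2ℚ * u
  trace₀ = solve-∀ ℚ-ring

  trace± : ∀ v → v + - 1ℚ * v ≡ 0ℚ
  trace± = solve-∀ ℚ-ring

  norm-m₀ : ∀ M N u v → u * u + M * (v * (- 1ℚ * v)) + N * (0ℚ * (1ℚ * 0ℚ)) + M * N * (0ℚ * (- 1ℚ * 1ℚ * 0ℚ)) ≡ u * u - M * (v * v)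
  norm-m₀ = solve-∀ ℚ-ring

  norm-m₁ : ∀ N u v → u * (- 1ℚ * v) + v * u + N * (0ℚ * (- 1ℚ * 1ℚ * 0ℚ) + 0ℚ * (1ℚ * 0ℚ)) ≡ 0ℚ
  norm-m₁ = solve-∀ ℚ-ring

  norm-m₂ : ∀ M u v → u * (1ℚ * 0ℚ) + 0ℚ * u + M * (v * (- 1ℚ * 1ℚ * 0ℚ) + 0ℚ * (- 1ℚ * v)) ≡ 0ℚ
  norm-m₂ = solve-∀ ℚ-ring

  norm-m₃ : ∀ u v → u * (- 1ℚ * 1ℚ * 0ℚ) + 0ℚ * u + v * (1ℚ * 0ℚ) + 0ℚ * (- 1ℚ * v) ≡ 0ℚ
  norm-m₃ = solve-∀ ℚ-ring

  norm-n₀ : ∀ M N u v → u * u + M * (0ℚ * (1ℚ * 0ℚ)) + N * (v * (- 1ℚ * v)) + M * N * (0ℚ * (1ℚ * - 1ℚ * 0ℚ)) ≡ u * u - N * (v * v)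
  norm-n₀ = solve-∀ ℚ-ring

  norm-n₁ : ∀ N u v → u * (1ℚ * 0ℚ) + 0ℚ * u + N * (v * (1ℚ * - 1ℚ * 0ℚ) + 0ℚ * (- 1ℚ * v)) ≡ 0ℚ
  norm-n₁ = solve-∀ ℚ-ring

  norm-n₂ : ∀ M u v → u * (- 1ℚ * v) + v * u + M * (0ℚ * (1ℚ * - 1ℚ * 0ℚ) + 0ℚ * (1ℚ * 0ℚ)) ≡ 0ℚ
  norm-n₂ = solve-∀ ℚ-ring

  norm-n₃ : ∀ u v → u * (1ℚ * - 1ℚ * 0ℚ) + 0ℚ * u + 0ℚ * (- 1ℚ * v) + v * (1ℚ * 0ℚ) ≡ 0ℚ
  norm-n₃ = solve-∀ ℚ-ring

  norm-k₀ : ∀ M N u v → u * u + M * (0ℚ * (- 1ℚ * 0ℚ)) + N * (0ℚ * (1ℚ * 0ℚ)) + M * N * (v * (- 1ℚ * 1ℚ * v)) ≡ u * u - M * N * (v * v)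
  norm-k₀ = solve-∀ ℚ-ring

  norm-k₁ : ∀ N u v → u * (- 1ℚ * 0ℚ) + 0ℚ * u + N * (0ℚ * (- 1ℚ * 1ℚ * v) + v * (1ℚ * 0ℚ)) ≡ 0ℚ
  norm-k₁ = solve-∀ ℚ-ring

  norm-k₂ : ∀ M u v → u * (1ℚ * 0ℚ) + 0ℚ * u + M * (0ℚ * (- 1ℚ * 1ℚ * v) + v * (- 1ℚ * 0ℚ)) ≡ 0ℚ
  norm-k₂ = solve-∀ ℚ-ring

  norm-k₃ : ∀ u v → u * (- 1ℚ * 1ℚ * v) + v * u + 0ℚ * (1ℚ * 0ℚ) + 0ℚ * (- 1ℚ * 0ℚ) ≡ 0ℚ
  norm-k₃ = solve-∀ ℚ-ring

  relative₀ : ∀ M N a b c e → a * a + M * (b * (1ℚ * b)) + N * (c * (- 1ℚ * c)) + M * N * (e * (1ℚ * - 1ℚ * e)) ≡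
    a * a + M * (b * b) - N * (c * c + M * (e * e))
  relative₀ = solve-∀ ℚ-ring

  relative₁ : ∀ N a b c e → a * (1ℚ * b) + b * a + N * (c * (1ℚ * - 1ℚ * e) + e * (- 1ℚ * c)) ≡ 2ℚ * (a * b) - 2ℚ * (N * (c * e))
  relative₁ = solve-∀ ℚ-ring

  relative₂ : ∀ M a b c e → a * (- 1ℚ * c) + c * a + M * (b * (1ℚ * - 1ℚ * e) + e * (1ℚ * b)) ≡ 0ℚ
  relative₂ = solve-∀ ℚ-ring

  relative₃ : ∀ a b c e → a * (1ℚ * - 1ℚ * e) + e * a + b * (- 1ℚ * c) + c * (1ℚ * b) ≡ 0ℚ
  relative₃ = solve-∀ ℚ-ring

  root₀ : ∀ M N → 0ℚ * 0ℚ + M * (1ℚ * 1ℚ) + N * (0ℚ * 0ℚ) + M * N * (0ℚ * 0ℚ) ≡ M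
  root₀ = solve-∀ ℚ-ring

  root₂ : ∀ M → 0ℚ * 0ℚ + 0ℚ * 0ℚ + M * (1ℚ * 0ℚ + 0ℚ * 1ℚ) ≡ 0ℚ
  root₂ = solve-∀ ℚ-ring

  root₁ : ∀ N → 0ℚ * 1ℚ + 1ℚ * 0ℚ + N * (0ℚ * 0ℚ + 0ℚ * 0ℚ) ≡ 0ℚ
  root₁ = solve-∀ ℚ-ring

  product₀ : ∀ M N p q → p * q + M * (0ℚ * 0ℚ) + N * (0ℚ * 0ℚ) + M * N * (0ℚ * 0ℚ) ≡ p * q
  product₀ = solve-∀ ℚ-ring

  product₁ : ∀ N p q → p * 0ℚ + 0ℚ * q + N * (0ℚ * 0ℚ + 0ℚ * 0ℚ) ≡ 0ℚ
  product₁ = solve-∀ ℚ-ring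

  product₃ : ∀ p q → p * 0ℚ + 0ℚ * q + 0ℚ * 0ℚ + 0ℚ * 0ℚ ≡ 0ℚ
  product₃ = solve-∀ ℚ-ring

  -- The components of x² - 2ax + P = (2bx - Q)√m.
  relation₀ : ∀ M N a b c e → let P = a * a + M * (b * b) - N * (c * c + M * (e * e)) ; Q = 2ℚ * (a * b) - 2ℚ * (N * (c * e)) in
    a * a + M * (b * b) + N * (c * c) + M * N * (e * e) + - (2ℚ * a) * a + P ≡
    (2ℚ * b * a + - Q) * 0ℚ + M * ((2ℚ * b * b + 0ℚ) * 1ℚ) + N * ((2ℚ * b * c + 0ℚ) * 0ℚ) + M * N * ((2ℚ * b * e + 0ℚ) * 0ℚ)
  relation₀ = solve-∀ ℚ-ring

  relation₁ : ∀ M N a b c e → let P = a * a + M * (b * b) - N * (c * c + M * (e * e)) ; Q = 2ℚ * (a * b) - 2ℚ * (N * (c * e)) in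
    a * b + b * a + N * (c * e + e * c) + - (2ℚ * a) * b + 0ℚ ≡
    (2ℚ * b * a + - Q) * 1ℚ + (2ℚ * b * b + 0ℚ) * 0ℚ + N * ((2ℚ * b * c + 0ℚ) * 0ℚ + (2ℚ * b * e + 0ℚ) * 0ℚ)
  relation₁ = solve-∀ ℚ-ring

  relation₂ : ∀ M N a b c e → let P = a * a + M * (b * b) - N * (c * c + M * (e * e)) ; Q = 2ℚ * (a * b) - 2ℚ * (N * (c * e)) in
    a * c + c * a + M * (b * e + e * b) + - (2ℚ * a) * c + 0ℚ ≡
    (2ℚ * b * a + - Q) * 0ℚ + (2ℚ * b * c + 0ℚ) * 0ℚ + M * ((2ℚ * b * b + 0ℚ) * 0ℚ + (2ℚ * b * e + 0ℚ) * 1ℚ)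
  relation₂ = solve-∀ ℚ-ring

  relation₃ : ∀ M N a b c e → let P = a * a + M * (b * b) - N * (c * c + M * (e * e)) ; Q = 2ℚ * (a * b) - 2ℚ * (N * (c * e)) in
    a * e + e * a + b * c + c * b + - (2ℚ * a) * e + 0ℚ ≡
    (2ℚ * b * a + - Q) * 0ℚ + (2ℚ * b * e + 0ℚ) * 0ℚ + (2ℚ * b * b + 0ℚ) * 0ℚ + (2ℚ * b * c + 0ℚ) * 1ℚ
  relation₃ = solve-∀ ℚ-ring

module Conjugation (m n : ℤ) .{{m≢0 : ℤ.NonZero m}} .{{n≢0 : ℤ.NonZero n}} where

  open Biquadratic m n
  open BiquadraticRing m n
  open ConjugationIdentities
  open Quartic L-commutativeRing using (quartic)

  -- The signs given to √m and √n are rational variables, so the four automorphisms are treated by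
  -- one identity modulo s² = t² = 1.
  conj : ℚ → ℚ → L → L
  conj s t ⟨ a , b , c , e ⟩ = ⟨ a , s ℚ.* b , t ℚ.* c , s ℚ.* t ℚ.* e ⟩

  conj-* : ∀ {s t} → IsUnit s → IsUnit t → ∀ x y → conj s t (x * y) ≡ conj s t x * conj s t y
  conj-* {s} {t} s-unit t-unit ⟨ a₀ , a₁ , a₂ , a₃ ⟩ ⟨ b₀ , b₁ , b₂ , b₃ ⟩ = sym (L-≡
    (combine₂ (M ℚ.* (a₁ ℚ.* b₁) ℚ.+ M ℚ.* N ℚ.* (a₃ ℚ.* b₃) ℚ.* (t ℚ.* t)) (N ℚ.* (a₂ ℚ.* b₂) ℚ.+ M ℚ.* N ℚ.* (a₃ ℚ.* b₃))
      (unit-square s-unit) (unit-square t-unit) (homo₀ M N s t a₀ a₁ a₂ a₃ b₀ b₁ b₂ b₃))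
    (combine (s ℚ.* N ℚ.* (a₂ ℚ.* b₃ ℚ.+ a₃ ℚ.* b₂)) (unit-square t-unit) (homo₁ N s t a₀ a₁ a₂ a₃ b₀ b₁ b₂ b₃))
    (combine (t ℚ.* M ℚ.* (a₁ ℚ.* b₃ ℚ.+ a₃ ℚ.* b₁)) (unit-square s-unit) (homo₂ M s t a₀ a₁ a₂ a₃ b₀ b₁ b₂ b₃))
    (homo₃ s t a₀ a₁ a₂ a₃ b₀ b₁ b₂ b₃))

  conj-1 : ∀ s t → conj s t 1L ≡ 1L
  conj-1 s t = L-≡ refl (ℚₚ.*-zeroʳ s) (ℚₚ.*-zeroʳ t) (ℚₚ.*-zeroʳ (s ℚ.* t))

  conj-^ : ∀ {s t} → IsUnit s → IsUnit t → ∀ x j → conj s t (x ^ j) ≡ conj s t x ^ j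
  conj-^ {s} {t} _ _ x zero = conj-1 s t
  conj-^ {s} {t} s-unit t-unit x (suc j) =
    trans (conj-* s-unit t-unit x (x ^ j)) (cong (conj s t x *_) (conj-^ s-unit t-unit x j))

  conj-· : ∀ s t D x → conj s t (D · x) ≡ D · conj s t x
  conj-· s t D ⟨ a , b , c , e ⟩ = L-≡ refl (swap s D b) (swap t D c) (swap (s ℚ.* t) D e)
    where
    swap : ∀ s D b → s ℚ.* (D ℚ.* b) ≡ D ℚ.* (s ℚ.* b)
    swap = solve-∀ ℚ-ring

  Λ-conj : ∀ {s t x} → IsUnit s → IsUnit t → Λ x → Λ (conj s t x)
  Λ-conj s-unit t-unit (a , b , c , e) =
    a , unit⇒int s-unit *ᴵ b , unit⇒int t-unit *ᴵ c , unit⇒int s-unit *ᴵ unit⇒int t-unit *ᴵ e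

  almostIntegral-conj : ∀ {s t x} → IsUnit s → IsUnit t → AlmostIntegral x → AlmostIntegral (conj s t x)
  almostIntegral-conj {s} {t} {x} s-unit t-unit (D , D-den , ok) = D , D-den , λ j →
    subst Λ (trans (conj-· s t D (x ^ j)) (cong (D ·_) (conj-^ s-unit t-unit x j))) (Λ-conj s-unit t-unit (ok j))

  1-unit : IsUnit 1ℚ
  1-unit = inj₁ refl

  -1-unit : IsUnit (ℚ.- 1ℚ)
  -1-unit = inj₂ refl

  module _ {u v : ℚ} where

    trace-norm-m : AlmostIntegral ⟨ u , v , 0ℚ , 0ℚ ⟩ → IsInt (2ℚ ℚ.* u) × IsInt (u ℚ.* u ℚ.- M ℚ.* (v ℚ.* v))
    trace-norm-m ai =
      rational-almostIntegral (subst AlmostIntegral (L-≡ (trace₀ u) (trace± v) refl refl) (almostIntegral-+ ai ai′)) ,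
      rational-almostIntegral (subst AlmostIntegral (L-≡ (norm-m₀ M N u v) (norm-m₁ N u v) (norm-m₂ M u v) (norm-m₃ u v)) (almostIntegral-* ai ai′))
      where
      ai′ : AlmostIntegral (conj (ℚ.- 1ℚ) 1ℚ ⟨ u , v , 0ℚ , 0ℚ ⟩)
      ai′ = almostIntegral-conj -1-unit 1-unit ai

    trace-norm-n : AlmostIntegral ⟨ u , 0ℚ , v , 0ℚ ⟩ → IsInt (2ℚ ℚ.* u) × IsInt (u ℚ.* u ℚ.- N ℚ.* (v ℚ.* v))
    trace-norm-n ai =
      rational-almostIntegral (subst AlmostIntegral (L-≡ (trace₀ u) refl (trace± v) refl) (almostIntegral-+ ai ai′)) ,
      rational-almostIntegral (subst AlmostIntegral (L-≡ (norm-n₀ M N u v) (norm-n₁ N u v) (norm-n₂ M u v) (norm-n₃ u v)) (almostIntegral-* ai ai′))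
      where
      ai′ : AlmostIntegral (conj 1ℚ (ℚ.- 1ℚ) ⟨ u , 0ℚ , v , 0ℚ ⟩)
      ai′ = almostIntegral-conj 1-unit -1-unit ai

    trace-norm-k : AlmostIntegral ⟨ u , 0ℚ , 0ℚ , v ⟩ → IsInt (2ℚ ℚ.* u) × IsInt (u ℚ.* u ℚ.- M ℚ.* N ℚ.* (v ℚ.* v))
    trace-norm-k ai =
      rational-almostIntegral (subst AlmostIntegral (L-≡ (trace₀ u) refl refl (trace± v)) (almostIntegral-+ ai ai′)) ,
      rational-almostIntegral (subst AlmostIntegral (L-≡ (norm-k₀ M N u v) (norm-k₁ N u v) (norm-k₂ M u v) (norm-k₃ u v)) (almostIntegral-* ai ai′))
      where
      ai′ : AlmostIntegral (conj (ℚ.- 1ℚ) 1ℚ ⟨ u , 0ℚ , 0ℚ , v ⟩)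
      ai′ = almostIntegral-conj -1-unit 1-unit ai

  -- The coordinates of the norm from L to ℚ(√m).
  relative-norm₀ relative-norm₁ : ℚ → ℚ → ℚ → ℚ → ℚ
  relative-norm₀ a b c e = a ℚ.* a ℚ.+ M ℚ.* (b ℚ.* b) ℚ.- N ℚ.* (c ℚ.* c ℚ.+ M ℚ.* (e ℚ.* e))
  relative-norm₁ a b c e = 2ℚ ℚ.* (a ℚ.* b) ℚ.- 2ℚ ℚ.* (N ℚ.* (c ℚ.* e))

  relative-norm : ∀ {a b c e} → AlmostIntegral ⟨ a , b , c , e ⟩ →
    AlmostIntegral ⟨ relative-norm₀ a b c e , relative-norm₁ a b c e , 0ℚ , 0ℚ ⟩
  relative-norm {a} {b} {c} {e} ai = subst AlmostIntegral
    (L-≡ (relative₀ M N a b c e) (relative₁ N a b c e) (relative₂ M a b c e) (relative₃ a b c e))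
    (almostIntegral-* ai (almostIntegral-conj 1-unit -1-unit ai))

  -- The traces to the three quadratic subfields each isolate one irrational coordinate, which
  -- reduces denominators to the quadratic case.
  trace-m : ∀ {a b c e} → AlmostIntegral ⟨ a , b , c , e ⟩ → AlmostIntegral ⟨ 2ℚ ℚ.* a , 2ℚ ℚ.* b , 0ℚ , 0ℚ ⟩
  trace-m {a} {b} {c} {e} ai = subst AlmostIntegral
    (L-≡ (trace₀ a) (trans (cong (b ℚ.+_) (ℚₚ.*-identityˡ b)) (trace₀ b)) (trace± c) (trace± e))
    (almostIntegral-+ ai (almostIntegral-conj 1-unit -1-unit ai))

  trace-n : ∀ {a b c e} → AlmostIntegral ⟨ a , b , c , e ⟩ → AlmostIntegral ⟨ 2ℚ ℚ.* a , 0ℚ , 2ℚ ℚ.* c , 0ℚ ⟩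
  trace-n {a} {b} {c} {e} ai = subst AlmostIntegral
    (L-≡ (trace₀ a) (trace± b) (trans (cong (c ℚ.+_) (ℚₚ.*-identityˡ c)) (trace₀ c)) (trace± e))
    (almostIntegral-+ ai (almostIntegral-conj -1-unit 1-unit ai))

  trace-k : ∀ {a b c e} → AlmostIntegral ⟨ a , b , c , e ⟩ → AlmostIntegral ⟨ 2ℚ ℚ.* a , 0ℚ , 0ℚ , 2ℚ ℚ.* e ⟩
  trace-k {a} {b} {c} {e} ai = subst AlmostIntegral
    (L-≡ (trace₀ a) (trace± b) (trace± c) (trans (cong (e ℚ.+_) (ℚₚ.*-identityˡ e)) (trace₀ e)))
    (almostIntegral-+ ai (almostIntegral-conj -1-unit -1-unit ai))

  rational-* : ∀ p q → rational p * rational q ≡ rational (p ℚ.* q)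
  rational-* p q = L-≡ (product₀ M N p q) (product₁ N p q) (product₁ M p q) (product₃ p q)

  √m² : √m * √m ≡ rational M
  √m² = L-≡ (root₀ M N) (root₁ N) (root₂ M) refl

  -- Over ℚ(√m) the element x has trace 2a + 2b√m and norm P + Q√m, so x² - 2ax + P = (2bx - Q)√m.
  -- Squaring removes √m and leaves a monic quartic with integral coefficients.
  int-norms⇒integral : ∀ {a b c e} → IsInt a → IsInt b → IsInt (relative-norm₀ a b c e) → IsInt (relative-norm₁ a b c e) →
    IsIntegral ⟨ a , b , c , e ⟩
  int-norms⇒integral {a} {b} {c} {e} a-int b-int P-int Q-int =
    proj₁ i₀ ∷ proj₁ i₁ ∷ proj₁ i₂ ∷ proj₁ i₃ ∷ [] , (begin
      fromℤ (proj₁ i₀) · 1L + x * (fromℤ (proj₁ i₁) · 1L + x * (fromℤ (proj₁ i₂) · 1L + x * (fromℤ (proj₁ i₃) · 1L + x * 1L)))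
        ≡⟨ horner (coefficient i₀ e₀) (coefficient i₁ e₁) (coefficient i₂ e₂) (coefficient i₃ refl) ⟩
      (P * P + M′ * (Q * Q)) + x * (((T * P + T * P) + M′ * (V * Q + V * Q)) + x * ((T * T + (P + P) + M′ * (V * V)) + x * ((T + T) + x * 1L)))
        ≡⟨ quartic {T} {P} {V} {Q} {rational M} {M′} {x} {√m} √m² (L-≡ (ℚₚ.+-inverseʳ M) refl refl refl) relation ⟩
      0L ∎)
    where
    open ≡-Reasoning
    p q t v : ℚ
    p = relative-norm₀ a b c e
    q = ℚ.- relative-norm₁ a b c e
    t = ℚ.- (2ℚ ℚ.* a)
    v = 2ℚ ℚ.* b
    x T P V Q M′ : L
    x = ⟨ a , b , c , e ⟩
    T = rational t
    P = rational p
    V = rational v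
    Q = rational q
    M′ = rational (ℚ.- M)
    t-int : IsInt t
    t-int = -ᴵ (2ᴵ *ᴵ a-int)
    v-int : IsInt v
    v-int = 2ᴵ *ᴵ b-int
    q-int : IsInt q
    q-int = -ᴵ Q-int
    i₀ = P-int *ᴵ P-int +ᴵ -ᴵ (int m) *ᴵ (q-int *ᴵ q-int)
    i₁ = t-int *ᴵ P-int +ᴵ t-int *ᴵ P-int +ᴵ -ᴵ (int m) *ᴵ (v-int *ᴵ q-int +ᴵ v-int *ᴵ q-int)
    i₂ = t-int *ᴵ t-int +ᴵ (P-int +ᴵ P-int) +ᴵ -ᴵ (int m) *ᴵ (v-int *ᴵ v-int)
    i₃ = t-int +ᴵ t-int
    coefficient : ∀ {r y} (i : IsInt r) → rational r ≡ y → fromℤ (proj₁ i) · 1L ≡ y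
    coefficient (z , eq) eq′ = trans (q·1L (fromℤ z)) (trans (cong rational (sym eq)) eq′)
    horner : ∀ {z₀ z₁ z₂ z₃ y₀ y₁ y₂ y₃} → z₀ ≡ y₀ → z₁ ≡ y₁ → z₂ ≡ y₂ → z₃ ≡ y₃ →
      z₀ + x * (z₁ + x * (z₂ + x * (z₃ + x * 1L))) ≡ y₀ + x * (y₁ + x * (y₂ + x * (y₃ + x * 1L)))
    horner refl refl refl refl = refl
    e₀ : rational (p ℚ.* p ℚ.+ ℚ.- M ℚ.* (q ℚ.* q)) ≡ P * P + M′ * (Q * Q)
    e₀ = sym (cong₂ _+_ (rational-* p p) (trans (cong (M′ *_) (rational-* q q)) (rational-* (ℚ.- M) (q ℚ.* q))))
    e₁ : rational (t ℚ.* p ℚ.+ t ℚ.* p ℚ.+ ℚ.- M ℚ.* (v ℚ.* q ℚ.+ v ℚ.* q)) ≡ (T * P + T * P) + M′ * (V * Q + V * Q)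
    e₁ = sym (cong₂ _+_ (cong₂ _+_ (rational-* t p) (rational-* t p))
      (trans (cong (M′ *_) (cong₂ _+_ (rational-* v q) (rational-* v q))) (rational-* (ℚ.- M) (v ℚ.* q ℚ.+ v ℚ.* q))))
    e₂ : rational (t ℚ.* t ℚ.+ (p ℚ.+ p) ℚ.+ ℚ.- M ℚ.* (v ℚ.* v)) ≡ T * T + (P + P) + M′ * (V * V)
    e₂ = sym (cong₂ _+_ (cong (_+ (P + P)) (rational-* t t)) (trans (cong (M′ *_) (rational-* v v)) (rational-* (ℚ.- M) (v ℚ.* v))))
    rational-1L-* : ∀ r y → rational r * y ≡ r · y
    rational-1L-* r y = trans (cong (_* y) (sym (q·1L r))) (·-1L-* r y)
    relation : x * x + T * x + P ≡ (V * x + Q) * √m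
    relation = trans (cong (λ y → x * x + y + P) (rational-1L-* t x)) (trans
      (L-≡ (relation₀ M N a b c e) (relation₁ M N a b c e) (relation₂ M N a b c e) (relation₃ M N a b c e))
      (cong (λ y → (y + Q) * √m) (sym (rational-1L-* v x))))

open import Data.Rational using (_+_; _*_; -_; _-_; _≟_)

ℚ-Comaximal : ℚ → ℚ → Set
ℚ-Comaximal p q = ∃₂ λ α β → IsInt α × IsInt β × α * p + β * q ≡ 1ℚ

fromℤ-comaximal : ∀ {a b} → Comaximal a b → ℚ-Comaximal (fromℤ a) (fromℤ b)
fromℤ-comaximal {a} {b} (α , β , eq) = fromℤ α , fromℤ β , int α , int β ,
  trans (sym (cong₂ _+_ (fromℤ-* α a) (fromℤ-* β b))) (trans (sym (fromℤ-+ (α ℤ.* a) (β ℤ.* b))) (cong fromℤ eq))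

fromℤ-+* : ∀ i j k → fromℤ (i ℤ.+ j ℤ.* k) ≡ fromℤ i + fromℤ j * fromℤ k
fromℤ-+* i j k = trans (fromℤ-+ i (j ℤ.* k)) (cong (λ u → fromℤ i + u) (fromℤ-* j k))

fromℤ-odd : ∀ {i} → Odd i → IsOdd (fromℤ i)
fromℤ-odd (j , refl) = fromℤ j , int j , fromℤ-+* (+ 1) (+ 2) j

-- Relative norms in terms of the doubled coordinates.

module ParityIdentities where
  norm₀ : ∀ M N D M′ H a b c e → M ≡ D * M′ → N ≡ D * (2ℚ * H) →
    2ℚ * a * (2ℚ * a) + M * (2ℚ * b * (2ℚ * b)) - 2ℚ * H * (D * (2ℚ * c * (2ℚ * c)) + M′ * (D * (2ℚ * e) * (D * (2ℚ * e)))) ≡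
    4ℚ * (a * a + M * (b * b) - N * (c * c + M * (e * e)))
  norm₀ _ _ D M′ H a b c e refl refl = solve (D ∷ M′ ∷ H ∷ a ∷ b ∷ c ∷ e ∷ []) ℚ-ring

  norm₁ : ∀ N D H a b c e → N ≡ D * (2ℚ * H) →
    2ℚ * a * (2ℚ * b) - 2ℚ * H * (2ℚ * c * (D * (2ℚ * e))) ≡ 2ℚ * (2ℚ * (a * b) - 2ℚ * (N * (c * e)))
  norm₁ _ D H a b c e refl = solve (D ∷ H ∷ a ∷ b ∷ c ∷ e ∷ []) ℚ-ring

  norm-k : ∀ M N D M′ H u v → M ≡ D * M′ → N ≡ D * (2ℚ * H) → u * u - M * N * (v * v) ≡ u * u - M′ * (2ℚ * H) * (D * v * (D * v))
  norm-k _ _ D M′ H u v refl refl = solve (D ∷ M′ ∷ H ∷ u ∷ v ∷ []) ℚ-ring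

  -- With S = 2c and T = 2de one has N(c² + Me²) = (h/2)(dS² + m′T²). Substituting S = T + 2s and d
  -- + m′ = 4r makes the bracket divisible by 4.
  integral₀ : ∀ M N D M′ H R a b c e s → M ≡ D * M′ → N ≡ D * (2ℚ * H) → D + M′ ≡ 4ℚ * R → 2ℚ * c - 2ℚ * D * e ≡ 2ℚ * s →
    a * a + M * (b * b) - N * (c * c + M * (e * e)) ≡
    a * a + M * (b * b) - 2ℚ * H * (R * (2ℚ * D * e * (2ℚ * D * e)) + D * (s * (2ℚ * D * e)) + D * (s * s))
  integral₀ _ _ D M′ H R a b c e s refl refl 4R 2s =
    combine₂ (½ * H * (2ℚ * D * e) * (2ℚ * D * e) * - 1ℚ) (- ½ * (D * H) * (2ℚ * c + 2ℚ * D * e + 2ℚ * s)) 4R 2s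
      (solve (D ∷ M′ ∷ H ∷ R ∷ a ∷ b ∷ c ∷ e ∷ s ∷ []) ℚ-ring)

  integral₁ : ∀ N D H a b c e → N ≡ D * (2ℚ * H) →
    2ℚ * (a * b) - 2ℚ * (N * (c * e)) ≡ 2ℚ * (a * b) - H * (2ℚ * c * (2ℚ * D * e))
  integral₁ _ D H a b c e refl = solve (D ∷ H ∷ a ∷ b ∷ c ∷ e ∷ []) ℚ-ring

-- The ring of integers as a lattice.

module Setting (m n : ℤ) (m-sf : Squarefree m) (n-sf : Squarefree n) (decomposition : Decomposition m n (gcd m n)) where

  open Biquadratic m n {{squarefree⇒nonZero m m-sf}} {{squarefree⇒nonZero n n-sf}} public
    renaming (_+_ to _+ᴸ_; _*_ to _*ᴸ_; -_ to -ᴸ_; _-_ to _-ᴸ_)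
  open BiquadraticRing m n {{squarefree⇒nonZero m m-sf}} {{squarefree⇒nonZero n n-sf}} public
  open Conjugation m n {{squarefree⇒nonZero m m-sf}} {{squarefree⇒nonZero n n-sf}} public
  open Decomposition decomposition public
  open ParityIdentities

  D M′ H R : ℚ
  D = fromℤ d
  M′ = fromℤ m′
  H = fromℤ h
  R = fromℤ r

  M≡DM′ : M ≡ D * M′
  M≡DM′ = trans (cong fromℤ m≡dm′) (fromℤ-* d m′)

  N≡D2H : N ≡ D * (2ℚ * H)
  N≡D2H = trans (cong fromℤ n≡d2h) (trans (fromℤ-* d (+ 2 ℤ.* h)) (cong (D *_) (fromℤ-* (+ 2) h)))

  D+M′≡4R : D + M′ ≡ 4ℚ * R
  D+M′≡4R = trans (sym (fromℤ-+ d m′)) (trans (cong fromℤ d+m′≡4r) (fromℤ-* (+ 4) r))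

  D-odd : IsOdd D
  D-odd = fromℤ-odd d-odd

  M′-odd : IsOdd M′
  M′-odd = fromℤ-odd m′-odd

  H-odd : IsOdd H
  H-odd = fromℤ-odd h-odd

  M-odd : IsOdd M
  M-odd = subst IsOdd (sym M≡DM′) (odd*odd D-odd M′-odd)

  D≢0 : D ≢ 0ℚ
  D≢0 = fromℤ-≢0 (Integers.≢-nonZero⁻¹ d {{d≢0}})

  k≡ : k ≡ m′ ℤ.* (+ 2 ℤ.* h)
  k≡ = trans (cong (λ u → (u ℤ./ (d ℤ.* d)) {{dd≢0}}) mn≡) (a*b/b (m′ ℤ.* (+ 2 ℤ.* h)) (d ℤ.* d) {{dd≢0}})
    where
    dd≢0 : ℤ.NonZero (d ℤ.* d)
    dd≢0 = ℤₚ.i*j≢0 d d {{d≢0}} {{d≢0}}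
    swap : ∀ d m h → d ℤ.* m ℤ.* (d ℤ.* h) ≡ m ℤ.* h ℤ.* (d ℤ.* d)
    swap = ℤ-solver.solve-∀
    mn≡ : m ℤ.* n ≡ m′ ℤ.* (+ 2 ℤ.* h) ℤ.* (d ℤ.* d)
    mn≡ = trans (cong₂ ℤ._*_ m≡dm′ n≡d2h) (swap d m′ (+ 2 ℤ.* h))

  n/d≡ : n/d ≡ + 2 ℤ.* h
  n/d≡ = trans (cong (λ u → (u ℤ./ d) {{d≢0}}) (trans n≡d2h (ℤₚ.*-comm d (+ 2 ℤ.* h)))) (a*b/b (+ 2 ℤ.* h) d {{d≢0}})

  2h-sf : Squarefree (+ 2 ℤ.* h)
  2h-sf = squarefree-∣ d (+ 2 ℤ.* h) n-sf n≡d2h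

  d-sf : Squarefree d
  d-sf = squarefree-∣ m′ d m-sf (trans m≡dm′ (ℤₚ.*-comm d m′))

  -- This product is k, the radicand of the third quadratic subfield.
  m′2h-sf : Squarefree (m′ ℤ.* (+ 2 ℤ.* h))
  m′2h-sf = squarefree-* {m′} {+ 2 ℤ.* h} {{squarefree⇒nonZero m′ m′-sf}} {{squarefree⇒nonZero (+ 2 ℤ.* h) 2h-sf}} m′-sf 2h-sf m′-2h
    where
    m′-sf : Squarefree m′
    m′-sf = squarefree-∣ d m′ m-sf m≡dm′

  K≡ : fromℤ (m′ ℤ.* (+ 2 ℤ.* h)) ≡ M′ * (2ℚ * H)
  K≡ = trans (fromℤ-* m′ (+ 2 ℤ.* h)) (cong (M′ *_) (fromℤ-* (+ 2) h))

  M-residue : IsTwoOrThree M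
  M-residue = inj₂ (fromℤ a , int a , trans (cong fromℤ m≡3+4a) (fromℤ-+* (+ 3) (+ 4) a))

  N-residue : IsTwoOrThree N
  N-residue = inj₁ (fromℤ b , int b , trans (cong fromℤ n≡2+4b) (fromℤ-+* (+ 2) (+ 4) b))

  twice-odd : ∀ {x} → IsOdd x → IsTwoOrThree (2ℚ * x)
  twice-odd (y , y-int , refl) = inj₁ (y , y-int , identity y)
    where
    identity : ∀ y → 2ℚ * (1ℚ + 2ℚ * y) ≡ 2ℚ + 4ℚ * y
    identity = solve-∀ ℚ-ring

  K-residue : IsTwoOrThree (fromℤ (m′ ℤ.* (+ 2 ℤ.* h)))
  K-residue = subst IsTwoOrThree (trans (swap M′ H) (sym K≡)) (twice-odd (odd*odd M′-odd H-odd))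
    where
    swap : ∀ M′ H → 2ℚ * (M′ * H) ≡ M′ * (2ℚ * H)
    swap = solve-∀ ℚ-ring

  MN-residue : IsTwoOrThree (M * N)
  MN-residue = subst IsTwoOrThree (trans (swap M D H) (cong (M *_) (sym N≡D2H))) (twice-odd (odd*odd M-odd (odd*odd D-odd H-odd)))
    where
    swap : ∀ M D H → 2ℚ * (M * (D * H)) ≡ M * (D * (2ℚ * H))
    swap = solve-∀ ℚ-ring

  -- In terms of √k = √m√n/d, the element ⟨a,b,c,e⟩ is a + b√m + (s√n + t√k)/2 with s = 2c, t = 2de.
  IsLattice : L → Set
  IsLattice ⟨ a , b , c , e ⟩ = IsInt a × IsInt b × IsInt (2ℚ * c) × IsInt (2ℚ * D * e) × IsEven (2ℚ * c - 2ℚ * D * e)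

  -- The traces make 2a, 2b, 2c and 2de integers; the norm to ℚ(√m) supplies the parity conditions.
  integral⇒lattice : ∀ {x} → IsIntegral x → IsLattice x
  integral⇒lattice {⟨ a , b , c , e ⟩} integral = go (biquadratic-parity M-odd H-odd D-odd M′-odd 2a-int 2b-int 2c-int 2De-int P-int Q-int
      (norm₀ M N D M′ H a b c e M≡DM′ N≡D2H) (norm₁ N D H a b c e N≡D2H))
    where
    ai = integral⇒almostIntegral integral
    int-m : ∀ u v → AlmostIntegral ⟨ u , v , 0ℚ , 0ℚ ⟩ → IsInt u × IsInt v
    int-m u v ai = let tr , nm = trace-norm-m ai in quadratic-int {m} u v m-sf M-residue tr nm
    int-n : ∀ u v → AlmostIntegral ⟨ u , 0ℚ , v , 0ℚ ⟩ → IsInt u × IsInt v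
    int-n u v ai = let tr , nm = trace-norm-n ai in quadratic-int {n} u v n-sf N-residue tr nm
    -- Since u + v√m√n = u + dv√k, the quadratic criterion is applied with radicand k = 2hm′ and
    -- coefficient dv.
    int-k : ∀ u v → AlmostIntegral ⟨ u , 0ℚ , 0ℚ , v ⟩ → IsInt u × IsInt (D * v)
    int-k u v ai = let tr , nm = trace-norm-k ai in quadratic-int {m′ ℤ.* (+ 2 ℤ.* h)} u (D * v) m′2h-sf K-residue tr
      (subst IsInt (trans (norm-k M N D M′ H u v M≡DM′ N≡D2H) (cong (λ w → u * u - w * (D * v * (D * v))) (sym K≡))) nm)
    2a-int = proj₁ (int-m (2ℚ * a) (2ℚ * b) (trace-m ai))
    2b-int = proj₂ (int-m (2ℚ * a) (2ℚ * b) (trace-m ai))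
    2c-int = proj₂ (int-n (2ℚ * a) (2ℚ * c) (trace-n ai))
    2De-int = proj₂ (int-k (2ℚ * a) (2ℚ * e) (trace-k ai))
    P-int = proj₁ (int-m (relative-norm₀ a b c e) (relative-norm₁ a b c e) (relative-norm ai))
    Q-int = proj₂ (int-m (relative-norm₀ a b c e) (relative-norm₁ a b c e) (relative-norm ai))
    swap : ∀ D e → D * (2ℚ * e) ≡ 2ℚ * D * e
    swap = solve-∀ ℚ-ring
    go : IsEven (2ℚ * a) × IsEven (2ℚ * b) × IsEven (2ℚ * c - D * (2ℚ * e)) → IsLattice ⟨ a , b , c , e ⟩
    go (2a-even , 2b-even , even) = half-even 2a-even , half-even 2b-even , 2c-int , subst IsInt (swap D e) 2De-int ,
      subst IsEven (cong (λ w → 2ℚ * c - w) (swap D e)) even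

  lattice⇒integral : ∀ {x} → IsLattice x → IsIntegral x
  lattice⇒integral {⟨ a , b , c , e ⟩} (a-int , b-int , S-int , T-int , s , s-int , S-T≡2s) = int-norms⇒integral a-int b-int
    (subst IsInt (sym (integral₀ M N D M′ H R a b c e s M≡DM′ N≡D2H D+M′≡4R S-T≡2s))
      (a-int *ᴵ a-int +ᴵ int m *ᴵ (b-int *ᴵ b-int) -ᴵ 2ᴵ *ᴵ int h *ᴵ (int r *ᴵ (T-int *ᴵ T-int) +ᴵ int d *ᴵ (s-int *ᴵ T-int) +ᴵ int d *ᴵ (s-int *ᴵ s-int))))
    (subst IsInt (sym (integral₁ N D H a b c e N≡D2H)) (2ᴵ *ᴵ (a-int *ᴵ b-int) -ᴵ int h *ᴵ (S-int *ᴵ T-int)))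

-- Square roots of m and n in L.

module SquareRoots where
  NonSquare : ℚ → Set
  NonSquare p = ∀ q → q * q ≢ p

  nonSquare≢0 : ∀ {p} → NonSquare p → p ≢ 0ℚ
  nonSquare≢0 ns refl = ns 0ℚ refl

  square≡0 : ∀ {p} → p * p ≡ 0ℚ → p ≡ 0ℚ
  square≡0 {p} eq with p*q≡0⇒ p eq
  ... | inj₁ p≡0 = p≡0
  ... | inj₂ p≡0 = p≡0

  square≡1 : ∀ {p} → p * p ≡ 1ℚ → IsUnit p
  square≡1 {p} eq = go (p*q≡0⇒ (p - 1ℚ) (trans (identity p) (p≡q⇒p-q≡0 eq)))
    where
    identity : ∀ p → (p - 1ℚ) * (p - - 1ℚ) ≡ p * p - 1ℚ
    identity = solve-∀ ℚ-ring
    go : p - 1ℚ ≡ 0ℚ ⊎ p - - 1ℚ ≡ 0ℚ → IsUnit p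
    go (inj₁ p-1≡0) = inj₁ (p-q≡0⇒p≡q {p} {1ℚ} p-1≡0)
    go (inj₂ p+1≡0) = inj₂ (p-q≡0⇒p≡q {p} { - 1ℚ} p+1≡0)

  square-multiple : ∀ {M a b} → NonSquare M → a * a ≡ M * (b * b) → b ≡ 0ℚ
  square-multiple {M} {a} {b} ns eq with b ≟ 0ℚ
  ... | yes b≡0 = b≡0
  ... | no b≢0 = let b⁻¹ , inv = inverse b≢0 in contradiction
      (combine₂ (b⁻¹ * b⁻¹) (M * (b⁻¹ * b + 1ℚ)) eq inv (identity M a b b⁻¹)) (ns (a * b⁻¹))
    where
    identity : ∀ M a b b⁻¹ → a * b⁻¹ * (a * b⁻¹) - M ≡ b⁻¹ * b⁻¹ * (a * a - M * (b * b)) + M * (b⁻¹ * b + 1ℚ) * (b⁻¹ * b - 1ℚ)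
    identity = solve-∀ ℚ-ring

  -- The last two equations say ac + Mbe = 0 and ae + bc = 0; eliminating e gives c(a² - Mb²) = 0.
  -- In each branch any solution other than b = ±1 makes M, N or MN a rational square. M and N enter
  -- symmetrically enough that exchanging them treats √n.
  square-root-M : ∀ {M N} → NonSquare M → NonSquare N → NonSquare (M * N) → ∀ a b c e →
    a * a + M * (b * b) + N * (c * c) + M * N * (e * e) ≡ M →
    a * b + b * a + N * (c * e + e * c) ≡ 0ℚ →
    a * c + c * a + M * (b * e + e * b) ≡ 0ℚ →
    a * e + e * a + b * c + c * b ≡ 0ℚ →
    a ≡ 0ℚ × IsUnit b × c ≡ 0ℚ × e ≡ 0ℚ
  square-root-M {M} {N} nsM nsN nsMN a b c e eq₀ eq₁ eq₂ eq₃ = go (p*q≡0⇒ c c[a²-Mb²]≡0)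
    where
    halve : ∀ {x} → 2ℚ * x ≡ 0ℚ → x ≡ 0ℚ
    halve = p*q≡0⇒q≡0 2≢0
    ac+Mbe : a * c + M * (b * e) ≡ 0ℚ
    ac+Mbe = halve (trans (identity a b c e M) eq₂)
      where
      identity : ∀ a b c e M → 2ℚ * (a * c + M * (b * e)) ≡ a * c + c * a + M * (b * e + e * b)
      identity = solve-∀ ℚ-ring
    ae+bc : a * e + b * c ≡ 0ℚ
    ae+bc = halve (trans (identity a b c e) eq₃)
      where
      identity : ∀ a b c e → 2ℚ * (a * e + b * c) ≡ a * e + e * a + b * c + c * b
      identity = solve-∀ ℚ-ring
    c[a²-Mb²]≡0 : c * (a * a - M * (b * b)) ≡ 0ℚ
    c[a²-Mb²]≡0 = combine₂ a (- (M * b)) ac+Mbe ae+bc (solve (a ∷ b ∷ c ∷ e ∷ M ∷ []) ℚ-ring)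
    -- Otherwise Ne² = 1, and (Ne)² = N.
    MN[ee]≢M : M * N * (e * e) ≢ M
    MN[ee]≢M eq = nsN (N * e) (*-cancelˡ (nonSquare≢0 nsM) (combine N eq (solve (M ∷ N ∷ e ∷ []) ℚ-ring)))
    from-zeros : a ≡ 0ℚ → b ≡ 0ℚ → c ≡ 0ℚ → ⊥
    from-zeros refl refl refl = MN[ee]≢M (combine 1ℚ eq₀ (solve (M ∷ N ∷ e ∷ []) ℚ-ring))
    c≡0-case : c ≡ 0ℚ → a ≡ 0ℚ × IsUnit b × c ≡ 0ℚ × e ≡ 0ℚ
    c≡0-case refl = inner (e ≟ 0ℚ) (a ≟ 0ℚ)
      where
      ea≡0 : e * a ≡ 0ℚ
      ea≡0 = combine 1ℚ ae+bc (solve (a ∷ b ∷ e ∷ []) ℚ-ring)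
      M[eb]≡0 : M * (e * b) ≡ 0ℚ
      M[eb]≡0 = combine 1ℚ ac+Mbe (solve (M ∷ a ∷ b ∷ e ∷ []) ℚ-ring)
      inner : _ → _ → a ≡ 0ℚ × IsUnit b × 0ℚ ≡ 0ℚ × e ≡ 0ℚ
      inner (no e≢0) _ = ⊥-elim (from-zeros (p*q≡0⇒q≡0 e≢0 ea≡0) (p*q≡0⇒q≡0 e≢0 (p*q≡0⇒q≡0 (nonSquare≢0 nsM) M[eb]≡0)) refl)
      inner (yes refl) (yes refl) = refl , square≡1 (*-cancelˡ (nonSquare≢0 nsM) (combine 1ℚ eq₀ (identity M N b))) , refl , refl
        where
        identity : ∀ M N b → M * (b * b) - M * 1ℚ ≡ 1ℚ * (0ℚ * 0ℚ + M * (b * b) + N * (0ℚ * 0ℚ) + M * N * (0ℚ * 0ℚ) - M)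
        identity = solve-∀ ℚ-ring
      inner (yes refl) (no a≢0) = contradiction (combine₂ 1ℚ (- (M * b)) eq₀ b≡0 (identity M N a b)) (nsM a)
        where
        b≡0 : b ≡ 0ℚ
        b≡0 = p*q≡0⇒q≡0 a≢0 (halve (trans (identity a b N) eq₁))
          where
          identity : ∀ a b N → 2ℚ * (a * b) ≡ a * b + b * a + N * (0ℚ * 0ℚ + 0ℚ * 0ℚ)
          identity = solve-∀ ℚ-ring
        identity : ∀ M N a b → a * a - M ≡ 1ℚ * (a * a + M * (b * b) + N * (0ℚ * 0ℚ) + M * N * (0ℚ * 0ℚ) - M) + - (M * b) * (b - 0ℚ)
        identity = solve-∀ ℚ-ring
    a²≡Mb²-case : a ≡ 0ℚ → b ≡ 0ℚ → a ≡ 0ℚ × IsUnit b × c ≡ 0ℚ × e ≡ 0ℚ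
    a²≡Mb²-case refl refl = inner (c ≟ 0ℚ)
      where
      inner : _ → 0ℚ ≡ 0ℚ × IsUnit 0ℚ × c ≡ 0ℚ × e ≡ 0ℚ
      inner (yes c≡0) = ⊥-elim (from-zeros refl refl c≡0)
      inner (no c≢0) = contradiction (combine₂ N (- (M * N * N * e)) eq₀ e≡0 (identity M N c e)) (nsMN (N * c))
        where
        e≡0 : e ≡ 0ℚ
        e≡0 = p*q≡0⇒q≡0 c≢0 (p*q≡0⇒q≡0 (nonSquare≢0 nsN) (halve (trans (identity′ N c e) eq₁)))
          where
          identity′ : ∀ N c e → 2ℚ * (N * (c * e)) ≡ 0ℚ * 0ℚ + 0ℚ * 0ℚ + N * (c * e + e * c)
          identity′ = solve-∀ ℚ-ring
        identity : ∀ M N c e → N * c * (N * c) - M * N ≡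
          N * (0ℚ * 0ℚ + M * (0ℚ * 0ℚ) + N * (c * c) + M * N * (e * e) - M) + - (M * N * N * e) * (e - 0ℚ)
        identity = solve-∀ ℚ-ring
    go : c ≡ 0ℚ ⊎ a * a - M * (b * b) ≡ 0ℚ → a ≡ 0ℚ × IsUnit b × c ≡ 0ℚ × e ≡ 0ℚ
    go (inj₁ c≡0) = c≡0-case c≡0
    go (inj₂ eq) = a²≡Mb²-case a≡0 b≡0
      where
      b≡0 : b ≡ 0ℚ
      b≡0 = square-multiple {M} {a} nsM (p-q≡0⇒p≡q eq)
      a≡0 : a ≡ 0ℚ
      a≡0 = square≡0 (trans (p-q≡0⇒p≡q eq) (trans (cong (λ u → M * (u * b)) b≡0) (trans (cong (M *_) (ℚₚ.*-zeroˡ b)) (ℚₚ.*-zeroʳ M))))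

module ImageIdentities where
  image₀ : ∀ M N s t → 0ℚ * 0ℚ + M * (s * 0ℚ) + N * (0ℚ * t) + M * N * (0ℚ * 0ℚ) ≡ 0ℚ
  image₀ = solve-∀ ℚ-ring

  image₁ : ∀ N s t → 0ℚ * 0ℚ + s * 0ℚ + N * (0ℚ * 0ℚ + 0ℚ * t) ≡ 0ℚ
  image₁ = solve-∀ ℚ-ring

  image₂ : ∀ M s t → 0ℚ * t + 0ℚ * 0ℚ + M * (s * 0ℚ + 0ℚ * 0ℚ) ≡ 0ℚ
  image₂ = solve-∀ ℚ-ring

  image₃ : ∀ s t → 0ℚ * 0ℚ + 0ℚ * 0ℚ + s * t + 0ℚ * 0ℚ ≡ s * t
  image₃ = solve-∀ ℚ-ring

  sum₀ : ∀ a b c e → a * 1ℚ + b * 0ℚ + c * 0ℚ + e * 0ℚ ≡ a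
  sum₀ = solve-∀ ℚ-ring

  sum₁ : ∀ a b c e s → a * 0ℚ + b * s + c * 0ℚ + e * 0ℚ ≡ s * b
  sum₁ = solve-∀ ℚ-ring

  sum₂ : ∀ a b c e t → a * 0ℚ + b * 0ℚ + c * t + e * 0ℚ ≡ t * c
  sum₂ = solve-∀ ℚ-ring

  sum₃ : ∀ a b c e u → a * 0ℚ + b * 0ℚ + c * 0ℚ + e * u ≡ u * e
  sum₃ = solve-∀ ℚ-ring

-- The Galois group of L.

module Galois (m n : ℤ) (m-sf : Squarefree m) (n-sf : Squarefree n) (decomposition : Decomposition m n (gcd m n)) where

  open Setting m n m-sf n-sf decomposition public
  open SquareRoots
  open ImageIdentities

  nsM : NonSquare M
  nsM = nonsquare M-residue (int m)

  nsN : NonSquare N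
  nsN = nonsquare N-residue (int n)

  nsMN : NonSquare (M * N)
  nsMN = nonsquare MN-residue (int m *ᴵ int n)

  square-root-√m : ∀ x → x *ᴸ x ≡ rational M → ∃ λ s → IsUnit s × x ≡ ⟨ 0ℚ , s , 0ℚ , 0ℚ ⟩
  square-root-√m ⟨ a , b , c , e ⟩ eq =
    let a≡0 , unit , c≡0 , e≡0 = square-root-M nsM nsN nsMN a b c e (cong L.c₀ eq) (cong L.c₁ eq) (cong L.c₂ eq) (cong L.c₃ eq)
    in b , unit , L-≡ a≡0 refl c≡0 e≡0

  square-root-√n : ∀ x → x *ᴸ x ≡ rational N → ∃ λ t → IsUnit t × x ≡ ⟨ 0ℚ , 0ℚ , t , 0ℚ ⟩
  square-root-√n ⟨ a , b , c , e ⟩ eq =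
    let a≡0 , unit , b≡0 , e≡0 = square-root-M nsN nsM (subst NonSquare (ℚₚ.*-comm M N) nsMN) a c b e
          (trans (swap₀ M N a b c e) (cong L.c₀ eq)) (cong L.c₂ eq) (cong L.c₁ eq) (trans (swap₃ a b c e) (cong L.c₃ eq))
    in c , unit , L-≡ a≡0 b≡0 refl e≡0
    where
    swap₀ : ∀ M N a b c e → a * a + N * (c * c) + M * (b * b) + N * M * (e * e) ≡
      a * a + M * (b * b) + N * (c * c) + M * N * (e * e)
    swap₀ = solve-∀ ℚ-ring
    swap₃ : ∀ a b c e → a * e + e * a + c * b + b * c ≡ a * e + e * a + b * c + c * b
    swap₃ = solve-∀ ℚ-ring

  √n² : √n *ᴸ √n ≡ rational N
  √n² = L-≡ (root₀′ M N) (ConjugationIdentities.root₂ N) (ConjugationIdentities.root₁ M) refl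
    where
    root₀′ : ∀ M N → 0ℚ * 0ℚ + M * (0ℚ * 0ℚ) + N * (1ℚ * 1ℚ) + M * N * (0ℚ * 0ℚ) ≡ N
    root₀′ = solve-∀ ℚ-ring

  √m*√n : ∀ s t → ⟨ 0ℚ , s , 0ℚ , 0ℚ ⟩ *ᴸ ⟨ 0ℚ , 0ℚ , t , 0ℚ ⟩ ≡ ⟨ 0ℚ , 0ℚ , 0ℚ , s * t ⟩
  √m*√n s t = L-≡ (image₀ M N s t) (image₁ N s t) (image₂ M s t) (image₃ s t)

  combination : ∀ a b c e s t u → a · 1L +ᴸ b · ⟨ 0ℚ , s , 0ℚ , 0ℚ ⟩ +ᴸ c · ⟨ 0ℚ , 0ℚ , t , 0ℚ ⟩ +ᴸ e · ⟨ 0ℚ , 0ℚ , 0ℚ , u ⟩ ≡ ⟨ a , s * b , t * c , u * e ⟩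
  combination a b c e s t u = L-≡ (sum₀ a b c e) (sum₁ a b c e s) (sum₂ a b c e t) (sum₃ a b c e u)

  -- An automorphism can only change the signs of √m and √n, their square roots being unique up to
  -- sign, and these two images determine it.
  automorphism⇒conj : ∀ {ρ} → IsAutomorphism ρ → ∃₂ λ s t → IsUnit s × IsUnit t × ∀ x → ρ x ≡ conj s t x
  automorphism⇒conj {ρ} aut =
    let s , s-unit , ρ√m = square-root-√m (ρ √m) (ρ-square √m M √m²)
        t , t-unit , ρ√n = square-root-√n (ρ √n) (ρ-square √n N √n²)
    in s , t , s-unit , t-unit , image s t ρ√m ρ√n
    where
    open IsAutomorphism aut
    open RingMorphisms.IsRingIsomorphism isRingIsomorphism using (+-homo; *-homo)
    open ≡-Reasoning
    ρ-square : ∀ x q → x *ᴸ x ≡ rational q → ρ x *ᴸ ρ x ≡ rational q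
    ρ-square x q eq = trans (sym (*-homo x x)) (trans (cong ρ (trans eq (sym (q·1L q)))) (trans (fixes-ℚ q) (q·1L q)))
    ρ-· : ∀ q x → ρ (q · x) ≡ q · ρ x
    ρ-· q x = trans (cong ρ (sym (·-1L-* q x))) (trans (*-homo (q · 1L) x) (trans (cong (_*ᴸ ρ x) (fixes-ℚ q)) (·-1L-* q (ρ x))))
    image : ∀ s t → ρ √m ≡ ⟨ 0ℚ , s , 0ℚ , 0ℚ ⟩ → ρ √n ≡ ⟨ 0ℚ , 0ℚ , t , 0ℚ ⟩ → ∀ x → ρ x ≡ conj s t x
    image s t ρ√m ρ√n x@(⟨ a , b , c , e ⟩) = begin
      ρ x ≡⟨ cong ρ basis ⟨
      ρ (a · 1L +ᴸ b · √m +ᴸ c · √n +ᴸ e · (√m *ᴸ √n)) ≡⟨ +-homo (a · 1L +ᴸ b · √m +ᴸ c · √n) (e · (√m *ᴸ √n)) ⟩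
      ρ (a · 1L +ᴸ b · √m +ᴸ c · √n) +ᴸ ρ (e · (√m *ᴸ √n)) ≡⟨ cong (_+ᴸ ρ (e · (√m *ᴸ √n))) (+-homo (a · 1L +ᴸ b · √m) (c · √n)) ⟩
      ρ (a · 1L +ᴸ b · √m) +ᴸ ρ (c · √n) +ᴸ ρ (e · (√m *ᴸ √n)) ≡⟨ cong (λ u → u +ᴸ ρ (c · √n) +ᴸ ρ (e · (√m *ᴸ √n))) (+-homo (a · 1L) (b · √m)) ⟩
      ρ (a · 1L) +ᴸ ρ (b · √m) +ᴸ ρ (c · √n) +ᴸ ρ (e · (√m *ᴸ √n))
        ≡⟨ cong₂ (λ u v → u +ᴸ v) (cong₂ (λ u v → u +ᴸ v) (cong₂ (λ u v → u +ᴸ v) (fixes-ℚ a) (ρ-· b √m)) (ρ-· c √n)) (trans (ρ-· e (√m *ᴸ √n)) (cong (e ·_) (*-homo √m √n))) ⟩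
      a · 1L +ᴸ b · ρ √m +ᴸ c · ρ √n +ᴸ e · (ρ √m *ᴸ ρ √n)
        ≡⟨ cong₂ (λ u v → a · 1L +ᴸ b · u +ᴸ c · v +ᴸ e · (u *ᴸ v)) ρ√m ρ√n ⟩
      a · 1L +ᴸ b · ⟨ 0ℚ , s , 0ℚ , 0ℚ ⟩ +ᴸ c · ⟨ 0ℚ , 0ℚ , t , 0ℚ ⟩ +ᴸ e · (⟨ 0ℚ , s , 0ℚ , 0ℚ ⟩ *ᴸ ⟨ 0ℚ , 0ℚ , t , 0ℚ ⟩)
        ≡⟨ cong (λ u → a · 1L +ᴸ b · ⟨ 0ℚ , s , 0ℚ , 0ℚ ⟩ +ᴸ c · ⟨ 0ℚ , 0ℚ , t , 0ℚ ⟩ +ᴸ e · u) (√m*√n s t) ⟩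
      a · 1L +ᴸ b · ⟨ 0ℚ , s , 0ℚ , 0ℚ ⟩ +ᴸ c · ⟨ 0ℚ , 0ℚ , t , 0ℚ ⟩ +ᴸ e · ⟨ 0ℚ , 0ℚ , 0ℚ , s * t ⟩
        ≡⟨ combination a b c e s t (s * t) ⟩
      conj s t x ∎
      where
      basis : a · 1L +ᴸ b · √m +ᴸ c · √n +ᴸ e · (√m *ᴸ √n) ≡ x
      basis = trans (cong (λ u → a · 1L +ᴸ b · √m +ᴸ c · √n +ᴸ e · u) (√m*√n 1ℚ 1ℚ))
        (trans (combination a b c e 1ℚ 1ℚ 1ℚ) (L-≡ refl (ℚₚ.*-identityˡ b) (ℚₚ.*-identityˡ c) (ℚₚ.*-identityˡ e)))

  conj-+ : ∀ s t x y → conj s t (x +ᴸ y) ≡ conj s t x +ᴸ conj s t y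
  conj-+ s t ⟨ a , b , c , e ⟩ ⟨ a′ , b′ , c′ , e′ ⟩ =
    L-≡ refl (ℚₚ.*-distribˡ-+ s b b′) (ℚₚ.*-distribˡ-+ t c c′) (ℚₚ.*-distribˡ-+ (s * t) e e′)

  conj-neg : ∀ s t x → conj s t (-ᴸ x) ≡ -ᴸ conj s t x
  conj-neg s t ⟨ a , b , c , e ⟩ =
    L-≡ refl (sym (ℚₚ.neg-distribʳ-* s b)) (sym (ℚₚ.neg-distribʳ-* t c)) (sym (ℚₚ.neg-distribʳ-* (s * t) e))

  conj-involutive : ∀ {s t} → IsUnit s → IsUnit t → ∀ x → conj s t (conj s t x) ≡ x
  conj-involutive {s} {t} s-unit t-unit ⟨ a , b , c , e ⟩ = L-≡ refl (cancel s-unit b) (cancel t-unit c)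
    (combine₂ (t * t * e) e (unit-square s-unit) (unit-square t-unit) (identity s t e))
    where
    cancel : ∀ {s} → IsUnit s → ∀ b → s * (s * b) ≡ b
    cancel {s} s-unit b = trans (sym (ℚₚ.*-assoc s s b)) (trans (cong (_* b) (unit-square s-unit)) (ℚₚ.*-identityˡ b))
    identity : ∀ s t e → s * t * (s * t * e) - e ≡ t * t * e * (s * s - 1ℚ) + e * (t * t - 1ℚ)
    identity = solve-∀ ℚ-ring

  conj-automorphism : ∀ {s t} → IsUnit s → IsUnit t → IsAutomorphism (conj s t)
  conj-automorphism {s} {t} s-unit t-unit = record
    { isRingIsomorphism = record
      { isRingMonomorphism = record
        { isRingHomomorphism = record
          { isSemiringHomomorphism = record
            { isNearSemiringHomomorphism = record
              { +-isMonoidHomomorphism = record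
                { isMagmaHomomorphism = record
                  { isRelHomomorphism = record { cong = cong (conj s t) }
                  ; homo = conj-+ s t }
                ; ε-homo = L-≡ refl (ℚₚ.*-zeroʳ s) (ℚₚ.*-zeroʳ t) (ℚₚ.*-zeroʳ (s * t)) }
              ; *-homo = conj-* s-unit t-unit }
            ; 1#-homo = conj-1 s t }
          ; -‿homo = conj-neg s t }
        ; injective = λ {x} {y} eq → trans (sym (involutive x)) (trans (cong (conj s t) eq) (involutive y)) }
      ; surjective = λ y → conj s t y , λ { refl → involutive y } }
    ; fixes-ℚ = λ q → trans (conj-· s t q 1L) (cong (q ·_) (conj-1 s t)) }
    where
    involutive = conj-involutive s-unit t-unit

  1/d : ℚ
  1/d = (+ 1 // d) {{d≢0}}

  √k≡ : √k ≡ ⟨ 0ℚ , 0ℚ , 0ℚ , 1/d ⟩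
  √k≡ = trans (cong (1/d ·_) (√m*√n 1ℚ 1ℚ))
    (L-≡ (ℚₚ.*-zeroʳ 1/d) (ℚₚ.*-zeroʳ 1/d) (ℚₚ.*-zeroʳ 1/d) (ℚₚ.*-identityʳ 1/d))

  D*1/d : D * 1/d ≡ 1ℚ
  D*1/d = //-* (+ 1) d {{d≢0}}

  1/d≢0 : 1/d ≢ 0ℚ
  1/d≢0 eq = contradiction (trans (sym D*1/d) (trans (cong (D *_) eq) (ℚₚ.*-zeroʳ D))) λ ()

  iterate-identity : ∀ {τ : L → L} → (∀ x → τ x ≡ x) → ∀ x j → iterate τ x j ≡ x
  iterate-identity fix x zero = refl
  iterate-identity {τ} fix x (suc j) = trans (cong (λ y → iterate τ y j) (fix x)) (iterate-identity fix x j)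

-- The Hopf-Galois action in coordinates.

module ActionIdentities where
  action-m₀ : ∀ M N s q₀ q₁ q₂ q₃ a b c e →
    q₀ * a + q₁ * a + q₂ * (a + a) + q₃ * (0ℚ * (a - a) + M * (1ℚ * (((- 1ℚ) * b) - ((- 1ℚ) * (1ℚ * b)))) + N * (0ℚ * ((s * c) - (s * ((- 1ℚ) * c)))) + M * N * (0ℚ * (((- 1ℚ) * s * e) - ((- 1ℚ) * s * (1ℚ * (- 1ℚ) * e))))) ≡
    (q₀ + q₁ + 2ℚ * q₂) * a
  action-m₀ = solve-∀ ℚ-ring

  action-m₁ : ∀ N s q₀ q₁ q₂ q₃ a b c e →
    q₀ * b + q₁ * (1ℚ * b) + q₂ * (((- 1ℚ) * b) + ((- 1ℚ) * (1ℚ * b))) + q₃ * (0ℚ * (((- 1ℚ) * b) - ((- 1ℚ) * (1ℚ * b))) + 1ℚ * (a - a) + N * (0ℚ * (((- 1ℚ) * s * e) - ((- 1ℚ) * s * (1ℚ * (- 1ℚ) * e))) + 0ℚ * ((s * c) - (s * ((- 1ℚ) * c))))) ≡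
    (q₀ + q₁ - 2ℚ * q₂) * b
  action-m₁ = solve-∀ ℚ-ring

  action-m₂ : ∀ M D M′ s q₀ q₁ q₂ q₃ a b c e → M ≡ D * M′ →
    2ℚ * (q₀ * c + q₁ * ((- 1ℚ) * c) + q₂ * ((s * c) + (s * ((- 1ℚ) * c))) + q₃ * (0ℚ * ((s * c) - (s * ((- 1ℚ) * c))) + 0ℚ * (a - a) + M * (1ℚ * (((- 1ℚ) * s * e) - ((- 1ℚ) * s * (1ℚ * (- 1ℚ) * e))) + 0ℚ * (((- 1ℚ) * b) - ((- 1ℚ) * (1ℚ * b)))))) ≡
    (q₀ - q₁) * (2ℚ * c) - (2ℚ * (s * q₃)) * (M′ * (2ℚ * D * e))
  action-m₂ _ D M′ s q₀ q₁ q₂ q₃ a b c e refl = solve (D ∷ M′ ∷ s ∷ q₀ ∷ q₁ ∷ q₂ ∷ q₃ ∷ a ∷ b ∷ c ∷ e ∷ []) ℚ-ring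

  action-m₃ : ∀ D s q₀ q₁ q₂ q₃ a b c e →
    2ℚ * D * (q₀ * e + q₁ * (1ℚ * (- 1ℚ) * e) + q₂ * (((- 1ℚ) * s * e) + ((- 1ℚ) * s * (1ℚ * (- 1ℚ) * e))) + q₃ * (0ℚ * (((- 1ℚ) * s * e) - ((- 1ℚ) * s * (1ℚ * (- 1ℚ) * e))) + 0ℚ * (a - a) + 1ℚ * ((s * c) - (s * ((- 1ℚ) * c))) + 0ℚ * (((- 1ℚ) * b) - ((- 1ℚ) * (1ℚ * b))))) ≡
    (q₀ - q₁) * (2ℚ * D * e) + (2ℚ * (s * q₃)) * (D * (2ℚ * c))
  action-m₃ = solve-∀ ℚ-ring

  action-n₀ : ∀ M N s q₀ q₁ q₂ q₃ a b c e →
    q₀ * a + q₁ * a + q₂ * (a + a) + q₃ * (0ℚ * (a - a) + M * (0ℚ * ((s * b) - (s * ((- 1ℚ) * b)))) + N * (1ℚ * (((- 1ℚ) * c) - ((- 1ℚ) * (1ℚ * c)))) + M * N * (0ℚ * ((s * (- 1ℚ) * e) - (s * (- 1ℚ) * ((- 1ℚ) * 1ℚ * e))))) ≡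
    (q₀ + q₁ + 2ℚ * q₂) * a
  action-n₀ = solve-∀ ℚ-ring

  action-n₁ : ∀ M s q₀ q₁ q₂ q₃ a b c e →
    2ℚ * (q₀ * c + q₁ * (1ℚ * c) + q₂ * (((- 1ℚ) * c) + ((- 1ℚ) * (1ℚ * c))) + q₃ * (0ℚ * (((- 1ℚ) * c) - ((- 1ℚ) * (1ℚ * c))) + 1ℚ * (a - a) + M * (0ℚ * ((s * (- 1ℚ) * e) - (s * (- 1ℚ) * ((- 1ℚ) * 1ℚ * e))) + 0ℚ * ((s * b) - (s * ((- 1ℚ) * b)))))) ≡
    (q₀ + q₁ - 2ℚ * q₂) * (2ℚ * c)
  action-n₁ = solve-∀ ℚ-ring

  action-n₂ : ∀ N D H s q₀ q₁ q₂ q₃ a b c e → N ≡ D * (2ℚ * H) →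
    q₀ * b + q₁ * ((- 1ℚ) * b) + q₂ * ((s * b) + (s * ((- 1ℚ) * b))) + q₃ * (0ℚ * ((s * b) - (s * ((- 1ℚ) * b))) + 0ℚ * (a - a) + N * (1ℚ * ((s * (- 1ℚ) * e) - (s * (- 1ℚ) * ((- 1ℚ) * 1ℚ * e))) + 0ℚ * (((- 1ℚ) * c) - ((- 1ℚ) * (1ℚ * c))))) ≡
    (q₀ - q₁) * b - (2ℚ * (s * q₃)) * (H * (2ℚ * D * e))
  action-n₂ _ D H s q₀ q₁ q₂ q₃ a b c e refl = solve (D ∷ H ∷ s ∷ q₀ ∷ q₁ ∷ q₂ ∷ q₃ ∷ a ∷ b ∷ c ∷ e ∷ []) ℚ-ring

  action-n₃ : ∀ D s q₀ q₁ q₂ q₃ a b c e →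
    2ℚ * D * (q₀ * e + q₁ * ((- 1ℚ) * 1ℚ * e) + q₂ * ((s * (- 1ℚ) * e) + (s * (- 1ℚ) * ((- 1ℚ) * 1ℚ * e))) + q₃ * (0ℚ * ((s * (- 1ℚ) * e) - (s * (- 1ℚ) * ((- 1ℚ) * 1ℚ * e))) + 0ℚ * (a - a) + 0ℚ * (((- 1ℚ) * c) - ((- 1ℚ) * (1ℚ * c))) + 1ℚ * ((s * b) - (s * ((- 1ℚ) * b))))) ≡
    (q₀ - q₁) * (2ℚ * D * e) + (2ℚ * (s * q₃)) * ((2ℚ * D) * b)
  action-n₃ = solve-∀ ℚ-ring

  -- In these four identities κ is 1/d, the coefficient of √m√n in √k.
  action-k₀ : ∀ M N κ s q₀ q₁ q₂ q₃ a b c e →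
    q₀ * a + q₁ * a + q₂ * (a + a) + q₃ * (0ℚ * (a - a) + M * (0ℚ * ((s * b) - (s * ((- 1ℚ) * b)))) + N * (0ℚ * (((- s) * c) - ((- s) * ((- 1ℚ) * c)))) + M * N * (κ * ((s * (- s) * e) - (s * (- s) * ((- 1ℚ) * (- 1ℚ) * e))))) ≡
    (q₀ + q₁ + 2ℚ * q₂) * a
  action-k₀ = solve-∀ ℚ-ring

  -- Here σ multiplies √k by s(-s), which is -1 only through s² = 1.
  action-k₁ : ∀ D κ s q₀ q₁ q₂ q₃ a b c e → s * s ≡ 1ℚ →
    2ℚ * D * (q₀ * e + q₁ * ((- 1ℚ) * (- 1ℚ) * e) + q₂ * ((s * (- s) * e) + (s * (- s) * ((- 1ℚ) * (- 1ℚ) * e))) + q₃ * (0ℚ * ((s * (- s) * e) - (s * (- s) * ((- 1ℚ) * (- 1ℚ) * e))) + κ * (a - a) + 0ℚ * (((- s) * c) - ((- s) * ((- 1ℚ) * c))) + 0ℚ * ((s * b) - (s * ((- 1ℚ) * b))))) ≡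
    (q₀ + q₁ - 2ℚ * q₂) * (2ℚ * D * e)
  action-k₁ D κ s q₀ q₁ q₂ q₃ a b c e eq = combine (- (2ℚ * (2ℚ * D * e * q₂))) eq (solve (D ∷ κ ∷ s ∷ q₀ ∷ q₁ ∷ q₂ ∷ q₃ ∷ a ∷ b ∷ c ∷ e ∷ []) ℚ-ring)

  action-k₂ : ∀ N H κ s q₀ q₁ q₂ q₃ a b c e → N * κ ≡ 2ℚ * H →
    q₀ * b + q₁ * ((- 1ℚ) * b) + q₂ * ((s * b) + (s * ((- 1ℚ) * b))) + q₃ * (0ℚ * ((s * b) - (s * ((- 1ℚ) * b))) + 0ℚ * (a - a) + N * (0ℚ * ((s * (- s) * e) - (s * (- s) * ((- 1ℚ) * (- 1ℚ) * e))) + κ * (((- s) * c) - ((- s) * ((- 1ℚ) * c))))) ≡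
    (q₀ - q₁) * b - (2ℚ * (s * q₃)) * (H * (2ℚ * c))
  action-k₂ N H κ s q₀ q₁ q₂ q₃ a b c e eq = combine (- (2ℚ * (s * q₃) * c)) eq (solve (N ∷ H ∷ κ ∷ s ∷ q₀ ∷ q₁ ∷ q₂ ∷ q₃ ∷ a ∷ b ∷ c ∷ e ∷ []) ℚ-ring)

  action-k₃ : ∀ M M′ κ s q₀ q₁ q₂ q₃ a b c e → M * κ ≡ M′ →
    2ℚ * (q₀ * c + q₁ * ((- 1ℚ) * c) + q₂ * (((- s) * c) + ((- s) * ((- 1ℚ) * c))) + q₃ * (0ℚ * (((- s) * c) - ((- s) * ((- 1ℚ) * c))) + 0ℚ * (a - a) + M * (0ℚ * ((s * (- s) * e) - (s * (- s) * ((- 1ℚ) * (- 1ℚ) * e))) + κ * ((s * b) - (s * ((- 1ℚ) * b)))))) ≡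
    (q₀ - q₁) * (2ℚ * c) + (2ℚ * (s * q₃)) * ((2ℚ * M′) * b)
  action-k₃ M M′ κ s q₀ q₁ q₂ q₃ a b c e eq = combine (2ℚ * (2ℚ * (s * q₃) * b)) eq (solve (M ∷ M′ ∷ κ ∷ s ∷ q₀ ∷ q₁ ∷ q₂ ∷ q₃ ∷ a ∷ b ∷ c ∷ e ∷ []) ℚ-ring)

-- Galois pairs and the structures they define.

module HopfGaloisStructures (m n : ℤ) (m-sf : Squarefree m) (n-sf : Squarefree n) (decomposition : Decomposition m n (gcd m n)) where

  open Galois m n m-sf n-sf decomposition public
  open ActionIdentities

  Fixes Moves : L → (L → L) → Set
  Fixes ζ ρ = ∃₂ λ s t → IsUnit s × IsUnit t × (∀ x → ρ x ≡ conj s t x) × conj s t ζ ≡ ζ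
  Moves ζ ρ = ∃₂ λ s t → IsUnit s × IsUnit t × (∀ x → ρ x ≡ conj s t x) × conj s t ζ ≢ ζ

  module _ {ζ : L} {τ σ : L → L} (pair : IsGaloisPair ζ τ σ) where
    open IsGaloisPair pair

    σ-moves : Moves ζ σ
    σ-moves = let s , t , s-unit , t-unit , eq = automorphism⇒conj σ-automorphism in
      s , t , s-unit , t-unit , eq , λ fix → σ∉⟨τ⟩ (τ-generates σ σ-automorphism (trans (eq ζ) fix))

    -- If τ were the identity, all its powers would be, yet a conjugation that fixes ζ and moves y
    -- has to be one of them.
    τ-nontrivial : ∀ {s t} → IsUnit s → IsUnit t → conj s t ζ ≡ ζ → ∀ y → conj s t y ≢ y → ¬ (∀ x → τ x ≡ x)
    τ-nontrivial {s} {t} s-unit t-unit fix y moves τ-id =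
      let j , power = τ-generates (conj s t) (conj-automorphism s-unit t-unit) fix
      in moves (trans (power y) (iterate-identity τ-id y j))

    τ-fixes : Fixes ζ τ
    τ-fixes = let s , t , s-unit , t-unit , eq = automorphism⇒conj τ-automorphism in
      s , t , s-unit , t-unit , eq , trans (sym (eq ζ)) τ-fixes-ζ

  conj-identity : ∀ x → conj 1ℚ 1ℚ x ≡ x
  conj-identity ⟨ a , b , c , e ⟩ = L-≡ refl (ℚₚ.*-identityˡ b) (ℚₚ.*-identityˡ c) (ℚₚ.*-identityˡ e)

  -x≢x : ∀ {x} → x ≢ 0ℚ → - 1ℚ * x ≢ x
  -x≢x {x} x≢0 eq = x≢0 (p*q≡0⇒q≡0 2≢0 (combine (- 1ℚ) eq (identity x)))
    where
    identity : ∀ x → 2ℚ * x - 0ℚ ≡ - 1ℚ * (- 1ℚ * x - x)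
    identity = solve-∀ ℚ-ring

  conj-√k : ∀ s t → conj s t √k ≡ ⟨ 0ℚ , 0ℚ , 0ℚ , s * t * 1/d ⟩
  conj-√k s t = trans (cong (conj s t) √k≡) (L-≡ refl (ℚₚ.*-zeroʳ s) (ℚₚ.*-zeroʳ t) refl)

  conj-fixes-√k : ∀ {s t} → s * t ≡ 1ℚ → conj s t √k ≡ √k
  conj-fixes-√k {s} {t} eq = trans (conj-√k s t) (trans (L-≡ refl refl refl (trans (cong (_* 1/d) eq) (ℚₚ.*-identityˡ 1/d))) (sym √k≡))

  conj-moves-√k : ∀ {s t} → s * t ≡ - 1ℚ → conj s t √k ≢ √k
  conj-moves-√k {s} {t} eq fix = -x≢x 1/d≢0 (trans (cong (_* 1/d) (sym eq)) (cong L.c₃ (trans (sym (conj-√k s t)) (trans fix √k≡))))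

  conj-fixes-√m : ∀ t → conj 1ℚ t √m ≡ √m
  conj-fixes-√m t = L-≡ refl refl (ℚₚ.*-zeroʳ t) (ℚₚ.*-zeroʳ (1ℚ * t))

  conj-fixes-√n : ∀ s → conj s 1ℚ √n ≡ √n
  conj-fixes-√n s = L-≡ refl (ℚₚ.*-zeroʳ s) refl (ℚₚ.*-zeroʳ (s * 1ℚ))

  conj-moves-√m : ∀ t → conj (- 1ℚ) t √m ≢ √m
  conj-moves-√m t eq = contradiction (cong L.c₁ eq) λ ()

  conj-moves-√n : ∀ s → conj s (- 1ℚ) √n ≢ √n
  conj-moves-√n s eq = contradiction (cong L.c₂ eq) λ ()

  -- For ζ = √m, √n and √k, with s the sign that the definition of a Galois pair leaves free.
  τ-of σ-of : Index → ℚ → L → L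
  τ-of one   s = conj 1ℚ (- 1ℚ)
  τ-of two   s = conj (- 1ℚ) 1ℚ
  τ-of three s = conj (- 1ℚ) (- 1ℚ)
  σ-of one   s = conj (- 1ℚ) s
  σ-of two   s = conj s (- 1ℚ)
  σ-of three s = conj s (- s)

  Explicit : Index → (τ σ : L → L) → Set
  Explicit i τ σ = ∃ λ s → IsUnit s × (∀ x → τ x ≡ τ-of i s x) × (∀ x → σ x ≡ σ-of i s x)

  -- σ moves ζ, as it would otherwise be a power of τ, and τ fixes ζ without being the identity.
  -- Among the sign pairs this leaves a single τ, and one free sign in σ.
  galoisPair-explicit : ∀ i {τ σ} → IsGaloisPair (ζ i) τ σ → Explicit i τ σ
  galoisPair-explicit one {τ} {σ} pair = go (σ-moves pair) (τ-fixes pair)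
    where
    go : Moves √m σ → Fixes √m τ → Explicit one τ σ
    go (_ , t , inj₁ refl , _ , _ , moves) _ = contradiction (conj-fixes-√m t) moves
    go _ (_ , t , inj₂ refl , _ , _ , fixes) = contradiction fixes (conj-moves-√m t)
    go _ (_ , _ , inj₁ refl , inj₁ refl , τ-eq , _) =
      contradiction (λ x → trans (τ-eq x) (conj-identity x)) (τ-nontrivial pair 1-unit -1-unit (conj-fixes-√m (- 1ℚ)) √n (conj-moves-√n 1ℚ))
    go (_ , s , inj₂ refl , s-unit , σ-eq , _) (_ , _ , inj₁ refl , inj₂ refl , τ-eq , _) = s , s-unit , τ-eq , σ-eq
  galoisPair-explicit two {τ} {σ} pair = go (σ-moves pair) (τ-fixes pair)
    where
    go : Moves √n σ → Fixes √n τ → Explicit two τ σ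
    go (s , _ , _ , inj₁ refl , _ , moves) _ = contradiction (conj-fixes-√n s) moves
    go _ (s , _ , _ , inj₂ refl , _ , fixes) = contradiction fixes (conj-moves-√n s)
    go _ (_ , _ , inj₁ refl , inj₁ refl , τ-eq , _) =
      contradiction (λ x → trans (τ-eq x) (conj-identity x)) (τ-nontrivial pair -1-unit 1-unit (conj-fixes-√n (- 1ℚ)) √m (conj-moves-√m 1ℚ))
    go (s , _ , s-unit , inj₂ refl , σ-eq , _) (_ , _ , inj₂ refl , inj₁ refl , τ-eq , _) = s , s-unit , τ-eq , σ-eq
  galoisPair-explicit three {τ} {σ} pair = go (σ-moves pair) (τ-fixes pair)
    where
    go : Moves √k σ → Fixes √k τ → Explicit three τ σ
    go (_ , _ , inj₁ refl , inj₁ refl , _ , moves) _ = contradiction (conj-fixes-√k {1ℚ} {1ℚ} refl) moves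
    go (_ , _ , inj₂ refl , inj₂ refl , _ , moves) _ = contradiction (conj-fixes-√k { - 1ℚ} { - 1ℚ} refl) moves
    go _ (_ , _ , inj₁ refl , inj₂ refl , _ , fixes) = contradiction fixes (conj-moves-√k {1ℚ} { - 1ℚ} refl)
    go _ (_ , _ , inj₂ refl , inj₁ refl , _ , fixes) = contradiction fixes (conj-moves-√k { - 1ℚ} {1ℚ} refl)
    go _ (_ , _ , inj₁ refl , inj₁ refl , τ-eq , _) =
      contradiction (λ x → trans (τ-eq x) (conj-identity x))
        (τ-nontrivial pair -1-unit -1-unit (conj-fixes-√k { - 1ℚ} { - 1ℚ} refl) √m (conj-moves-√m (- 1ℚ)))
    go (_ , _ , inj₁ refl , inj₂ refl , σ-eq , _) (_ , _ , inj₂ refl , inj₂ refl , τ-eq , _) = 1ℚ , 1-unit , τ-eq , σ-eq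
    go (_ , _ , inj₂ refl , inj₁ refl , σ-eq , _) (_ , _ , inj₂ refl , inj₂ refl , τ-eq , _) = - 1ℚ , -1-unit , τ-eq , σ-eq

  -- Coordinates in the basis 1, √m, √n/2, √k/2, ordered so that the first two belong to ℚ(ζ) and
  -- the last two to the complement on which τ is -1.
  toCoordinates : Index → L → ℚ⁴
  toCoordinates one   ⟨ a , b , c , e ⟩ = a , b , 2ℚ * c , 2ℚ * D * e
  toCoordinates two   ⟨ a , b , c , e ⟩ = a , 2ℚ * c , b , 2ℚ * D * e
  toCoordinates three ⟨ a , b , c , e ⟩ = a , 2ℚ * D * e , b , 2ℚ * c

  fromCoordinates : Index → ℚ⁴ → L
  fromCoordinates one   (u , v , w , z) = ⟨ u , v , ½ * w , ½ * 1/d * z ⟩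
  fromCoordinates two   (u , v , w , z) = ⟨ u , w , ½ * v , ½ * 1/d * z ⟩
  fromCoordinates three (u , v , w , z) = ⟨ u , w , ½ * z , ½ * 1/d * v ⟩

  2[½x] : ∀ x → 2ℚ * (½ * x) ≡ x
  2[½x] = solve-∀ ℚ-ring

  ½[2x] : ∀ x → ½ * (2ℚ * x) ≡ x
  ½[2x] = solve-∀ ℚ-ring

  2D[½1/dx] : ∀ x → 2ℚ * D * (½ * 1/d * x) ≡ x
  2D[½1/dx] x = combine x D*1/d (identity D 1/d x)
    where
    identity : ∀ D κ x → 2ℚ * D * (½ * κ * x) - x ≡ x * (D * κ - 1ℚ)
    identity = solve-∀ ℚ-ring

  ½1/d[2Dx] : ∀ x → ½ * 1/d * (2ℚ * D * x) ≡ x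
  ½1/d[2Dx] x = combine x D*1/d (identity D 1/d x)
    where
    identity : ∀ D κ x → ½ * κ * (2ℚ * D * x) - x ≡ x * (D * κ - 1ℚ)
    identity = solve-∀ ℚ-ring

  to-from : ∀ i v → toCoordinates i (fromCoordinates i v) ≡ v
  to-from one   (u , v , w , z) = quadruple refl refl (2[½x] w) (2D[½1/dx] z)
  to-from two   (u , v , w , z) = quadruple refl (2[½x] v) refl (2D[½1/dx] z)
  to-from three (u , v , w , z) = quadruple refl (2D[½1/dx] v) refl (2[½x] z)

  from-to : ∀ i x → fromCoordinates i (toCoordinates i x) ≡ x
  from-to one   ⟨ a , b , c , e ⟩ = L-≡ refl refl (½[2x] c) (½1/d[2Dx] e)
  from-to two   ⟨ a , b , c , e ⟩ = L-≡ refl refl (½[2x] c) (½1/d[2Dx] e)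
  from-to three ⟨ a , b , c , e ⟩ = L-≡ refl refl (½[2x] c) (½1/d[2Dx] e)

  element : (ζ : L) (q₀ q₁ q₂ q₃ : ℚ) (x τx σx στx : L) → L
  element ζ q₀ q₁ q₂ q₃ x τx σx στx = q₀ · x +ᴸ q₁ · τx +ᴸ q₂ · (σx +ᴸ στx) +ᴸ q₃ · (ζ *ᴸ (σx -ᴸ στx))

  -- The maps id, τ, σ + στ act on 1 as 1, 1, 2, on ζ as 1, 1, -2, and on the complement as 1, -1,
  -- 0; the last entry is the contribution of ζ(σ - στ).
  scalars : (s q₀ q₁ q₂ q₃ : ℚ) → ℚ⁴
  scalars s q₀ q₁ q₂ q₃ = q₀ + q₁ + 2ℚ * q₂ , q₀ + q₁ - 2ℚ * q₂ , q₀ - q₁ , 2ℚ * (s * q₃)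

  pᵢ qᵢ : Index → ℚ
  pᵢ one   = M′
  pᵢ two   = H
  pᵢ three = H
  qᵢ one   = D
  qᵢ two   = 2ℚ * D
  qᵢ three = 2ℚ * M′

  Nκ≡2H : N * 1/d ≡ 2ℚ * H
  Nκ≡2H = trans (cong (_* 1/d) N≡D2H) (combine (2ℚ * H) D*1/d (identity D 1/d H))
    where
    identity : ∀ D κ H → D * (2ℚ * H) * κ - 2ℚ * H ≡ 2ℚ * H * (D * κ - 1ℚ)
    identity = solve-∀ ℚ-ring

  Mκ≡M′ : M * 1/d ≡ M′
  Mκ≡M′ = trans (cong (_* 1/d) M≡DM′) (combine M′ D*1/d (identity D 1/d M′))
    where
    identity : ∀ D κ M′ → D * M′ * κ - M′ ≡ M′ * (D * κ - 1ℚ)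
    identity = solve-∀ ℚ-ring

  element-action : ∀ i {s} → IsUnit s → ∀ q₀ q₁ q₂ q₃ x →
    toCoordinates i (element (ζ i) q₀ q₁ q₂ q₃ x (τ-of i s x) (σ-of i s x) (σ-of i s (τ-of i s x))) ≡
    Action.act (pᵢ i) (qᵢ i) (scalars s q₀ q₁ q₂ q₃) (toCoordinates i x)
  element-action one {s} _ q₀ q₁ q₂ q₃ ⟨ a , b , c , e ⟩ = quadruple
    (action-m₀ M N s q₀ q₁ q₂ q₃ a b c e) (action-m₁ N s q₀ q₁ q₂ q₃ a b c e)
    (action-m₂ M D M′ s q₀ q₁ q₂ q₃ a b c e M≡DM′) (action-m₃ D s q₀ q₁ q₂ q₃ a b c e)
  element-action two {s} _ q₀ q₁ q₂ q₃ ⟨ a , b , c , e ⟩ = quadruple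
    (action-n₀ M N s q₀ q₁ q₂ q₃ a b c e) (action-n₁ M s q₀ q₁ q₂ q₃ a b c e)
    (action-n₂ N D H s q₀ q₁ q₂ q₃ a b c e N≡D2H) (action-n₃ D s q₀ q₁ q₂ q₃ a b c e)
  element-action three {s} s-unit q₀ q₁ q₂ q₃ x@(⟨ a , b , c , e ⟩) = trans
    (cong (λ ζ → toCoordinates three (element ζ q₀ q₁ q₂ q₃ x (τ-of three s x) (σ-of three s x) (σ-of three s (τ-of three s x)))) √k≡)
    (quadruple
      (action-k₀ M N 1/d s q₀ q₁ q₂ q₃ a b c e) (action-k₁ D 1/d s q₀ q₁ q₂ q₃ a b c e (unit-square s-unit))
      (action-k₂ N H 1/d s q₀ q₁ q₂ q₃ a b c e Nκ≡2H) (action-k₃ M M′ 1/d s q₀ q₁ q₂ q₃ a b c e Mκ≡M′))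

  -- All rational quadruples occur, so every stabilising quadruple comes from an element of the
  -- associated order. The sign s is its own inverse.
  scalars-onto : ∀ {s} → IsUnit s → ∀ A B C E →
    scalars s (½ * (½ * (A + B) + C)) (½ * (½ * (A + B) - C)) (½ * ½ * (A - B)) (½ * (s * E)) ≡ (A , B , C , E)
  scalars-onto {s} s-unit A B C E = quadruple (identity₀ A B C) (identity₁ A B C) (identity₂ A B C) (combine E (unit-square s-unit) (identity₃ s E))
    where
    identity₀ : ∀ A B C → ½ * (½ * (A + B) + C) + ½ * (½ * (A + B) - C) + 2ℚ * (½ * ½ * (A - B)) ≡ A
    identity₀ = solve-∀ ℚ-ring
    identity₁ : ∀ A B C → ½ * (½ * (A + B) + C) + ½ * (½ * (A + B) - C) - 2ℚ * (½ * ½ * (A - B)) ≡ B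
    identity₁ = solve-∀ ℚ-ring
    identity₂ : ∀ A B C → ½ * (½ * (A + B) + C) - ½ * (½ * (A + B) - C) ≡ C
    identity₂ = solve-∀ ℚ-ring
    identity₃ : ∀ s E → 2ℚ * (s * (½ * (s * E))) - E ≡ E * (s * s - 1ℚ)
    identity₃ = solve-∀ ℚ-ring

-- Free generators and the quadratic equations.

module Generators (m n : ℤ) (m-sf : Squarefree m) (n-sf : Squarefree n) (decomposition : Decomposition m n (gcd m n)) where

  open HopfGaloisStructures m n m-sf n-sf decomposition public

  -- `O` is 𝒪 in coordinates, given by the two implications. Bijectivity of evaluation at β becomes
  -- a statement about the quadruples that stabilise `O`.
  module Transfer (i : Index) {τ σ : L → L} {s : ℚ} (s-unit : IsUnit s)
    (τ-eq : ∀ x → τ x ≡ τ-of i s x) (σ-eq : ∀ x → σ x ≡ σ-of i s x)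
    (O : ℚ⁴ → Set) (integral⇒O : ∀ {x} → IsIntegral x → O (toCoordinates i x))
    (O⇒integral : ∀ {v} → O v → IsIntegral (fromCoordinates i v)) where

    open Action (pᵢ i) (qᵢ i)

    private
      to : L → ℚ⁴
      to = toCoordinates i
      from : ℚ⁴ → L
      from = fromCoordinates i
      Structure : (L → L) → Set
      Structure = HopfGalois (ζ i) τ σ

    explicit : ∀ q₀ q₁ q₂ q₃ x → element (ζ i) q₀ q₁ q₂ q₃ x (τ x) (σ x) (σ (τ x)) ≡
      element (ζ i) q₀ q₁ q₂ q₃ x (τ-of i s x) (σ-of i s x) (σ-of i s (τ-of i s x))
    explicit q₀ q₁ q₂ q₃ x = trans
      (cong₂ (λ y z → element (ζ i) q₀ q₁ q₂ q₃ x y z (σ (τ x))) (τ-eq x) (σ-eq x))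
      (cong (element (ζ i) q₀ q₁ q₂ q₃ x (τ-of i s x) (σ-of i s x)) (trans (σ-eq (τ x)) (cong (σ-of i s) (τ-eq x))))

    structure⇒act : ∀ {f} → Structure f → ∃ λ S → ∀ x → to (f x) ≡ act S (to x)
    structure⇒act (q₀ , q₁ , q₂ , q₃ , eq) = scalars s q₀ q₁ q₂ q₃ , λ x →
      trans (cong to (trans (eq x) (explicit q₀ q₁ q₂ q₃ x))) (element-action i s-unit q₀ q₁ q₂ q₃ x)

    act⇒structure : ∀ S → Structure (λ x → from (act S (to x)))
    act⇒structure S@(A , B , C , E) = q₀ , q₁ , q₂ , q₃ , λ x → sym (trans (explicit q₀ q₁ q₂ q₃ x)
      (trans (sym (from-to i _)) (cong from (trans (element-action i s-unit q₀ q₁ q₂ q₃ x)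
        (cong (λ S → act S (to x)) (scalars-onto s-unit A B C E))))))
      where
      q₀ q₁ q₂ q₃ : ℚ
      q₀ = ½ * (½ * (A + B) + C)
      q₁ = ½ * (½ * (A + B) - C)
      q₂ = ½ * ½ * (A - B)
      q₃ = ½ * (s * E)

    Onto : ℚ⁴ → Set
    Onto v = ∀ y → O y → ∃ λ S → Stabilises O S × act S v ≡ y

    -- Each element of the associated order acts by some quadruple, and preservation of 𝒪 makes that
    -- quadruple a stabiliser.
    generator⇒onto : ∀ {β} → IsFreeGenerator Structure β → O (to β) × Onto (to β)
    generator⇒onto {β} (β-integral , _ , surjective) = integral⇒O β-integral , λ y y∈O →
      let h , hits = surjective (from y , O⇒integral y∈O)
          S , S-eq = structure⇒act (AssociatedOrder.act∈H h)
      in S ,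
        (λ v v∈O → subst O (trans (S-eq (from v)) (cong (act S) (to-from i v))) (integral⇒O (AssociatedOrder.preserves𝒪 h (O⇒integral v∈O)))) ,
        trans (sym (S-eq β)) (trans (cong to (hits {h} (λ _ → refl))) (to-from i y))

    -- With u = v = 1 and nonzero norm, a quadruple is determined by its value at β; this gives
    -- injectivity.
    onto⇒generator : ∀ {β w z} → to β ≡ (1ℚ , 1ℚ , w , z) → norm w z ≢ 0ℚ → O (1ℚ , 1ℚ , w , z) → Onto (1ℚ , 1ℚ , w , z) →
      IsFreeGenerator Structure β
    onto⇒generator {β} {w} {z} β≡ norm≢0 β∈O onto = β-integral , (λ {h} {h′} → injective {h} {h′}) , λ y → let h , hits = surjective y in h , λ {h′} → hits {h′}
      where
      integral-from : ∀ {x} → IsIntegral (from (to x)) → IsIntegral x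
      integral-from {x} = subst IsIntegral (from-to i x)
      β-integral : IsIntegral β
      β-integral = integral-from (O⇒integral (subst O (sym β≡) β∈O))
      injective : ∀ {h h′ : AssociatedOrder Structure} → AssociatedOrder.act h β ≡ AssociatedOrder.act h′ β →
        ∀ x → AssociatedOrder.act h x ≡ AssociatedOrder.act h′ x
      injective {h} {h′} eq x =
        let S , S-eq = structure⇒act (AssociatedOrder.act∈H h)
            S′ , S′-eq = structure⇒act (AssociatedOrder.act∈H h′)
            S≡S′ = act-injective {w} {z} S S′ norm≢0 (trans (cong (act S) (sym β≡)) (trans (sym (S-eq β))
              (trans (cong to eq) (trans (S′-eq β) (cong (act S′) β≡)))))
        in trans (sym (from-to i _)) (trans (cong from (trans (S-eq x) (trans (cong (λ S → act S (to x)) S≡S′) (sym (S′-eq x))))) (from-to i _))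
      surjective : ∀ (y : 𝒪) → ∃ λ (h : AssociatedOrder Structure) → ∀ {h′ : AssociatedOrder Structure} →
        (∀ x → AssociatedOrder.act h′ x ≡ AssociatedOrder.act h x) → AssociatedOrder.act h′ β ≡ proj₁ y
      surjective (y , y-integral) =
        let S , S-stab , S-hits = onto (to y) (integral⇒O y-integral)
        in record
          { act = λ x → from (act S (to x))
          ; act∈H = act⇒structure S
          ; preserves𝒪 = λ {x} x-integral → O⇒integral (S-stab (to x) (integral⇒O x-integral)) } ,
        λ eq → trans (eq β) (trans (cong (from ∘ act S) β≡) (trans (cong from S-hits) (from-to i y)))

  module One = DirectModel M′ D R M′-odd D-odd (int r) (trans (ℚₚ.+-comm M′ D) D+M′≡4R) (fromℤ-comaximal m′-d)
  module Two = CrossModel H D H-odd (int d) (fromℤ-comaximal h-d)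
  module Three = CrossModel H M′ H-odd (int m′) (fromℤ-comaximal h-m′)

  integral⇒One : ∀ {x} → IsIntegral x → One.O (toCoordinates one x)
  integral⇒One = integral⇒lattice

  integral⇒Two : ∀ {x} → IsIntegral x → Two.O (toCoordinates two x)
  integral⇒Two x-integral = let a , b , c , e , even = integral⇒lattice x-integral in a , c , b , e , even

  even-swap : ∀ x y → IsEven (x - y) → IsEven (y - x)
  even-swap x y (f , f-int , eq) = - f , -ᴵ f-int , combine (- 1ℚ) eq (identity x y f)
    where
    identity : ∀ x y f → y - x - 2ℚ * (- f) ≡ - 1ℚ * (x - y - 2ℚ * f)
    identity = solve-∀ ℚ-ring

  integral⇒Three : ∀ {x} → IsIntegral x → Three.O (toCoordinates three x)
  integral⇒Three {x} x-integral = let a , b , c , e , even = integral⇒lattice x-integral in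
    a , e , b , c , even-swap (2ℚ * L.c₂ x) (2ℚ * D * L.c₃ x) even

  One⇒integral : ∀ {v} → One.O v → IsIntegral (fromCoordinates one v)
  One⇒integral {v} v∈O = lattice⇒integral (subst One.O (sym (to-from one v)) v∈O)

  Two⇒integral : ∀ {v} → Two.O v → IsIntegral (fromCoordinates two v)
  Two⇒integral {v} v∈O = let a , c , b , e , even = subst Two.O (sym (to-from two v)) v∈O in lattice⇒integral (a , b , c , e , even)

  Three⇒integral : ∀ {v} → Three.O v → IsIntegral (fromCoordinates three v)
  Three⇒integral {v} v∈O = let x = fromCoordinates three v ; a , e , b , c , even = subst Three.O (sym (to-from three v)) v∈O in
    lattice⇒integral (a , b , c , e , even-swap (2ℚ * D * L.c₃ x) (2ℚ * L.c₂ x) even)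

  -- The two signs become one factor e = ±1, so both equations are treated at once.
  ≡±⇒unit : ∀ {a b} → a ≡± b → ∃ λ e → IsUnit e × fromℤ a ≡ fromℤ b * e
  ≡±⇒unit {a} {b} (inj₁ refl) = 1ℚ , 1-unit , sym (ℚₚ.*-identityʳ (fromℤ b))
  ≡±⇒unit {a} {b} (inj₂ refl) = - 1ℚ , -1-unit , trans (fromℤ-neg b) (identity (fromℤ b))
    where
    identity : ∀ x → - x ≡ x * (- 1ℚ)
    identity = solve-∀ ℚ-ring

  unit⇒≡± : ∀ {a b e} → IsUnit e → fromℤ a ≡ fromℤ b * e → a ≡± b
  unit⇒≡± {a} {b} (inj₁ refl) eq = inj₁ (fromℤ-injective (trans eq (ℚₚ.*-identityʳ (fromℤ b))))
  unit⇒≡± {a} {b} (inj₂ refl) eq = inj₂ (fromℤ-injective (trans eq (trans (identity (fromℤ b)) (sym (fromℤ-neg b)))))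
    where
    identity : ∀ x → x * (- 1ℚ) ≡ - x
    identity = solve-∀ ℚ-ring

  fromℤ-form : ∀ x c y → fromℤ (x ℤ.* x ℤ.+ c ℤ.* (y ℤ.* y)) ≡ fromℤ x * fromℤ x + fromℤ c * (fromℤ y * fromℤ y)
  fromℤ-form x c y = trans (fromℤ-+ (x ℤ.* x) (c ℤ.* (y ℤ.* y)))
    (cong₂ _+_ (fromℤ-* x x) (trans (fromℤ-* c (y ℤ.* y)) (cong (fromℤ c *_) (fromℤ-* y y))))

  squarefree-divides : ∀ {c x t} → Squarefree c → IsInt t → fromℤ x * fromℤ x ≡ t * fromℤ c → ∃ λ X → IsInt X × fromℤ x ≡ fromℤ c * X
  squarefree-divides {c} {x} sf (t , refl) eq = go (squarefree-∣-square sf (divides t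
      (fromℤ-injective (trans (fromℤ-* x x) (trans eq (sym (fromℤ-* t c)))))))
    where
    go : c ∣ₛ x → ∃ λ X → IsInt X × fromℤ x ≡ fromℤ c * X
    go (divides X eq) = fromℤ X , int X , trans (cong fromℤ eq) (trans (fromℤ-* X c) (ℚₚ.*-comm (fromℤ X) (fromℤ c)))

  γ₄≡ : γ₄ ≡ ⟨ 0ℚ , 0ℚ , ½ , ½ * 1/d ⟩
  γ₄≡ = trans (cong (λ u → ½ · (√n +ᴸ u)) √k≡) (L-≡ refl refl refl (cong (½ *_) (ℚₚ.+-identityˡ 1/d)))

  γ-combination : ∀ p q y → γ₁ +ᴸ p · γ₂ +ᴸ q · γ₃ +ᴸ y · γ₄ ≡ ⟨ 1ℚ , p , q + y * ½ , y * (½ * 1/d) ⟩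
  γ-combination p q y = trans (cong (λ u → γ₁ +ᴸ p · γ₂ +ᴸ q · γ₃ +ᴸ y · u) γ₄≡)
    (L-≡ (identity₀ p q y) (identity₁ p q y) (identity₂ p q y) (identity₃ p q y 1/d))
    where
    identity₀ : ∀ p q y → 1ℚ + p * 0ℚ + q * 0ℚ + y * 0ℚ ≡ 1ℚ
    identity₀ = solve-∀ ℚ-ring
    identity₁ : ∀ p q y → 0ℚ + p * 1ℚ + q * 0ℚ + y * 0ℚ ≡ p
    identity₁ = solve-∀ ℚ-ring
    identity₂ : ∀ p q y → 0ℚ + p * 0ℚ + q * 1ℚ + y * ½ ≡ q + y * ½
    identity₂ = solve-∀ ℚ-ring
    identity₃ : ∀ p q y κ → 0ℚ + p * 0ℚ + q * 0ℚ + y * (½ * κ) ≡ y * (½ * κ)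
    identity₃ = solve-∀ ℚ-ring

  2D[y[½1/d]] : ∀ y → 2ℚ * D * (y * (½ * 1/d)) ≡ y
  2D[y[½1/d]] y = combine y D*1/d (identity D 1/d y)
    where
    identity : ∀ D κ y → 2ℚ * D * (y * (½ * κ)) - y ≡ y * (D * κ - 1ℚ)
    identity = solve-∀ ℚ-ring

  fromℤ-x-dy : ∀ x d y → fromℤ (x ℤ.- d ℤ.* y) ≡ fromℤ x - fromℤ d * fromℤ y
  fromℤ-x-dy x d y = trans (fromℤ-+ x (ℤ.- (d ℤ.* y))) (cong (λ u → fromℤ x + u) (trans (fromℤ-neg (d ℤ.* y)) (cong (λ u → - u) (fromℤ-* d y))))

  //-unique : ∀ {a b q} (b≢0 : ℤ.NonZero b) → fromℤ a ≡ fromℤ b * q → (a // b) {{b≢0}} ≡ q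
  //-unique {a} {b} b≢0 eq = *-cancelˡ (fromℤ-≢0 (Integers.≢-nonZero⁻¹ b {{b≢0}})) (trans (//-* a b {{b≢0}}) eq)

  unit-odd : ∀ {e} → IsUnit e → IsOdd e
  unit-odd (inj₁ refl) = 0ℚ , 0ᴵ , refl
  unit-odd (inj₂ refl) = - 1ℚ , -ᴵ 1ᴵ , refl

  1-odd : IsOdd 1ℚ
  1-odd = unit-odd 1-unit

  -- Case ζ = √m: a solution satisfies x = dX, and dX² + m′y² = ±4.

  Solution₁ : ℤ → ℤ → Set
  Solution₁ x y = ∃₂ λ X e → IsInt X × fromℤ x ≡ D * X × IsUnit e × One.norm X (fromℤ y) ≡ 4ℚ * e × IsEven (X - fromℤ y)

  -- d divides x² = d(±4 - m′y²), hence x, as it is square-free; dividing by d gives the norm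
  -- equation. The norm is even while d and m′ are odd, so X and y have the same parity.
  equation⇒solution₁ : ∀ {x y} → Equation one x y → Solution₁ x y
  equation⇒solution₁ {x} {y} equation = go (≡±⇒unit {b = + 4 ℤ.* d} equation)
    where
    Y : ℚ
    Y = fromℤ y
    go : (∃ λ e → IsUnit e × fromℤ (x ℤ.* x ℤ.+ m ℤ.* (y ℤ.* y)) ≡ fromℤ (+ 4 ℤ.* d) * e) → Solution₁ x y
    go (e , unit , eq) = finish (squarefree-divides {d} {x} d-sf (4ᴵ *ᴵ unit⇒int unit -ᴵ int m′ *ᴵ (int y *ᴵ int y)) (combine 1ℚ eq′ (identity D M′ Y e (fromℤ x))))
      where
      eq′ : fromℤ x * fromℤ x + D * M′ * (Y * Y) ≡ 4ℚ * D * e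
      eq′ = trans (cong (λ u → fromℤ x * fromℤ x + u * (Y * Y)) (sym M≡DM′))
        (trans (sym (fromℤ-form x m y)) (trans eq (cong (_* e) (fromℤ-* (+ 4) d))))
      identity : ∀ D M′ Y e x → x * x - (4ℚ * e - M′ * (Y * Y)) * D ≡ 1ℚ * (x * x + D * M′ * (Y * Y) - 4ℚ * D * e)
      identity = solve-∀ ℚ-ring
      finish : (∃ λ X → IsInt X × fromℤ x ≡ D * X) → Solution₁ x y
      finish (X , X-int , x≡DX) = X , e , X-int , x≡DX , unit , norm≡4e , even (parity X-int) (parity (int y))
        where
        norm≡4e : One.norm X Y ≡ 4ℚ * e
        norm≡4e = *-cancelˡ D≢0 (combine 1ℚ (trans (cong (λ u → u * u + D * M′ * (Y * Y)) (sym x≡DX)) eq′) (identity′ D M′ X Y e))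
          where
          identity′ : ∀ D M′ X Y e → D * (D * (X * X) + M′ * (Y * Y)) - D * (4ℚ * e) ≡
            1ℚ * (D * X * (D * X) + D * M′ * (Y * Y) - 4ℚ * D * e)
          identity′ = solve-∀ ℚ-ring
        norm-even : IsEven (One.norm X Y)
        norm-even = 2ℚ * e , 2ᴵ *ᴵ unit⇒int unit , trans norm≡4e (ℚₚ.*-assoc 2ℚ 2ℚ e)
        even : IsEven X ⊎ IsOdd X → IsEven Y ⊎ IsOdd Y → IsEven (X - Y)
        even (inj₁ X-even) (inj₁ Y-even) = even-even X-even Y-even
        even (inj₂ X-odd) (inj₂ Y-odd) = odd-odd X-odd Y-odd
        even (inj₂ X-odd) (inj₁ Y-even) = ⊥-elim (odd-even-⊥
          (odd+even (odd*odd D-odd (odd*odd X-odd X-odd)) (int*even (int m′) (even*int Y-even (int y)))) norm-even)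
        even (inj₁ X-even) (inj₂ Y-odd) = ⊥-elim (odd-even-⊥
          (even+odd (int*even (int d) (even*int X-even X-int)) (odd*odd M′-odd (odd*odd Y-odd Y-odd))) norm-even)

  -- (x - dy)/(2d) = (X - y)/2, and the y/2 contributed by γ₄ completes the coefficient of √n to
  -- X/2.
  β₁-coordinates : ∀ {x y X} → fromℤ x ≡ D * X → toCoordinates one (β one x y) ≡ (1ℚ , 1ℚ , X , fromℤ y)
  β₁-coordinates {x} {y} {X} x≡DX = trans
    (cong (toCoordinates one) (trans (cong₂ (λ u q → γ₁ +ᴸ u +ᴸ q · γ₃ +ᴸ Y · γ₄) (sym (·-identity γ₂)) quotient) (γ-combination 1ℚ (½ * (X - Y)) Y)))
    (quadruple refl refl (identity X Y) (2D[y[½1/d]] Y))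
    where
    Y : ℚ
    Y = fromℤ y
    2d≢0 : ℤ.NonZero (+ 2 ℤ.* d)
    2d≢0 = ℤₚ.i*j≢0 (+ 2) d {{_}} {{d≢0}}
    quotient : ((x ℤ.- d ℤ.* y) // (+ 2 ℤ.* d)) {{2d≢0}} ≡ ½ * (X - Y)
    quotient = //-unique {x ℤ.- d ℤ.* y} 2d≢0 (trans (fromℤ-x-dy x d y) (trans (cong (λ u → u - D * Y) x≡DX)
      (trans (identity′ D X Y) (cong (_* (½ * (X - Y))) (sym (fromℤ-* (+ 2) d))))))
      where
      identity′ : ∀ D X Y → D * X - D * Y ≡ 2ℚ * D * (½ * (X - Y))
      identity′ = solve-∀ ℚ-ring
    identity : ∀ X Y → 2ℚ * (½ * (X - Y) + Y * ½) ≡ X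
    identity = solve-∀ ℚ-ring

  generator⇒equation₁ : ∀ {w z e} → IsInt w → IsInt z → IsUnit e → One.norm w z ≡ 4ℚ * e → ∃ λ x → ∃ λ y → Equation one x y
  -- The witnesses x = dw and y = z invert the substitution x = dX.
  generator⇒equation₁ {e = e} (w , refl) (z , refl) unit eq = d ℤ.* w , z , unit⇒≡± {b = + 4 ℤ.* d} unit (begin
    fromℤ (d ℤ.* w ℤ.* (d ℤ.* w) ℤ.+ m ℤ.* (z ℤ.* z)) ≡⟨ fromℤ-form (d ℤ.* w) m z ⟩
    fromℤ (d ℤ.* w) * fromℤ (d ℤ.* w) + M * (Z * Z) ≡⟨ cong₂ (λ u v → u * u + v * (Z * Z)) (fromℤ-* d w) M≡DM′ ⟩
    D * W * (D * W) + D * M′ * (Z * Z) ≡⟨ identity D M′ W Z ⟩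
    D * (D * (W * W) + M′ * (Z * Z)) ≡⟨ cong (D *_) eq ⟩
    D * (4ℚ * e) ≡⟨ identity′ D e ⟩
    4ℚ * D * e ≡⟨ cong (_* e) (fromℤ-* (+ 4) d) ⟨
    fromℤ (+ 4 ℤ.* d) * e ∎)
    where
    open ≡-Reasoning
    W Z : ℚ
    W = fromℤ w
    Z = fromℤ z
    identity : ∀ D M′ W Z → D * W * (D * W) + D * M′ * (Z * Z) ≡ D * (D * (W * W) + M′ * (Z * Z))
    identity = solve-∀ ℚ-ring
    identity′ : ∀ D e → D * (4ℚ * e) ≡ 4ℚ * D * e
    identity′ = solve-∀ ℚ-ring

  -- Case ζ = √n: a solution satisfies x = 2db, and 2db² + hy² = ±1.

  Solution₂ : ℤ → ℤ → Set
  Solution₂ x y = ∃ λ b → IsInt b × fromℤ x ≡ 2ℚ * D * b × IsUnit (Two.norm b (fromℤ y)) × IsEven (1ℚ - fromℤ y)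

  -- The square-free d divides x² and so x = dX. Then dX² = 2(±1 - hy²) with d odd forces X = 2b,
  -- and an even y would make ±1 even.
  equation⇒solution₂ : ∀ {x y} → Equation two x y → Solution₂ x y
  equation⇒solution₂ {x} {y} equation = go (≡±⇒unit {b = + 2 ℤ.* d} equation)
    where
    Y : ℚ
    Y = fromℤ y
    go : (∃ λ e → IsUnit e × fromℤ (x ℤ.* x ℤ.+ n ℤ.* (y ℤ.* y)) ≡ fromℤ (+ 2 ℤ.* d) * e) → Solution₂ x y
    go (e , unit , eq) = finish (squarefree-divides {d} {x} d-sf (2ᴵ *ᴵ unit⇒int unit -ᴵ 2ᴵ *ᴵ int h *ᴵ (int y *ᴵ int y)) (combine 1ℚ eq′ (identity D H Y e (fromℤ x))))
      where
      eq′ : fromℤ x * fromℤ x + D * (2ℚ * H) * (Y * Y) ≡ 2ℚ * D * e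
      eq′ = trans (cong (λ u → fromℤ x * fromℤ x + u * (Y * Y)) (sym N≡D2H))
        (trans (sym (fromℤ-form x n y)) (trans eq (cong (_* e) (fromℤ-* (+ 2) d))))
      identity : ∀ D H Y e x → x * x - (2ℚ * e - 2ℚ * H * (Y * Y)) * D ≡ 1ℚ * (x * x + D * (2ℚ * H) * (Y * Y) - 2ℚ * D * e)
      identity = solve-∀ ℚ-ring
      finish : (∃ λ X → IsInt X × fromℤ x ≡ D * X) → Solution₂ x y
      finish (X , X-int , x≡DX) = choose (parity X-int)
        where
        DX²≡ : D * (X * X) ≡ 2ℚ * (e - H * (Y * Y))
        DX²≡ = *-cancelˡ D≢0 (combine 1ℚ (trans (cong (λ u → u * u + D * (2ℚ * H) * (Y * Y)) (sym x≡DX)) eq′) (identity′ D H X Y e))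
          where
          identity′ : ∀ D H X Y e → D * (D * (X * X)) - D * (2ℚ * (e - H * (Y * Y))) ≡
            1ℚ * (D * X * (D * X) + D * (2ℚ * H) * (Y * Y) - 2ℚ * D * e)
          identity′ = solve-∀ ℚ-ring
        choose : IsEven X ⊎ IsOdd X → Solution₂ x y
        choose (inj₂ X-odd) = ⊥-elim (odd-even-⊥ (odd*odd D-odd (odd*odd X-odd X-odd))
          (e - H * (Y * Y) , unit⇒int unit -ᴵ int h *ᴵ (int y *ᴵ int y) , DX²≡))
        choose (inj₁ (b , b-int , X≡2b)) = b , b-int , trans x≡DX (trans (cong (D *_) X≡2b) (swap D b)) ,
          subst IsUnit (sym norm≡e) unit , 1-Y-even (parity (int y))
          where
          swap : ∀ D b → D * (2ℚ * b) ≡ 2ℚ * D * b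
          swap = solve-∀ ℚ-ring
          norm≡e : Two.norm b Y ≡ e
          norm≡e = *-cancelˡ 2≢0 (combine 1ℚ (trans (cong (λ u → D * (u * u)) (sym X≡2b)) DX²≡) (identity′ D H b Y e))
            where
            identity′ : ∀ D H b Y e → 2ℚ * (2ℚ * D * (b * b) + H * (Y * Y)) - 2ℚ * e ≡
              1ℚ * (D * (2ℚ * b * (2ℚ * b)) - 2ℚ * (e - H * (Y * Y)))
            identity′ = solve-∀ ℚ-ring
          1-Y-even : IsEven Y ⊎ IsOdd Y → IsEven (1ℚ - Y)
          1-Y-even (inj₂ Y-odd) = odd-odd 1-odd Y-odd
          1-Y-even (inj₁ (t , t-int , Y≡2t)) = ⊥-elim (odd-even-⊥ (unit-odd unit)
            (D * (b * b) + H * (2ℚ * (t * t)) , int d *ᴵ (b-int *ᴵ b-int) +ᴵ int h *ᴵ (2ᴵ *ᴵ (t-int *ᴵ t-int)) ,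
              trans (sym norm≡e) (trans (cong (Two.norm b) Y≡2t) (identity′ D H b t))))
            where
            identity′ : ∀ D H b t → 2ℚ * D * (b * b) + H * (2ℚ * t * (2ℚ * t)) ≡ 2ℚ * (D * (b * b) + H * (2ℚ * (t * t)))
            identity′ = solve-∀ ℚ-ring

  -- The coefficient (1 - y)/2 of γ₃ and the y/2 from γ₄ add up to 1/2, which makes v = 1.
  β₂-coordinates : ∀ {x y b} → fromℤ x ≡ 2ℚ * D * b → toCoordinates two (β two x y) ≡ (1ℚ , 1ℚ , b , fromℤ y)
  β₂-coordinates {x} {y} {b} x≡2Db = trans
    (cong (toCoordinates two) (trans (cong₂ (λ p q → γ₁ +ᴸ p · γ₂ +ᴸ q · γ₃ +ᴸ Y · γ₄) quotient₁ quotient₂) (γ-combination b (½ * (1ℚ - Y)) Y)))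
    (quadruple refl (identity Y) refl (2D[y[½1/d]] Y))
    where
    Y : ℚ
    Y = fromℤ y
    2d≢0 : ℤ.NonZero (+ 2 ℤ.* d)
    2d≢0 = ℤₚ.i*j≢0 (+ 2) d {{_}} {{d≢0}}
    quotient₁ : (x // (+ 2 ℤ.* d)) {{2d≢0}} ≡ b
    quotient₁ = //-unique {x} 2d≢0 (trans x≡2Db (cong (_* b) (sym (fromℤ-* (+ 2) d))))
    quotient₂ : (+ 1 ℤ.- y) // + 2 ≡ ½ * (1ℚ - Y)
    quotient₂ = //-unique {+ 1 ℤ.- y} {+ 2} _ (trans (fromℤ-+ (+ 1) (ℤ.- y)) (trans (cong (λ u → 1ℚ + u) (fromℤ-neg y)) (identity′ Y)))
      where
      identity′ : ∀ Y → 1ℚ - Y ≡ 2ℚ * (½ * (1ℚ - Y))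
      identity′ = solve-∀ ℚ-ring
    identity : ∀ Y → 2ℚ * (½ * (1ℚ - Y) + Y * ½) ≡ 1ℚ
    identity = solve-∀ ℚ-ring

  generator⇒equation₂ : ∀ {w z} → IsInt w → IsInt z → IsUnit (Two.norm w z) → ∃ λ x → ∃ λ y → Equation two x y
  generator⇒equation₂ (w , refl) (z , refl) unit = + 2 ℤ.* d ℤ.* w , z , unit⇒≡± {b = + 2 ℤ.* d} unit (begin
    fromℤ (2d ℤ.* w ℤ.* (2d ℤ.* w) ℤ.+ n ℤ.* (z ℤ.* z)) ≡⟨ fromℤ-form (2d ℤ.* w) n z ⟩
    fromℤ (2d ℤ.* w) * fromℤ (2d ℤ.* w) + N * (Z * Z) ≡⟨ cong₂ (λ u v → u * u + v * (Z * Z)) (trans (fromℤ-* 2d w) (cong (_* W) (fromℤ-* (+ 2) d))) N≡D2H ⟩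
    2ℚ * D * W * (2ℚ * D * W) + D * (2ℚ * H) * (Z * Z) ≡⟨ identity D H W Z ⟩
    2ℚ * D * Two.norm W Z ≡⟨ cong (_* Two.norm W Z) (fromℤ-* (+ 2) d) ⟨
    fromℤ 2d * Two.norm W Z ∎)
    where
    open ≡-Reasoning
    2d : ℤ
    2d = + 2 ℤ.* d
    W Z : ℚ
    W = fromℤ w
    Z = fromℤ z
    identity : ∀ D H W Z → 2ℚ * D * W * (2ℚ * D * W) + D * (2ℚ * H) * (Z * Z) ≡ 2ℚ * D * (2ℚ * D * (W * W) + H * (Z * Z))
    identity = solve-∀ ℚ-ring

  -- Case ζ = √k: a solution satisfies x = 2hX and y = 2b, and 2m′b² + hX² = ±1.

  Solution₃ : ℤ → ℤ → Set
  Solution₃ x y = ∃₂ λ X b → IsInt X × IsInt b × fromℤ x ≡ 2ℚ * H * X × fromℤ y ≡ 2ℚ * b × IsUnit (Three.norm b X) × IsEven (1ℚ - X)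

  -- With k = 2hm′ and n/d = 2h, the square-free 2h divides x² = 2h(±2 - m′y²), so x = 2hX. Then
  -- m′y² = 2(±1 - hX²) forces y = 2b, and an even X would make ±1 even.
  equation⇒solution₃ : ∀ {x y} → Equation three x y → Solution₃ x y
  equation⇒solution₃ {x} {y} equation = go (≡±⇒unit {b = + 2 ℤ.* (+ 2 ℤ.* h)}
      (subst₂ (λ k n/d → (x ℤ.* x ℤ.+ k ℤ.* (y ℤ.* y)) ≡± (+ 2 ℤ.* n/d)) k≡ n/d≡ equation))
    where
    Y : ℚ
    Y = fromℤ y
    2h : ℤ
    2h = + 2 ℤ.* h
    go : (∃ λ e → IsUnit e × fromℤ (x ℤ.* x ℤ.+ m′ ℤ.* 2h ℤ.* (y ℤ.* y)) ≡ fromℤ (+ 2 ℤ.* 2h) * e) → Solution₃ x y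
    go (e , unit , eq) = finish (squarefree-divides {2h} {x} 2h-sf (2ᴵ *ᴵ unit⇒int unit -ᴵ int m′ *ᴵ (int y *ᴵ int y))
        (trans (combine 1ℚ eq′ (identity M′ H Y e (fromℤ x))) (cong ((2ℚ * e - M′ * (Y * Y)) *_) (sym (fromℤ-* (+ 2) h)))))
      where
      eq′ : fromℤ x * fromℤ x + M′ * (2ℚ * H) * (Y * Y) ≡ 2ℚ * (2ℚ * H) * e
      eq′ = trans (cong (λ u → fromℤ x * fromℤ x + u * (Y * Y)) (sym K≡))
        (trans (sym (fromℤ-form x (m′ ℤ.* 2h) y)) (trans eq (cong (_* e) (trans (fromℤ-* (+ 2) 2h) (cong (2ℚ *_) (fromℤ-* (+ 2) h))))))
      identity : ∀ M′ H Y e x → x * x - (2ℚ * e - M′ * (Y * Y)) * (2ℚ * H) ≡ 1ℚ * (x * x + M′ * (2ℚ * H) * (Y * Y) - 2ℚ * (2ℚ * H) * e)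
      identity = solve-∀ ℚ-ring
      finish : (∃ λ X → IsInt X × fromℤ x ≡ fromℤ 2h * X) → Solution₃ x y
      finish (X , X-int , x≡2hX) = choose (parity (int y))
        where
        x≡2HX : fromℤ x ≡ 2ℚ * H * X
        x≡2HX = trans x≡2hX (cong (_* X) (fromℤ-* (+ 2) h))
        2H≢0 : 2ℚ * H ≢ 0ℚ
        2H≢0 eq = odd-even-⊥ H-odd (0ℚ , 0ᴵ , p*q≡0⇒q≡0 2≢0 eq)
        M′Y²≡ : M′ * (Y * Y) ≡ 2ℚ * (e - H * (X * X))
        M′Y²≡ = *-cancelˡ 2H≢0 (combine 1ℚ (trans (cong (λ u → u * u + M′ * (2ℚ * H) * (Y * Y)) (sym x≡2HX)) eq′) (identity′ M′ H X Y e))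
          where
          identity′ : ∀ M′ H X Y e → 2ℚ * H * (M′ * (Y * Y)) - 2ℚ * H * (2ℚ * (e - H * (X * X))) ≡
            1ℚ * (2ℚ * H * X * (2ℚ * H * X) + M′ * (2ℚ * H) * (Y * Y) - 2ℚ * (2ℚ * H) * e)
          identity′ = solve-∀ ℚ-ring
        choose : IsEven Y ⊎ IsOdd Y → Solution₃ x y
        choose (inj₂ Y-odd) = ⊥-elim (odd-even-⊥ (odd*odd M′-odd (odd*odd Y-odd Y-odd))
          (e - H * (X * X) , unit⇒int unit -ᴵ int h *ᴵ (X-int *ᴵ X-int) , M′Y²≡))
        choose (inj₁ (b , b-int , Y≡2b)) = X , b , X-int , b-int , x≡2HX , Y≡2b , subst IsUnit (sym norm≡e) unit , 1-X-even (parity X-int)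
          where
          norm≡e : Three.norm b X ≡ e
          norm≡e = *-cancelˡ 2≢0 (combine 1ℚ (trans (cong (λ u → M′ * (u * u)) (sym Y≡2b)) M′Y²≡) (identity′ M′ H b X e))
            where
            identity′ : ∀ M′ H b X e → 2ℚ * (2ℚ * M′ * (b * b) + H * (X * X)) - 2ℚ * e ≡
              1ℚ * (M′ * (2ℚ * b * (2ℚ * b)) - 2ℚ * (e - H * (X * X)))
            identity′ = solve-∀ ℚ-ring
          1-X-even : IsEven X ⊎ IsOdd X → IsEven (1ℚ - X)
          1-X-even (inj₂ X-odd) = odd-odd 1-odd X-odd
          1-X-even (inj₁ (t , t-int , X≡2t)) = ⊥-elim (odd-even-⊥ (unit-odd unit)
            (M′ * (b * b) + H * (2ℚ * (t * t)) , int m′ *ᴵ (b-int *ᴵ b-int) +ᴵ int h *ᴵ (2ᴵ *ᴵ (t-int *ᴵ t-int)) ,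
              trans (sym norm≡e) (trans (cong (Three.norm b) X≡2t) (identity′ M′ H b t))))
            where
            identity′ : ∀ M′ H b t → 2ℚ * M′ * (b * b) + H * (2ℚ * t * (2ℚ * t)) ≡ 2ℚ * (M′ * (b * b) + H * (2ℚ * (t * t)))
            identity′ = solve-∀ ℚ-ring

  -- As xd = nX, the coefficient of γ₃ is (X - 1)/2; adding γ₄ raises it to X/2 and makes v = 1.
  β₃-coordinates : ∀ {x y X b} → fromℤ x ≡ 2ℚ * H * X → fromℤ y ≡ 2ℚ * b → toCoordinates three (β three x y) ≡ (1ℚ , 1ℚ , b , X)
  β₃-coordinates {x} {y} {X} {b} x≡2HX y≡2b = trans
    (cong (toCoordinates three) (trans (trans (cong (λ u → β′ +ᴸ u) (sym (·-identity γ₄))) (cong₂ (λ p q → γ₁ +ᴸ p · γ₂ +ᴸ q · γ₃ +ᴸ 1ℚ · γ₄) quotient₁ quotient₂))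
      (γ-combination b (½ * (X - 1ℚ)) 1ℚ)))
    (quadruple refl (2D[y[½1/d]] 1ℚ) refl (identity X))
    where
    2n≢0 : ℤ.NonZero (+ 2 ℤ.* n)
    2n≢0 = ℤₚ.i*j≢0 (+ 2) n {{_}} {{squarefree⇒nonZero n n-sf}}
    β′ : L
    β′ = γ₁ +ᴸ (y // + 2) · γ₂ +ᴸ ((x ℤ.* d ℤ.- n) // (+ 2 ℤ.* n)) {{2n≢0}} · γ₃
    quotient₁ : y // + 2 ≡ b
    quotient₁ = //-unique {y} {+ 2} _ y≡2b
    quotient₂ : ((x ℤ.* d ℤ.- n) // (+ 2 ℤ.* n)) {{2n≢0}} ≡ ½ * (X - 1ℚ)
    quotient₂ = //-unique {x ℤ.* d ℤ.- n} 2n≢0 (begin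
      fromℤ (x ℤ.* d ℤ.- n) ≡⟨ fromℤ-+ (x ℤ.* d) (ℤ.- n) ⟩
      fromℤ (x ℤ.* d) + fromℤ (ℤ.- n) ≡⟨ cong₂ _+_ (fromℤ-* x d) (fromℤ-neg n) ⟩
      fromℤ x * D - N ≡⟨ cong₂ (λ u v → u * D - v) x≡2HX N≡D2H ⟩
      2ℚ * H * X * D - D * (2ℚ * H) ≡⟨ identity′ D H X ⟩
      2ℚ * (D * (2ℚ * H)) * (½ * (X - 1ℚ)) ≡⟨ cong (λ u → 2ℚ * u * (½ * (X - 1ℚ))) N≡D2H ⟨
      2ℚ * N * (½ * (X - 1ℚ)) ≡⟨ cong (_* (½ * (X - 1ℚ))) (fromℤ-* (+ 2) n) ⟨
      fromℤ (+ 2 ℤ.* n) * (½ * (X - 1ℚ)) ∎)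
      where
      open ≡-Reasoning
      identity′ : ∀ D H X → 2ℚ * H * X * D - D * (2ℚ * H) ≡ 2ℚ * (D * (2ℚ * H)) * (½ * (X - 1ℚ))
      identity′ = solve-∀ ℚ-ring
    identity : ∀ X → 2ℚ * (½ * (X - 1ℚ) + 1ℚ * ½) ≡ X
    identity = solve-∀ ℚ-ring

  generator⇒equation₃ : ∀ {w z} → IsInt w → IsInt z → IsUnit (Three.norm w z) → ∃ λ x → ∃ λ y → Equation three x y
  -- The witnesses invert x = 2hX and y = 2b, with z in the role of X and w in that of b.
  generator⇒equation₃ (w , refl) (z , refl) unit = 2h ℤ.* z , + 2 ℤ.* w ,
    subst₂ (λ k n/d → (2h ℤ.* z ℤ.* (2h ℤ.* z) ℤ.+ k ℤ.* (+ 2 ℤ.* w ℤ.* (+ 2 ℤ.* w))) ≡± (+ 2 ℤ.* n/d)) (sym k≡) (sym n/d≡)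
    (unit⇒≡± {b = + 2 ℤ.* 2h} unit (begin
      fromℤ (2h ℤ.* z ℤ.* (2h ℤ.* z) ℤ.+ m′ ℤ.* 2h ℤ.* (+ 2 ℤ.* w ℤ.* (+ 2 ℤ.* w)))
        ≡⟨ fromℤ-form (2h ℤ.* z) (m′ ℤ.* 2h) (+ 2 ℤ.* w) ⟩
      fromℤ (2h ℤ.* z) * fromℤ (2h ℤ.* z) + fromℤ (m′ ℤ.* 2h) * (fromℤ (+ 2 ℤ.* w) * fromℤ (+ 2 ℤ.* w))
        ≡⟨ cong₂ _+_ (cong (λ u → u * u) (trans (fromℤ-* 2h z) (cong (_* Z) (fromℤ-* (+ 2) h))))
             (cong₂ (λ u v → u * (v * v)) K≡ (fromℤ-* (+ 2) w)) ⟩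
      2ℚ * H * Z * (2ℚ * H * Z) + M′ * (2ℚ * H) * (2ℚ * W * (2ℚ * W))
        ≡⟨ identity M′ H W Z ⟩
      2ℚ * (2ℚ * H) * Three.norm W Z
        ≡⟨ cong (_* Three.norm W Z) (trans (fromℤ-* (+ 2) 2h) (cong (2ℚ *_) (fromℤ-* (+ 2) h))) ⟨
      fromℤ (+ 2 ℤ.* 2h) * Three.norm W Z ∎))
    where
    open ≡-Reasoning
    2h : ℤ
    2h = + 2 ℤ.* h
    W Z : ℚ
    W = fromℤ w
    Z = fromℤ z
    identity : ∀ M′ H W Z → 2ℚ * H * Z * (2ℚ * H * Z) + M′ * (2ℚ * H) * (2ℚ * W * (2ℚ * W)) ≡
      2ℚ * (2ℚ * H) * (2ℚ * M′ * (W * W) + H * (Z * Z))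
    identity = solve-∀ ℚ-ring

  generator⇒equation : ∀ i {τ σ β} → IsGaloisPair (ζ i) τ σ → IsFreeGenerator (HopfGalois (ζ i) τ σ) β → ∃ λ x → ∃ λ y → Equation i x y
  generator⇒equation one {τ} {σ} {β@(⟨ a , b , c , e ⟩)} pair gen =
    let s , s-unit , τ-eq , σ-eq = galoisPair-explicit one pair
        β∈O , onto = Transfer.generator⇒onto one {τ} {σ} {s} s-unit τ-eq σ-eq One.O (λ {x} → integral⇒One {x}) (λ {v} → One⇒integral {v}) {β} gen
        _ , _ , w-int , z-int , _ = β∈O
        ε , ε-unit , norm≡4ε = One.generator⇒unit {a} {b} {2ℚ * c} {2ℚ * D * e} β∈O onto
    in generator⇒equation₁ {2ℚ * c} {2ℚ * D * e} {ε} w-int z-int ε-unit norm≡4ε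
  generator⇒equation two {τ} {σ} {β@(⟨ a , b , c , e ⟩)} pair gen =
    let s , s-unit , τ-eq , σ-eq = galoisPair-explicit two pair
        β∈O , onto = Transfer.generator⇒onto two {τ} {σ} {s} s-unit τ-eq σ-eq Two.O (λ {x} → integral⇒Two {x}) (λ {v} → Two⇒integral {v}) {β} gen
        _ , _ , w-int , z-int , _ = β∈O
    in generator⇒equation₂ {b} {2ℚ * D * e} w-int z-int (Two.generator⇒unit {a} {2ℚ * c} {b} {2ℚ * D * e} β∈O onto)
  generator⇒equation three {τ} {σ} {β@(⟨ a , b , c , e ⟩)} pair gen =
    let s , s-unit , τ-eq , σ-eq = galoisPair-explicit three pair
        β∈O , onto = Transfer.generator⇒onto three {τ} {σ} {s} s-unit τ-eq σ-eq Three.O (λ {x} → integral⇒Three {x}) (λ {v} → Three⇒integral {v}) {β} gen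
        _ , _ , w-int , z-int , _ = β∈O
    in generator⇒equation₃ {b} {2ℚ * c} w-int z-int (Three.generator⇒unit {a} {2ℚ * D * e} {b} {2ℚ * c} β∈O onto)

  equation⇒generator : ∀ i {τ σ} → IsGaloisPair (ζ i) τ σ → ∀ x y → Equation i x y → IsFreeGenerator (HopfGalois (ζ i) τ σ) (β i x y)
  equation⇒generator one {τ} {σ} pair x y equation =
    let s , s-unit , τ-eq , σ-eq = galoisPair-explicit one pair
        X , e , X-int , x≡ , e-unit , norm≡4e , even = equation⇒solution₁ {x} {y} equation
        β∈O : One.O (1ℚ , 1ℚ , X , fromℤ y)
        β∈O = 1ᴵ , 1ᴵ , X-int , int y , even
    in Transfer.onto⇒generator one {τ} {σ} {s} s-unit τ-eq σ-eq One.O (λ {x} → integral⇒One {x}) (λ {v} → One⇒integral {v})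
      {β one x y} {X} {fromℤ y} (β₁-coordinates {x} {y} {X} x≡)
      (λ norm≡0 → unit≢0 e-unit (p*q≡0⇒q≡0 {4ℚ} {e} 4≢0 (trans (sym norm≡4e) norm≡0))) β∈O (One.unit⇒generator {X} {fromℤ y} {e} β∈O e-unit norm≡4e)
  equation⇒generator two {τ} {σ} pair x y equation =
    let s , s-unit , τ-eq , σ-eq = galoisPair-explicit two pair
        b , b-int , x≡ , unit , even = equation⇒solution₂ {x} {y} equation
        β∈O : Two.O (1ℚ , 1ℚ , b , fromℤ y)
        β∈O = 1ᴵ , 1ᴵ , b-int , int y , even
    in Transfer.onto⇒generator two {τ} {σ} {s} s-unit τ-eq σ-eq Two.O (λ {x} → integral⇒Two {x}) (λ {v} → Two⇒integral {v})
      {β two x y} {b} {fromℤ y} (β₂-coordinates {x} {y} {b} x≡) (unit≢0 unit) β∈O (Two.unit⇒generator {b} {fromℤ y} β∈O unit)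
  equation⇒generator three {τ} {σ} pair x y equation =
    let s , s-unit , τ-eq , σ-eq = galoisPair-explicit three pair
        X , b , X-int , b-int , x≡ , y≡ , unit , even = equation⇒solution₃ {x} {y} equation
        β∈O : Three.O (1ℚ , 1ℚ , b , X)
        β∈O = 1ᴵ , 1ᴵ , b-int , X-int , even
    in Transfer.onto⇒generator three {τ} {σ} {s} s-unit τ-eq σ-eq Three.O (λ {x} → integral⇒Three {x}) (λ {v} → Three⇒integral {v})
      {β three x y} {b} {X} (β₃-coordinates {x} {y} {X} {b} x≡ y≡) (unit≢0 unit) β∈O (Three.unit⇒generator {b} {X} β∈O unit)

proposition5p2 : (m n : ℤ) (m-sf : Squarefree m) (n-sf : Squarefree n) →
    m %ℕ 4 ≡ 3 → n %ℕ 4 ≡ 2 →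
    let open Biquadratic m n {{squarefree⇒nonZero m m-sf}} {{squarefree⇒nonZero n n-sf}} in
    (i : Index) (τ σ : L → L) → IsGaloisPair (ζ i) τ σ →
    let H = HopfGalois (ζ i) τ σ in
    (𝒪-IsFree H ⇔ (∃ λ x → ∃ λ y → Equation i x y))
    × (∀ x y → Equation i x y → IsFreeGenerator H (β i x y))
proposition5p2 m n m-sf n-sf m%4 n%4 i τ σ pair =
  mk⇔ (λ (_ , gen) → generator⇒equation i pair gen)
      -- The displayed β is itself the witness of freeness, so this direction reuses the second
      -- claim.
      (λ (x , y , equation) → Biquadratic.β m n {{squarefree⇒nonZero m m-sf}} {{squarefree⇒nonZero n n-sf}} i x y , equation⇒generator i pair x y equation) ,
  equation⇒generator i pair
  where
  open Generators m n m-sf n-sf (decomposition m n m-sf n-sf m%4 n%4) using (generator⇒equation; equation⇒generator)
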